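{- There is an algorithm that, given a connected graph $G$ on $n$ vertices and a treedepth decomposition $T$ of $G$ of depth $t$, finds the size of a minimum dominating set of $G$ in time $O(3^t\log t\cdot n)$ using $O(2^t\,t\log t+t\log n)$ bits of space.
   Context: All graphs are finite and simple; logarithms are base two. A treedepth decomposition of a graph $G$ is a rooted forest with vertex set $V(G)$ such that for every edge $uv\in E(G)$ either $u$ is an ancestor of $v$ or vice versa; since $G$ is connected, it is a tree. Its depth is its height, counted as the number of vertices on a longest root-to-leaf path. A dominating set of $G$ is a set $S\subseteq V(G)$ such that every vertex of $G$ is in $S$ or has a neighbor in $S$. Space refers to working memory, not counting the (read-only) input $G,T$. -}

module Defs where

open import Data.Bool using (Bool; true; false; if_then_else_; _∧_; _∨_; _xor_)
open import Data.Fin using (Fin; zero; toℕ; fromℕ<)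
open import Data.Fin.Subset using (Subset; ∣_∣) renaming (_∈_ to _∈ₛ_)
open import Data.List using (List; []; _∷_; length)
open import Data.List.Membership.Propositional using (_∈_)
open import Data.List.Relation.Unary.Unique.Propositional using (Unique)
open import Data.Maybe using (Maybe; just; nothing)
open import Data.Nat
open import Data.Nat.DivMod using (_/_; _%_)
open import Data.Nat.Properties using (_≟_; _<?_; m^n≢0)
open import Data.Product using (Σ; ∃; _×_; _,_)
open import Data.Sum using (_⊎_)
open import Data.Vec using (Vec; lookup; replicate; _[_]≔_)
open import Function.Bundles using (_⇔_)
open import Relation.Binary.Construct.Closure.ReflexiveTransitive using (Star)
open import Relation.Binary.Core using (Rel)
open import Relation.Binary.Definitions using (Decidable; Irreflexive; Symmetric)
open import Relation.Binary.PropositionalEquality using (_≡_; _≢_)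
open import Relation.Nullary using (yes; no; does)
open import Level using (0ℓ)

------------------------------------------------------------------------
-- Graphs, dominating sets

record Graph (n : ℕ) : Set₁ where
  field
    Adj        : Rel (Fin n) 0ℓ
    adj?       : Decidable Adj
    symmetric  : Symmetric Adj
    irreflexive : Irreflexive _≡_ Adj

open Graph public

-- The graph without vertices does not count as connected.
Connected : ∀ {n} → Graph n → Set
Connected {n} G = Fin n × (∀ u v → Star (Adj G) u v)

Dominating : ∀ {n} → Graph n → Subset n → Set
Dominating G S = ∀ v → v ∈ₛ S ⊎ ∃ λ u → u ∈ₛ S × Adj G v u

IsMinDominatingSetSize : ∀ {n} → Graph n → ℕ → Set
IsMinDominatingSetSize {n} G γ =
  (Σ (Subset n) λ S → Dominating G S × ∣ S ∣ ≡ γ) ×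
  (∀ S → Dominating G S → γ ≤ ∣ S ∣)

------------------------------------------------------------------------
-- Rooted forests, treedepth decompositions

-- RootPath parent v k: following parents, the path between v and a root
-- exists and has k vertices.
data RootPath {n} (parent : Fin n → Maybe (Fin n)) : Fin n → ℕ → Set where
  root : ∀ {v} → parent v ≡ nothing → RootPath parent v 1
  step : ∀ {v u k} → parent v ≡ just u → RootPath parent u k →
         RootPath parent v (suc k)

-- For parent pointers, being a forest means having no cycle, that is,
-- every vertex lies below some root.
record RootedForest (n : ℕ) : Set where
  field
    parent : Fin n → Maybe (Fin n)
    rooted : ∀ v → ∃ (RootPath parent v)

open RootedForest public

-- Reflexive: every vertex is an ancestor of itself.
Ancestor : ∀ {n} → RootedForest n → Fin n → Fin n → Set
Ancestor F u v = Star (λ x y → parent F x ≡ just y) v u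

IsTreedepthDecomposition : ∀ {n} → Graph n → RootedForest n → Set
IsTreedepthDecomposition G F =
  ∀ u v → Adj G u v → Ancestor F u v ⊎ Ancestor F v u

Leaf : ∀ {n} → RootedForest n → Fin n → Set
Leaf F v = ∀ u → parent F u ≢ just v

HasDepth : ∀ {n} → RootedForest n → ℕ → Set
HasDepth F t =
  (∃ λ v → Leaf F v × RootPath (parent F) v t) ×
  (∀ v k → Leaf F v → RootPath (parent F) v k → k ≤ t)

------------------------------------------------------------------------
-- The input: adjacency lists of the graph, and child lists of the forest,
-- in arbitrary order

record InputLists {n} (G : Graph n) (F : RootedForest n) : Set where
  field
    neighbours        : Fin n → List (Fin n)
    neighbours-unique : ∀ v → Unique (neighbours v)
    neighbours-adj    : ∀ v u → u ∈ neighbours v ⇔ Adj G v u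
    -- children nothing lists the roots
    children          : Maybe (Fin n) → List (Fin n)
    children-unique   : ∀ p → Unique (children p)
    children-parent   : ∀ p u → u ∈ children p ⇔ parent F u ≡ p

-- The questions a program may ask about its input; vertices are the numbers
-- below n, and list positions count from 0.
data Query (A : Set) : Set where
  order      : Query A
  degree     : (v : A) → Query A
  neighbour  : (v i : A) → Query A
  rootCount  : Query A
  rootAt     : (i : A) → Query A
  childCount : (v : A) → Query A
  childAt    : (v i : A) → Query A

mapQuery : ∀ {A B : Set} → (A → B) → Query A → Query B
mapQuery f order           = order
mapQuery f (degree v)      = degree (f v)
mapQuery f (neighbour v i) = neighbour (f v) (f i)
mapQuery f rootCount       = rootCount
mapQuery f (rootAt i)      = rootAt (f i)
mapQuery f (childCount v)  = childCount (f v)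
mapQuery f (childAt v i)   = childAt (f v) (f i)

Oracle : Set
Oracle = Query ℕ → ℕ

nth : ∀ {n} → List (Fin n) → ℕ → ℕ
nth []       _       = 0
nth (v ∷ _)  zero    = toℕ v
nth (_ ∷ vs) (suc i) = nth vs i

atVertex : ∀ {n} → (Fin n → ℕ) → ℕ → ℕ
atVertex {n} f v with v <? n
... | yes v<n = f (fromℕ< v<n)
... | no  _   = 0

-- Meaningless questions are answered by 0.
oracle : ∀ {n} {G : Graph n} {F : RootedForest n} → InputLists G F → Oracle
oracle {n} I = answer
  where
  open InputLists I
  answer : Oracle
  answer order           = n
  answer (degree v)      = atVertex (λ x → length (neighbours x)) v
  answer (neighbour v i) = atVertex (λ x → nth (neighbours x) i) v
  answer rootCount       = length (children nothing)
  answer (rootAt i)      = nth (children nothing) i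
  answer (childCount v)  = atVertex (λ x → length (children (just x))) v
  answer (childAt v i)   = atVertex (λ x → nth (children (just x)) i) v

------------------------------------------------------------------------
-- Programs for a word RAM: a fixed number k of registers, a working memory
-- addressed by words, and a read-only input

data Op : Set where
  add sub mul quo rem and or xor shl shr lt eq : Op

data Operand (k : ℕ) : Set where
  reg : Fin k → Operand k
  imm : ℕ → Operand k

data Cmd (k : ℕ) : Set where
  skip   : Cmd k
  calc   : (dst : Fin k) → Op → (x y : Operand k) → Cmd k
  ask    : (dst : Fin k) → Query (Operand k) → Cmd k
  load   : (dst : Fin k) → (addr : Operand k) → Cmd k
  store  : (addr src : Operand k) → Cmd k
  _⨾_    : Cmd k → Cmd k → Cmd k
  branch : (cond : Operand k) → (nonzero iszero : Cmd k) → Cmd k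
  while  : (cond : Operand k) → (body : Cmd k) → Cmd k

infixr 5 _⨾_

-- Register 0 holds the output.
record Program : Set where
  constructor program
  field
    extra : ℕ
    code  : Cmd (suc extra)

  registers : ℕ
  registers = suc extra

record State (k : ℕ) : Set where
  constructor state
  field
    regs : Vec ℕ k
    mem  : ℕ → ℕ

open State public

initial : ∀ {k} → State k
initial = state (replicate _ 0) (λ _ → 0)

truncate : ℕ → ℕ → ℕ
truncate w x = _%_ x (2 ^ w) {{m^n≢0 2 w}}

fromBool : Bool → ℕ
fromBool b = if b then 1 else 0

isOdd : ℕ → Bool
isOdd x = does (x % 2 ≟ 1)

-- Bitwise operation on the w lowest bits.
bitwise : (Bool → Bool → Bool) → (w x y : ℕ) → ℕ
bitwise f zero    x y = 0
bitwise f (suc w) x y =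
  fromBool (f (isOdd x) (isOdd y)) + 2 * bitwise f w (x / 2) (y / 2)

-- Subtraction is truncated at 0; division by 0 gives quotient and remainder 0.
evalOp : (w : ℕ) → Op → ℕ → ℕ → ℕ
evalOp w add x y       = x + y
evalOp w sub x y       = x ∸ y
evalOp w mul x y       = x * y
evalOp w quo x zero    = 0
evalOp w quo x (suc y) = x / suc y
evalOp w rem x zero    = 0
evalOp w rem x (suc y) = x % suc y
evalOp w and x y       = bitwise _∧_ w x y
evalOp w or  x y       = bitwise _∨_ w x y
evalOp w xor x y       = bitwise _xor_ w x y
evalOp w shl x y       = x * 2 ^ y
evalOp w shr x y       = _/_ x (2 ^ y) {{m^n≢0 2 y}}
evalOp w lt  x y       = fromBool (does (x <? y))
evalOp w eq  x y       = fromBool (does (x ≟ y))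

-- Execution with words of w bits and m words of working memory. All
-- arithmetic is modulo 2 ^ w, every instruction and every test costs one unit
-- of time, and an access to an address outside the memory is stuck.
module Machine (O : Oracle) (w m : ℕ) where

  value : ∀ {k} → State k → Operand k → ℕ
  value s (reg r) = lookup (regs s) r
  value s (imm x) = truncate w x

  setReg : ∀ {k} → State k → Fin k → ℕ → State k
  setReg s r x = state (regs s [ r ]≔ truncate w x) (mem s)

  setMem : ∀ {k} → State k → ℕ → ℕ → State k
  setMem s a x = state (regs s) (λ b → if does (b ≟ a) then x else mem s b)

  -- c , s ⇓ s′ [ τ ]: started in s, command c halts in s′ after τ steps.
  data _,_⇓_[_] {k : ℕ} : Cmd k → State k → State k → ℕ → Set where
    skip : ∀ {s} → skip , s ⇓ s [ 1 ]
    calc : ∀ {s r o x y} →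
      calc r o x y , s ⇓ setReg s r (evalOp w o (value s x) (value s y)) [ 1 ]
    ask : ∀ {s r q} →
      ask r q , s ⇓ setReg s r (O (mapQuery (value s) q)) [ 1 ]
    load : ∀ {s r a} → value s a < m →
      load r a , s ⇓ setReg s r (mem s (value s a)) [ 1 ]
    store : ∀ {s a x} → value s a < m →
      store a x , s ⇓ setMem s (value s a) (value s x) [ 1 ]
    seq : ∀ {c d s s′ s″ τ τ′} →
      c , s ⇓ s′ [ τ ] → d , s′ ⇓ s″ [ τ′ ] → (c ⨾ d) , s ⇓ s″ [ τ + τ′ ]
    branch-nonzero : ∀ {x c d s s′ τ} → value s x ≢ 0 →
      c , s ⇓ s′ [ τ ] → branch x c d , s ⇓ s′ [ suc τ ]
    branch-zero : ∀ {x c d s s′ τ} → value s x ≡ 0 →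
      d , s ⇓ s′ [ τ ] → branch x c d , s ⇓ s′ [ suc τ ]
    while-zero : ∀ {x c s} → value s x ≡ 0 →
      while x c , s ⇓ s [ 1 ]
    while-nonzero : ∀ {x c s s′ s″ τ τ′} → value s x ≢ 0 →
      c , s ⇓ s′ [ τ ] → while x c , s′ ⇓ s″ [ τ′ ] →
      while x c , s ⇓ s″ [ suc (τ + τ′) ]

-- On input O and with words of w bits, the program halts with output out after
-- τ steps and uses σ bits for its registers and its working memory.
Computes : Program → Oracle → (w out τ σ : ℕ) → Set
Computes P O w out τ σ =
  ∃ λ m → let open Machine O w m in
  ∃ λ s → code , initial ⇓ s [ τ ] ×
          lookup (regs s) zero ≡ out ×
          σ ≡ (registers + m) * w
  where open Program P

{-# OPTIONS --safe #-}
-- The program walks through the forest depth first and decides for every vertex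
-- v first to put it into the dominating set and then not to.  For the current
-- selection on the root path it keeps one table, indexed by the sets D of
-- unselected path vertices, of the least cost with which the finished part can
-- be dominated together with D.  Each subtree updates the table in place, so that
-- tables of siblings never have to be combined.  A vertex may also be declared
-- dominated at cost 1: this does not change the optimum, since the vertex could
-- as well have been selected, but it gives M D ≤ M E + ∣D ∖ E∣, so that all
-- entries differ from the one at ∅ by at most t.  Only these differences
-- are stored, packed into words, together with one base value per level.  At
-- depth i the tables of all selections have 3^i entries altogether, which gives
-- the running time, and the tables alive at the same time have O(2^t) entries.
module Submission where

open import Defs
open import Data.Bool using (Bool; true; false; if_then_else_; _∧_; _∨_; not; T)
open import Data.Bool.Properties using (T-∧; T-not-≡)
open import Data.Empty using (⊥; ⊥-elim)
open import Data.Fin using (Fin; zero; suc; toℕ; #_)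
open import Data.Fin.Properties using (toℕ-injective; fromℕ<-toℕ; toℕ<n)
open import Data.Fin.Subset using (Subset; ∣_∣)
open import Data.List using (List; []; _∷_; length; _++_; map; allFin; head)
import Data.List as List
open import Data.List.Extrema.Nat using (argmax; f[xs]≤f[argmax])
open import Data.List.Membership.Propositional using (_∈_)
open import Data.List.Membership.Propositional.Properties using (∈-++⁻; ∈-++⁺ˡ; ∈-++⁺ʳ; ∈-∃++; ∈-allFin)
open import Data.List.Properties using (length-++; map-++; length-map; length-tabulate; map-tabulate)
open import Data.List.Relation.Unary.All using (All; []; _∷_)
import Data.List.Relation.Unary.All as All
open import Data.List.Relation.Unary.AllPairs using ([]; _∷_)
open import Data.List.Relation.Unary.Any using (here; there)
open import Data.List.Relation.Unary.Unique.Propositional using (Unique)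
import Data.List.Relation.Unary.Unique.Propositional.Properties as Unique
open import Data.Maybe using (Maybe; just; nothing)
open import Data.Maybe.Properties using (just-injective)
open import Data.Nat
open import Data.Nat.DivMod
open import Data.Nat.ListAction using (sum)
open import Data.Nat.ListAction.Properties using (sum-++)
open import Data.Nat.Logarithm using (⌈log₂_⌉; ⌈log₂⌉-mono-≤; ⌈log₂2^n⌉≡n; ⌈log₂⌈n/2⌉⌉≡⌈log₂n⌉∸1)
open import Data.Nat.Properties
open import Data.Nat.Tactic.RingSolver using (solve-∀)
open import Data.Product using (Σ; ∃; _×_; _,_; proj₁; proj₂)
open import Data.Sum using (_⊎_; inj₁; inj₂; [_,_]′)
import Data.Sum as Sum
open import Data.Unit using (⊤; tt)
open import Data.Vec using (Vec; lookup; tabulate; replicate; zipWith; _[_]≔_) renaming ([] to []ᵛ; _∷_ to _∷ᵛ_)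
open import Data.Vec.Properties using (lookup∘tabulate; []=⇒lookup; lookup⇒[]=; lookup∘update; lookup∘update′)
open import Function using (_∘_; _$_)
open import Function.Bundles using (module Equivalence)
open import Relation.Binary.Construct.Closure.ReflexiveTransitive using (Star; ε; _◅_)
open import Relation.Binary.PropositionalEquality
open import Relation.Nullary using (Dec; yes; no; does; ¬_)
open import Relation.Nullary.Decidable using (dec-true; dec-false)

-- Symbolic execution of word RAM programs

-- A subtree is traversed once for every selection on its root path, and each time its top vertex
-- must be compared with the path by searching its adjacency list, at a cost of t times its degree.
-- This is affordable because there are at most 2^t selections, against 3^t table entries, and
-- because each edge joins a vertex to an ancestor, so that the degrees sum to O(t n): the
-- comparisons take O(t² 2^t n) steps, and t² 2^t is O(3^t). Correctness consists of two
-- inequalities. In one direction, the choices that attain the minima are traced back from the final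
-- entry, which yields a dominating set of at most that size. In the other, a given dominating set X
-- picks one branch at every vertex; along it the tables satisfy M D ≤ c + ∣D ∖ E∣, where c counts
-- the vertices of X met and E collects the path vertices they dominate, and each pass reproduces
-- this form. Since ∅ is the least entry, all differences are nonnegative; t + 1 bits per cell hold
-- them, and O(2^t) such cells take O(2^t t) bits.

Env : ℕ → Set
Env r = Fin r → ℕ

Mem : Set
Mem = ℕ → ℕ

-- Registers are compared by a Boolean test on numbers, so that looking up a concrete register after
-- a chain of updates evaluates and `refl` settles most side conditions.
set : ∀ {r} → Env r → Fin r → ℕ → Env r
set ρ i x j = if toℕ i ≡ᵇ toℕ j then x else ρ j

poke : Mem → ℕ → ℕ → Mem
poke μ a x = λ b → if does (b ≟ a) then x else μ b

poke-same : ∀ μ a x → poke μ a x a ≡ x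
poke-same μ a x rewrite dec-true (a ≟ a) refl = refl

poke-other : ∀ μ {a b} x → b ≢ a → poke μ a x b ≡ μ b
poke-other μ {a} {b} x b≢a rewrite dec-false (b ≟ a) b≢a = refl

tabulate-set : ∀ {r} (ρ : Env r) i x → tabulate ρ [ i ]≔ x ≡ tabulate (set ρ i x)
tabulate-set ρ zero    x = refl
tabulate-set ρ (suc i) x = cong (ρ zero ∷ᵛ_) (tabulate-set (ρ ∘ suc) i x)

≡ᵇ-refl : ∀ m → (m ≡ᵇ m) ≡ true
≡ᵇ-refl zero    = refl
≡ᵇ-refl (suc m) = ≡ᵇ-refl m

set-same : ∀ {r} (ρ : Env r) i x → set ρ i x i ≡ x
set-same ρ i x rewrite ≡ᵇ-refl (toℕ i) = refl

-- Boolean, so that for concrete programs the implicit arguments of type `T` in the frame rules are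
-- filled in by evaluation.
writes : ∀ {r} → Cmd r → Fin r → Bool
writes skip           j = false
writes (calc i _ _ _) j = toℕ i ≡ᵇ toℕ j
writes (ask i _)      j = toℕ i ≡ᵇ toℕ j
writes (load i _)     j = toℕ i ≡ᵇ toℕ j
writes (store _ _)    j = false
writes (c ⨾ d)        j = writes c j ∨ writes d j
writes (branch _ c d) j = writes c j ∨ writes d j
writes (while _ c)    j = writes c j

stores : ∀ {r} → Cmd r → Bool
stores skip           = false
stores (calc _ _ _ _) = false
stores (ask _ _)      = false
stores (load _ _)     = false
stores (store _ _)    = true
stores (c ⨾ d)        = stores c ∨ stores d
stores (branch _ c d) = stores c ∨ stores d
stores (while _ c)    = stores c

∨-false : ∀ {a b} → (a ∨ b) ≡ false → a ≡ false × b ≡ false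
∨-false {false} {false} _ = refl , refl

Holds : ∀ {r} → Env r → List (Fin r × ℕ) → Set
Holds ρ []             = ⊤
Holds ρ ((i , x) ∷ es) = ρ i ≡ x × Holds ρ es

untouched : ∀ {r} → Cmd r → List (Fin r × ℕ) → Bool
untouched c []             = true
untouched c ((i , _) ∷ es) = not (writes c i) ∧ untouched c es

-- The machine truncates immediate operands, hence the bound.
literal : ∀ {r} → Operand r → Bool
literal (reg _) = true
literal (imm x) = x ≤ᵇ 64

loop : ∀ {r} → Fin r → Fin r → Fin r → Cmd r → Cmd r
loop i f N body =
  calc i add (imm 0) (imm 0) ⨾ calc f lt (reg i) (reg N) ⨾
  while (reg f) (body ⨾ calc i add (reg i) (imm 1) ⨾ calc f lt (reg i) (reg N))

-- Three steps set the counter, make the first comparison and fail the last test; each round adds a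
-- test, an increment and a comparison to the body.
loopTime : ℕ → ℕ → ℕ
loopTime N t = 3 + N * (3 + t)

module Exec (O : Oracle) (w m : ℕ) (64<2^w : 64 < 2 ^ w) where
  open Machine O w m

  Val : ∀ {r} → Env r → Operand r → ℕ → Set
  Val ρ (reg i) v = ρ i ≡ v
  Val ρ (imm x) v = x ≡ v

  config : ∀ {r} → Env r → Mem → State r
  config ρ μ = state (tabulate ρ) μ

  truncate-< : ∀ {x} → x < 2 ^ w → truncate w x ≡ x
  truncate-< x<2^w = m<n⇒m%n≡m {{m^n≢0 2 w}} x<2^w

  value-Val : ∀ {r} (ρ : Env r) μ (x : Operand r) {v} → T (literal x) → Val ρ x v →
              value (config ρ μ) x ≡ v
  value-Val ρ μ (reg i) _ e≡ = trans (lookup∘tabulate ρ i) e≡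
  value-Val ρ μ (imm x) l refl = truncate-< (≤-<-trans (≤ᵇ⇒≤ x 64 l) 64<2^w)

  -- A total-correctness triple with a time bound. Since `Exec` may occur in its own postcondition,
  -- a straight-line program is verified by a chain of `seqE $`.
  record Exec {r} (c : Cmd r) (ρ : Env r) (μ : Mem) (n : ℕ) (Q : Env r → Mem → Set) : Set where
    constructor exec
    field
      {env}  : Env r
      {mem′} : Mem
      {time} : ℕ
      run    : c , config ρ μ ⇓ config env mem′ [ time ]
      time≤  : time ≤ n
      post   : Q env mem′

  private variable
    r : ℕ
    ρ : Env r
    μ : Mem
    c d : Cmd r
    n n′ : ℕ
    Q R : Env r → Mem → Set

  weaken : n ≤ n′ → Exec c ρ μ n Q → Exec c ρ μ n′ Q
  weaken n≤n′ (exec run t≤ q) = exec run (≤-trans t≤ n≤n′) q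

  consequence : (∀ ρ′ μ′ → Q ρ′ μ′ → R ρ′ μ′) → Exec c ρ μ n Q → Exec c ρ μ n R
  consequence f (exec run t≤ q) = exec run t≤ (f _ _ q)

  skipE : Q ρ μ → Exec skip ρ μ 1 Q
  skipE q = exec skip ≤-refl q

  seqE : Exec c ρ μ n (λ ρ′ μ′ → Exec d ρ′ μ′ n′ Q) → Exec (c ⨾ d) ρ μ (n + n′) Q
  seqE (exec run t≤ (exec run′ t′≤ q)) = exec (seq run run′) (+-mono-≤ t≤ t′≤) q

  setReg-config : ∀ (ρ : Env r) μ i {x v} → truncate w x ≡ v →
                  setReg (config ρ μ) i x ≡ config (set ρ i v) μ
  setReg-config ρ μ i refl = cong (λ vs → state vs μ) (tabulate-set ρ i _)

  setReg-< : ∀ {x v} → x ≡ v → v < 2 ^ w → truncate w x ≡ v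
  setReg-< refl v< = truncate-< v<

  -- Overflow is wanted in one place only, where `wordLoop` doubles 1 until it wraps to 0; elsewhere
  -- `calcE` asks for a proof that the result fits into a word.
  calcE-mod : ∀ {i o x y vx vy v} {l : T (literal x ∧ literal y)} →
              Val ρ x vx → Val ρ y vy → truncate w (evalOp w o vx vy) ≡ v →
              Q (set ρ i v) μ → Exec (calc i o x y) ρ μ 1 Q
  calcE-mod {ρ = ρ} {μ = μ} {i = i} {o} {x} {y} {l = l} ex ey ev q =
    exec (subst (λ s → calc i o x y , config ρ μ ⇓ s [ 1 ])
            (setReg-config ρ μ i
              (trans (cong (truncate w) (cong₂ (evalOp w o) (value-Val ρ μ x (proj₁ ls) ex) (value-Val ρ μ y (proj₂ ls) ey))) ev))
            calc)
         ≤-refl q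
    where ls = Equivalence.to T-∧ l

  calcE : ∀ {i o x y vx vy v} {l : T (literal x ∧ literal y)} →
          Val ρ x vx → Val ρ y vy → evalOp w o vx vy ≡ v → v < 2 ^ w →
          Q (set ρ i v) μ → Exec (calc i o x y) ρ μ 1 Q
  calcE {l = l} ex ey ev v< = calcE-mod {l = l} ex ey (setReg-< ev v<)

  ValQuery : Env r → Query (Operand r) → Query ℕ → Set
  ValQuery ρ order           q = order ≡ q
  ValQuery ρ (degree x)      q = ∃ λ v → Val ρ x v × degree v ≡ q
  ValQuery ρ (neighbour x i) q = ∃ λ v → ∃ λ j → Val ρ x v × Val ρ i j × neighbour v j ≡ q
  ValQuery ρ rootCount       q = rootCount ≡ q
  ValQuery ρ (rootAt i)      q = ∃ λ j → Val ρ i j × rootAt j ≡ q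
  ValQuery ρ (childCount x)  q = ∃ λ v → Val ρ x v × childCount v ≡ q
  ValQuery ρ (childAt x i)   q = ∃ λ v → ∃ λ j → Val ρ x v × Val ρ i j × childAt v j ≡ q

  literalQuery : Query (Operand r) → Bool
  literalQuery order           = true
  literalQuery (degree x)      = literal x
  literalQuery (neighbour x i) = literal x ∧ literal i
  literalQuery rootCount       = true
  literalQuery (rootAt i)      = literal i
  literalQuery (childCount x)  = literal x
  literalQuery (childAt x i)   = literal x ∧ literal i

  mapQuery-Val : ∀ (ρ : Env r) μ q {q′} → T (literalQuery q) → ValQuery ρ q q′ →
                 mapQuery (value (config ρ μ)) q ≡ q′
  mapQuery-Val ρ μ order           l refl = refl
  mapQuery-Val ρ μ (degree x)      l (_ , e , refl) = cong degree (value-Val ρ μ x l e)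
  mapQuery-Val ρ μ (neighbour x i) l (_ , _ , e , e′ , refl) =
    cong₂ neighbour (value-Val ρ μ x (proj₁ ls) e) (value-Val ρ μ i (proj₂ ls) e′)
    where ls = Equivalence.to T-∧ l
  mapQuery-Val ρ μ rootCount       l refl = refl
  mapQuery-Val ρ μ (rootAt i)      l (_ , e , refl) = cong rootAt (value-Val ρ μ i l e)
  mapQuery-Val ρ μ (childCount x)  l (_ , e , refl) = cong childCount (value-Val ρ μ x l e)
  mapQuery-Val ρ μ (childAt x i)   l (_ , _ , e , e′ , refl) =
    cong₂ childAt (value-Val ρ μ x (proj₁ ls) e) (value-Val ρ μ i (proj₂ ls) e′)
    where ls = Equivalence.to T-∧ l

  askE : ∀ {i q q′ v} {l : T (literalQuery q)} → ValQuery ρ q q′ → O q′ ≡ v → v < 2 ^ w →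
         Q (set ρ i v) μ → Exec (ask i q) ρ μ 1 Q
  askE {ρ = ρ} {μ = μ} {i = i} {q} {l = l} e≡ ev v< post =
    exec (subst (λ s → ask i q , config ρ μ ⇓ s [ 1 ])
            (setReg-config ρ μ i (setReg-< (trans (cong O (mapQuery-Val ρ μ q l e≡)) ev) v<)) ask)
         ≤-refl post

  loadE : ∀ {i x a v} {l : T (literal x)} → Val ρ x a → a < m → μ a ≡ v → v < 2 ^ w →
          Q (set ρ i v) μ → Exec (load i x) ρ μ 1 Q
  loadE {ρ = ρ} {μ = μ} {i = i} {x} {l = l} ex a< ev v< q =
    exec (subst (λ s → load i x , config ρ μ ⇓ s [ 1 ])
            (setReg-config ρ μ i (setReg-< (trans (cong μ ea) ev) v<))
            (load (subst (_< m) (sym ea) a<)))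
         ≤-refl q
    where ea = value-Val ρ μ x l ex

  storeE : ∀ {x y a v} {l : T (literal x ∧ literal y)} → Val ρ x a → Val ρ y v → a < m →
           Q ρ (poke μ a v) → Exec (store x y) ρ μ 1 Q
  storeE {ρ = ρ} {μ = μ} {x = x} {y} {l = l} ex ey a< q =
    exec (subst (λ s → store x y , config ρ μ ⇓ s [ 1 ])
            (cong₂ (λ a v → state (tabulate ρ) (poke μ a v)) ea (value-Val ρ μ y (proj₂ ls) ey))
            (store (subst (_< m) (sym ea) a<)))
         ≤-refl q
    where
    ls = Equivalence.to T-∧ l
    ea = value-Val ρ μ x (proj₁ ls) ex

  branchE₁ : ∀ {i v} → ρ i ≡ v → v ≢ 0 → Exec c ρ μ n Q → Exec (branch (reg i) c d) ρ μ (suc n) Q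
  branchE₁ {ρ = ρ} {i = i} e v≢0 (exec run t≤ q) =
    exec (branch-nonzero (λ z → v≢0 (trans (sym e) (trans (sym (lookup∘tabulate ρ i)) z))) run) (s≤s t≤) q

  branchE₀ : ∀ {i} → ρ i ≡ 0 → Exec d ρ μ n Q → Exec (branch (reg i) c d) ρ μ (suc n) Q
  branchE₀ {ρ = ρ} {i = i} e (exec run t≤ q) =
    exec (branch-zero (trans (lookup∘tabulate ρ i) e) run) (s≤s t≤) q

  whileE₀ : ∀ {i} → ρ i ≡ 0 → Q ρ μ → Exec (while (reg i) c) ρ μ 1 Q
  whileE₀ {ρ = ρ} {i = i} e q = exec (while-zero (trans (lookup∘tabulate ρ i) e)) ≤-refl q

  whileE₁ : ∀ {i v} → ρ i ≡ v → v ≢ 0 → Exec c ρ μ n (λ ρ′ μ′ → Exec (while (reg i) c) ρ′ μ′ n′ Q) →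
            Exec (while (reg i) c) ρ μ (suc (n + n′)) Q
  whileE₁ {ρ = ρ} {i = i} e v≢0 (exec run t≤ (exec run′ t′≤ q)) =
    exec (while-nonzero (λ z → v≢0 (trans (sym e) (trans (sym (lookup∘tabulate ρ i)) z))) run run′)
         (s≤s (+-mono-≤ t≤ t′≤)) q

  ⇓-writes : ∀ {c : Cmd r} {s s′ τ} → c , s ⇓ s′ [ τ ] → ∀ i → writes c i ≡ false →
             lookup (regs s′) i ≡ lookup (regs s) i
  ⇓-writes skip i e = refl
  ⇓-writes (calc {s = s} {r = j}) i e = lookup-≢ j i (regs s) e
    where
    lookup-≢ : ∀ j i (vs : Vec ℕ r) {x} → (toℕ j ≡ᵇ toℕ i) ≡ false → lookup (vs [ j ]≔ x) i ≡ lookup vs i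
    lookup-≢ zero    (suc i) (v ∷ᵛ vs) e = refl
    lookup-≢ (suc j) zero    (v ∷ᵛ vs) e = refl
    lookup-≢ (suc j) (suc i) (v ∷ᵛ vs) e = lookup-≢ j i vs e
  ⇓-writes (ask {s = s} {r = j}) i e = lookup∘update′ (λ { refl → case (trans (sym e) (≡ᵇ-refl (toℕ i))) }) (regs s) _
    where
    case : false ≡ true → ⊥
    case ()
  ⇓-writes (load {s = s} {r = j} _) i e = lookup∘update′ (λ { refl → case (trans (sym e) (≡ᵇ-refl (toℕ i))) }) (regs s) _
    where
    case : false ≡ true → ⊥
    case ()
  ⇓-writes (store _) i e = refl
  ⇓-writes (seq p q) i e = trans (⇓-writes q i (proj₂ (∨-false e))) (⇓-writes p i (proj₁ (∨-false e)))
  ⇓-writes (branch-nonzero _ p) i e = ⇓-writes p i (proj₁ (∨-false e))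
  ⇓-writes (branch-zero {c = c} _ p) i e = ⇓-writes p i (proj₂ (∨-false {writes c i} e))
  ⇓-writes (while-zero _) i e = refl
  ⇓-writes (while-nonzero _ p q) i e = trans (⇓-writes q i e) (⇓-writes p i e)

  ⇓-stores : ∀ {c : Cmd r} {s s′ τ} → c , s ⇓ s′ [ τ ] → stores c ≡ false → mem s′ ≡ mem s
  ⇓-stores skip e = refl
  ⇓-stores calc e = refl
  ⇓-stores ask e = refl
  ⇓-stores (load _) e = refl
  ⇓-stores (seq p q) e = trans (⇓-stores q (proj₂ (∨-false e))) (⇓-stores p (proj₁ (∨-false e)))
  ⇓-stores (branch-nonzero _ p) e = ⇓-stores p (proj₁ (∨-false e))
  ⇓-stores (branch-zero {c = c} _ p) e = ⇓-stores p (proj₂ (∨-false {stores c} e))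
  ⇓-stores (while-zero _) e = refl
  ⇓-stores (while-nonzero _ p q) e = trans (⇓-stores q e) (⇓-stores p e)

  Frame : Cmd r → Env r → Env r → Set
  Frame c ρ ρ′ = ∀ es → {u : T (untouched c es)} → Holds ρ es → Holds ρ′ es

  -- The run inside the triple shows which registers survive, so the specification of a subprogram
  -- need mention only its results.
  frameE : Exec c ρ μ n (λ ρ′ μ′ → Frame c ρ ρ′ → Q ρ′ μ′) → Exec c ρ μ n Q
  frameE {c = c} {ρ = ρ} (exec {ρ′} run t≤ q) = exec run t≤ (q keep)
    where
    keep : Frame c ρ ρ′
    keep []             _        = tt
    keep ((i , x) ∷ es) {u} (e , h) =
      trans (trans (sym (lookup∘tabulate ρ′ i))
              (trans (⇓-writes run i (Equivalence.to T-not-≡ (proj₁ us))) (lookup∘tabulate ρ i))) e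
      , keep es {proj₂ us} h
      where us = Equivalence.to T-∧ u

  noStoreE : {l : T (not (stores c))} →
             Exec c ρ μ n (λ ρ′ μ′ → μ′ ≡ μ → Q ρ′ μ′) → Exec c ρ μ n Q
  noStoreE {l = l} (exec run t≤ q) = exec run t≤ (q (⇓-stores run (Equivalence.to T-not-≡ l)))

  fromBool-< : ∀ {i N} → i < N → fromBool (does (i <? N)) ≡ 1
  fromBool-< {i} {N} i<N rewrite dec-true (i <? N) i<N = refl

  fromBool-≮ : ∀ N → fromBool (does (N <? N)) ≡ 0
  fromBool-≮ N rewrite dec-false (N <? N) (<-irrefl refl) = refl

  1<2^w : 1 < 2 ^ w
  1<2^w = ≤-<-trans (s≤s z≤n) 64<2^w

  0<2^w : 0 < 2 ^ w
  0<2^w = ≤-<-trans z≤n 64<2^w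

  -- The invariant has to tolerate any value in the counter and the flag, which are overwritten
  -- between rounds; the body receives the value of the counter as a separate hypothesis.
  loopE : ∀ {i f N : Fin r} {body} {V t} (Inv : ℕ → Env r → Mem → Set) →
          {l : T (not (toℕ i ≡ᵇ toℕ N) ∧ not (toℕ f ≡ᵇ toℕ i) ∧ not (toℕ f ≡ᵇ toℕ N))} →
          {l′ : T (not (writes body i) ∧ not (writes body N))} →
          V < 2 ^ w → ρ N ≡ V →
          (∀ {k ρ μ x} → Inv k ρ μ → Inv k (set ρ i x) μ) →
          (∀ {k ρ μ x} → Inv k ρ μ → Inv k (set ρ f x) μ) →
          Inv 0 ρ μ →
          (∀ k ρ μ → k < V → ρ i ≡ k → Inv k ρ μ → Exec body ρ μ t (Inv (suc k))) →
          (∀ ρ μ → Inv V ρ μ → Q ρ μ) →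
          Exec (loop i f N body) ρ μ (loopTime V t) Q
  loopE {r} {ρ = ρ₀} {μ = μ₀} {Q = Q} {i = i} {f} {N} {body} {V} {t} Inv {l} {l′} V< eN si sf init body✓ done =
    seqE (calcE refl refl refl 0<2^w
    (seqE (test 0 (set-same ρ₀ i 0) (trans (other i≢N) eN) z≤n
       (iterate V 0 (+-identityʳ V) (trans (other f≢i) (set-same ρ₀ i 0)) (trans (other f≢N) (trans (other i≢N) eN))
         (set-same (set ρ₀ i 0) f _) (sf (si init))))))
    where
    ls  = Equivalence.to (T-∧ {not (toℕ i ≡ᵇ toℕ N)}) l
    ls′ = Equivalence.to (T-∧ {not (toℕ f ≡ᵇ toℕ i)}) (proj₂ ls)
    i≢N : (toℕ i ≡ᵇ toℕ N) ≡ false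
    i≢N = Equivalence.to T-not-≡ (proj₁ ls)
    f≢i : (toℕ f ≡ᵇ toℕ i) ≡ false
    f≢i = Equivalence.to T-not-≡ (proj₁ ls′)
    f≢N : (toℕ f ≡ᵇ toℕ N) ≡ false
    f≢N = Equivalence.to T-not-≡ (proj₂ ls′)
    wr : T (not (writes body i)) × T (not (writes body N))
    wr = Equivalence.to T-∧ l′
    other : ∀ {b} {x y : ℕ} → b ≡ false → (if b then x else y) ≡ y
    other refl = refl
    test : ∀ {ρ μ Q} k → ρ i ≡ k → ρ N ≡ V → k ≤ V → Q (set ρ f (fromBool (does (k <? V)))) μ →
           Exec (calc f lt (reg i) (reg N)) ρ μ 1 Q
    test k ei eN k≤ q = calcE ei eN refl (≤-<-trans (bit (does (k <? V))) 1<2^w) q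
      where
      bit : ∀ b → fromBool b ≤ 1
      bit true  = ≤-refl
      bit false = z≤n
    iterate : ∀ n k → n + k ≡ V → ∀ {ρ μ} → ρ i ≡ k → ρ N ≡ V → ρ f ≡ fromBool (does (k <? V)) →
              Inv k ρ μ →
              Exec (while (reg f) (body ⨾ calc i add (reg i) (imm 1) ⨾ calc f lt (reg i) (reg N)))
                   ρ μ (suc (n * (3 + t))) Q
    iterate zero k refl ei eN ef inv = whileE₀ (trans ef (fromBool-≮ k)) (done _ _ inv)
    iterate (suc n) k refl {ρ} {μ} ei eN ef inv =
      weaken (s≤s (≤-reflexive arith))
      (whileE₁ (trans ef (fromBool-< k<V)) (λ ())
        (seqE (frameE {ρ = ρ} (consequence body-done (body✓ k ρ μ k<V ei inv)))))
      where
      k<V : k < suc n + k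
      k<V = s≤s (m≤n+m k n)
      arith : t + (1 + 1) + suc (n * (3 + t)) ≡ (3 + t) + n * (3 + t)
      arith = trans (cong (_+ suc (n * (3 + t))) (+-comm t 2)) (+-suc (2 + t) (n * (3 + t)))
      body-done : ∀ ρ′ μ′ → Inv (suc k) ρ′ μ′ → Frame body ρ ρ′ → _
      body-done ρ′ μ′ inv′ keep =
        seqE (calcE (proj₁ (keep ((i , _) ∷ []) {one (proj₁ wr)} (ei , tt))) refl (+-comm k 1)
               (≤-<-trans k<V V<)
        (test (suc k) (set-same ρ′ i _) N′ k<V
          (iterate n (suc k) (+-suc n k) (trans (other f≢i) (set-same ρ′ i _))
             (trans (other f≢N) N′) (set-same (set ρ′ i (suc k)) f _) (sf (si inv′)))))
        where
        one : ∀ {b} → T b → T (b ∧ true)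
        one {true} _ = tt
        N′ : set ρ′ i (suc k) N ≡ suc n + k
        N′ = trans (other i≢N) (proj₁ (keep ((N , _) ∷ []) {one (proj₂ wr)} (eN , tt)))

  tabulate-0 : ∀ r → replicate r 0 ≡ tabulate {n = r} (λ _ → 0)
  tabulate-0 zero    = refl
  tabulate-0 (suc r) = cong (0 ∷ᵛ_) (tabulate-0 r)

  computes : ∀ {e n out} {c : Cmd (suc e)} → Exec c (λ _ → 0) (λ _ → 0) n (λ ρ _ → ρ zero ≡ out) →
             ∃ λ τ → Computes (program e c) O w out τ ((suc e + m) * w) × τ ≤ n
  computes {e} {c = c} (exec {ρ} {μ} {τ} run τ≤ out) =
    τ , (m , config ρ μ , subst (λ s → c , s ⇓ config ρ μ [ τ ]) (cong (λ vs → state vs (λ _ → 0)) (sym (tabulate-0 (suc e)))) run ,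
         out , refl) , τ≤

-- Several small cells packed into a word

module Digits (b : ℕ) where

  B : ℕ
  B = 2 ^ b

  instance
    B≢0 : NonZero B
    B≢0 = m^n≢0 2 b

  digit : ℕ → ℕ → ℕ
  digit zero    x = x % B
  digit (suc i) x = digit i (x / B)

  setDigit : ℕ → ℕ → ℕ → ℕ
  setDigit zero    y x = y + x / B * B
  setDigit (suc i) y x = x % B + setDigit i y (x / B) * B

  digit-< : ∀ i x → digit i x < B
  digit-< zero    x = m%n<n x B
  digit-< (suc i) x = digit-< i (x / B)

  digit-zero : ∀ i → digit i 0 ≡ 0
  digit-zero zero    = m<n⇒m%n≡m (m^n>0 2 b)
  digit-zero (suc i) = trans (cong (digit i) (0/n≡0 B)) (digit-zero i)

  private
    low : ∀ x y → y < B → (y + x * B) % B ≡ y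
    low x y y<B = trans ([m+kn]%n≡m%n y x B) (m<n⇒m%n≡m y<B)

    high : ∀ x y → y < B → (y + x * B) / B ≡ x
    high x y y<B = begin
      (y + x * B) / B      ≡⟨ +-distrib-/ y (x * B) (subst (_< B) (sym (trans (cong₂ _+_ (m<n⇒m%n≡m y<B) (m*n%n≡0 x B)) (+-identityʳ y))) y<B) ⟩
      y / B + x * B / B    ≡⟨ cong₂ _+_ (m<n⇒m/n≡0 y<B) (m*n/n≡m x B) ⟩
      x                    ∎
      where open ≡-Reasoning

  digit-setDigit : ∀ i {y} x → y < B → digit i (setDigit i y x) ≡ y
  digit-setDigit zero    {y} x y<B = low (x / B) y y<B
  digit-setDigit (suc i) {y} x y<B = trans (cong (digit i) (high (setDigit i _ (x / B)) _ (m%n<n x B))) (digit-setDigit i (x / B) y<B)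

  digit-setDigit-≢ : ∀ {i j} {y} x → y < B → j ≢ i → digit j (setDigit i y x) ≡ digit j x
  digit-setDigit-≢ {zero}  {zero}  x y<B j≢i = ⊥-elim (j≢i refl)
  digit-setDigit-≢ {zero}  {suc j} x y<B j≢i = cong (digit j) (high (x / B) _ y<B)
  digit-setDigit-≢ {suc i} {zero}  x y<B j≢i = low (setDigit i _ (x / B)) _ (m%n<n x B)
  digit-setDigit-≢ {suc i} {suc j} x y<B j≢i =
    trans (cong (digit j) (high (setDigit i _ (x / B)) _ (m%n<n x B))) (digit-setDigit-≢ {i} {j} (x / B) y<B (j≢i ∘ cong suc))

  setDigit-< : ∀ {k i y x} → i < k → y < B → x < B ^ k → setDigit i y x < B ^ k
  setDigit-< {suc k} {i} {y} {x} i<k y<B x<B^k = below i i<k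
    where
    x/B< : x / B < B ^ k
    x/B< = m<n*o⇒m/o<n (subst (x <_) (*-comm B (B ^ k)) x<B^k)
    place : ∀ {l h} → l < B → h < B ^ k → l + h * B < B ^ suc k
    place {l} {h} l<B h< = begin-strict
      l + h * B    <⟨ +-monoˡ-< (h * B) l<B ⟩
      suc h * B    ≤⟨ *-monoˡ-≤ B h< ⟩
      B ^ k * B    ≡⟨ *-comm (B ^ k) B ⟩
      B * B ^ k    ∎
      where open ≤-Reasoning
    below : ∀ i → i < suc k → setDigit i y x < B ^ suc k
    below zero    _         = place y<B x/B<
    below (suc i) (s≤s i<k) = place (m%n<n x B) (setDigit-< i<k y<B x/B<)

  shr′ : ℕ → ℕ → ℕ
  shr′ x s = _/_ x (2 ^ s) {{m^n≢0 2 s}}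

  -- The recursive `digit` suits induction; the shifted form is what `readCell` computes.
  digit-shift : ∀ i x → shr′ x (i * b) % B ≡ digit i x
  digit-shift zero    x = cong (_% B) (n/1≡n x)
  digit-shift (suc i) x = begin
    shr′ x (b + i * b) % B
      ≡⟨ cong (_% B) (/-congʳ {{m^n≢0 2 (b + i * b)}} {{m*n≢0 B P}} (^-distribˡ-+-* 2 b (i * b))) ⟩
    _/_ x (B * P) {{m*n≢0 B P}} % B
      ≡⟨ cong (_% B) (m/n/o≡m/[n*o] x B P {{B≢0}} {{P≢0}} {{m*n≢0 B P}}) ⟨
    shr′ (x / B) (i * b) % B
      ≡⟨ digit-shift i (x / B) ⟩
    digit i (x / B)  ∎
    where
    open ≡-Reasoning
    P = 2 ^ (i * b)
    instance
      P≢0 : NonZero P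
      P≢0 = m^n≢0 2 (i * b)

  digit≤ : ∀ i x → digit i x * 2 ^ (i * b) ≤ x
  digit≤ i x = begin
    digit i x * P                ≡⟨ cong (_* P) (digit-shift i x) ⟨
    shr′ x (i * b) % B * P       ≤⟨ *-monoˡ-≤ P (m%n≤m (shr′ x (i * b)) B) ⟩
    shr′ x (i * b) * P           ≤⟨ m/n*n≤m x P {{m^n≢0 2 (i * b)}} ⟩
    x                            ∎
    where
    open ≤-Reasoning
    P = 2 ^ (i * b)

  -- `writeCell` subtracts the old digit at its place value and adds the new one. By `digit≤` the
  -- truncated subtraction is exact.
  setDigit-shift : ∀ i y x → x ∸ digit i x * 2 ^ (i * b) + y * 2 ^ (i * b) ≡ setDigit i y x
  setDigit-shift zero y x = begin
    x ∸ x % B * 1 + y * 1    ≡⟨ cong₂ (λ u v → x ∸ u + v) (*-identityʳ (x % B)) (*-identityʳ y) ⟩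
    x ∸ x % B + y            ≡⟨ cong (λ u → u ∸ x % B + y) (m≡m%n+[m/n]*n x B) ⟩
    x % B + x / B * B ∸ x % B + y  ≡⟨ cong (_+ y) (m+n∸m≡n (x % B) (x / B * B)) ⟩
    x / B * B + y            ≡⟨ +-comm (x / B * B) y ⟩
    y + x / B * B            ∎
    where open ≡-Reasoning
  setDigit-shift (suc i) y x = begin
    x ∸ g * 2 ^ (b + i * b) + y * 2 ^ (b + i * b)
      ≡⟨ cong₂ (λ u v → x ∸ u + v) (place g) (place y) ⟩
    x ∸ g * P * B + y * P * B
      ≡⟨ cong (λ u → u ∸ g * P * B + y * P * B) (m≡m%n+[m/n]*n x B) ⟩
    x % B + x / B * B ∸ g * P * B + y * P * B
      ≡⟨ cong (_+ y * P * B) (+-∸-assoc (x % B) (*-monoˡ-≤ B (digit≤ i (x / B)))) ⟩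
    x % B + (x / B * B ∸ g * P * B) + y * P * B
      ≡⟨ +-assoc (x % B) _ _ ⟩
    x % B + (x / B * B ∸ g * P * B + y * P * B)
      ≡⟨ cong (λ u → x % B + (u + y * P * B)) (*-distribʳ-∸ B (x / B) (g * P)) ⟨
    x % B + ((x / B ∸ g * P) * B + y * P * B)
      ≡⟨ cong (x % B +_) (*-distribʳ-+ B (x / B ∸ g * P) (y * P)) ⟨
    x % B + (x / B ∸ g * P + y * P) * B
      ≡⟨ cong (λ u → x % B + u * B) (setDigit-shift i y (x / B)) ⟩
    x % B + setDigit i y (x / B) * B  ∎
    where
    open ≡-Reasoning
    g = digit i (x / B)
    P = 2 ^ (i * b)
    place : ∀ u → u * 2 ^ (b + i * b) ≡ u * P * B
    place u = trans (cong (u *_) (trans (^-distribˡ-+-* 2 b (i * b)) (*-comm B P))) (sym (*-assoc u P B))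

module Cells (b k F : ℕ) {{_ : NonZero k}} where
  open Digits b public

  cell : Mem → ℕ → ℕ
  cell μ a = digit (a % k) (μ (a / k + F))

  -- Keeps every table word within its k digits and hence below 2 ^ w, so that loading it truncates
  -- nothing.
  Words : Mem → Set
  Words μ = ∀ q → μ (q + F) < B ^ k

  setCell : Mem → ℕ → ℕ → Mem
  setCell μ a y = poke μ (a / k + F) (setDigit (a % k) y (μ (a / k + F)))

  setCell-same : ∀ μ a {y} → y < B → cell (setCell μ a y) a ≡ y
  setCell-same μ a {y} y<B =
    trans (cong (digit (a % k)) (poke-same μ (a / k + F) _)) (digit-setDigit (a % k) _ y<B)

  setCell-other : ∀ μ {a a′ y} → y < B → a′ ≢ a → cell (setCell μ a y) a′ ≡ cell μ a′
  setCell-other μ {a} {a′} {y} y<B a′≢a with a′ / k ≟ a / k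
  ... | no q≢ = cong (digit (a′ % k)) (poke-other μ _ (q≢ ∘ +-cancelʳ-≡ F (a′ / k) (a / k)))
  ... | yes q≡ = begin
    digit (a′ % k) (setCell μ a y (a′ / k + F))                       ≡⟨ cong (λ q → digit (a′ % k) (setCell μ a y (q + F))) q≡ ⟩
    digit (a′ % k) (setCell μ a y (a / k + F))                        ≡⟨ cong (digit (a′ % k)) (poke-same μ (a / k + F) _) ⟩
    digit (a′ % k) (setDigit (a % k) y (μ (a / k + F)))  ≡⟨ digit-setDigit-≢ {a % k} {a′ % k} _ y<B r≢ ⟩
    digit (a′ % k) (μ (a / k + F))                       ≡⟨ cong (λ q → digit (a′ % k) (μ (q + F))) q≡ ⟨
    cell μ a′                                            ∎
    where
    open ≡-Reasoning
    r≢ : a′ % k ≢ a % k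
    r≢ r≡ = a′≢a (trans (m≡m%n+[m/n]*n a′ k) (trans (cong₂ (λ r q → r + q * k) r≡ q≡) (sym (m≡m%n+[m/n]*n a k))))

  setCell-below : ∀ μ {a x} y → x < F → setCell μ a y x ≡ μ x
  setCell-below μ {a} y x<F = poke-other μ _ λ { refl → <⇒≱ x<F (m≤n+m F (a / k)) }

  setCell-words : ∀ {μ} a {y} → y < B → Words μ → Words (setCell μ a y)
  setCell-words {μ} a {y} y<B ws q with q + F ≟ a / k + F
  ... | yes e = subst (_< B ^ k) (sym (trans (cong (setCell μ a y) e) (poke-same μ (a / k + F) _)))
                  (setDigit-< {x = μ (a / k + F)} (m%n<n a k) y<B (ws (a / k)))
  ... | no ne = subst (_< B ^ k) (sym (poke-other μ _ ne)) (ws q)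

  cell-poke : ∀ {μ x v} a → x < F → cell (poke μ x v) a ≡ cell μ a
  cell-poke {μ} a x<F = cong (digit (a % k)) (poke-other μ _ λ { refl → <⇒≱ x<F (m≤n+m F (a / k)) })

  poke-words : ∀ {μ x v} → x < F → Words μ → Words (poke μ x v)
  poke-words {μ} x<F ws q = subst (_< B ^ k) (sym (poke-other μ _ λ { refl → <⇒≱ x<F (m≤n+m F q) })) (ws q)

  -- Frame condition of a table pass, which writes only cells from `lo` on; the stack occupies the
  -- first F words.
  record Kept (lo : ℕ) (μ μ′ : Mem) : Set where
    field
      cells : ∀ a → a < lo → cell μ′ a ≡ cell μ a
      stack : ∀ a → a < F → μ′ a ≡ μ a
      words : Words μ′
  open Kept public

  kept-refl : ∀ {lo μ} → Words μ → Kept lo μ μ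
  kept-refl ws = record { cells = λ _ _ → refl ; stack = λ _ _ → refl ; words = ws }

  kept-setCell : ∀ {lo μ μ′ a y} → lo ≤ a → y < B → Kept lo μ μ′ → Kept lo μ (setCell μ′ a y)
  kept-setCell {lo} {μ} {μ′} {a} {y} lo≤a y<B kp = record
    { cells = λ a′ a′<lo → trans (setCell-other μ′ y<B (<⇒≢ (<-≤-trans a′<lo lo≤a))) (cells kp a′ a′<lo)
    ; stack = λ x x<F → trans (setCell-below μ′ {a} y x<F) (stack kp x x<F)
    ; words = setCell-words {μ′} a y<B (words kp) }

-- The dynamic programming tables

∅ : ∀ {u} → Vec Bool u
∅ = replicate _ false

-- This is ∣D ∖ E∣.
excess : ∀ {u} → Vec Bool u → Vec Bool u → ℕ
excess []ᵛ      []ᵛ      = 0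
excess (d ∷ᵛ D) (e ∷ᵛ E) = fromBool (d ∧ not e) + excess D E

fromBool≤1 : ∀ b → fromBool b ≤ 1
fromBool≤1 true  = ≤-refl
fromBool≤1 false = z≤n

excess≤ : ∀ {u} (D E : Vec Bool u) → excess D E ≤ u
excess≤ []ᵛ      []ᵛ      = z≤n
excess≤ (d ∷ᵛ D) (e ∷ᵛ E) = +-mono-≤ (fromBool≤1 (d ∧ not e)) (excess≤ D E)

excess-∅ : ∀ {u} (E : Vec Bool u) → excess ∅ E ≡ 0
excess-∅ []ᵛ      = refl
excess-∅ (e ∷ᵛ E) = excess-∅ E

excess-∧ : ∀ {u} (D E C : Vec Bool u) → excess (zipWith _∧_ D C) (zipWith _∧_ E C) ≤ excess D E
excess-∧ []ᵛ []ᵛ []ᵛ = z≤n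
excess-∧ (d ∷ᵛ D) (e ∷ᵛ E) (c ∷ᵛ C) = +-mono-≤ (bit d e c) (excess-∧ D E C)
  where
  bit : ∀ d e c → fromBool ((d ∧ c) ∧ not (e ∧ c)) ≤ fromBool (d ∧ not e)
  bit false e     c     = z≤n
  bit true  true  true  = z≤n
  bit true  true  false = z≤n
  bit true  false true  = ≤-refl
  bit true  false false = z≤n

_∨¬_ : ∀ {u} → Vec Bool u → Vec Bool u → Vec Bool u
E ∨¬ C = zipWith (λ e c → e ∨ not c) E C

-- With C the non-neighbours of a selected vertex: removing its neighbours from the demand D amounts
-- to adding them to the set E of vertices already dominated.
excess-∨¬ : ∀ {u} (D E C : Vec Bool u) → excess (zipWith _∧_ D C) E ≡ excess D (E ∨¬ C)
excess-∨¬ []ᵛ []ᵛ []ᵛ = refl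
excess-∨¬ (d ∷ᵛ D) (e ∷ᵛ E) (c ∷ᵛ C) = cong₂ _+_ (cong fromBool (bit d e c)) (excess-∨¬ D E C)
  where
  bit : ∀ d e c → ((d ∧ c) ∧ not e) ≡ (d ∧ not (e ∨ not c))
  bit false e     c     = refl
  bit true  true  true  = refl
  bit true  true  false = refl
  bit true  false true  = refl
  bit true  false false = refl

_⊑_ : ∀ {u} → Vec Bool u → Vec Bool u → Set
E ⊑ E′ = ∀ i → lookup E i ≡ true → lookup E′ i ≡ true

⊑-∨¬ : ∀ {u} (E C : Vec Bool u) → E ⊑ (E ∨¬ C)
⊑-∨¬ (true ∷ᵛ E) (c ∷ᵛ C) zero    e = refl
⊑-∨¬ (_ ∷ᵛ E)    (c ∷ᵛ C) (suc i) e = ⊑-∨¬ E C i e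

∨¬-∉ : ∀ {u} (E C : Vec Bool u) i → lookup C i ≡ false → lookup (E ∨¬ C) i ≡ true
∨¬-∉ (true  ∷ᵛ E) (c     ∷ᵛ C) zero    e = refl
∨¬-∉ (false ∷ᵛ E) (false ∷ᵛ C) zero    e = refl
∨¬-∉ (_     ∷ᵛ E) (_     ∷ᵛ C) (suc i) e = ∨¬-∉ E C i e

∧-split : ∀ {u} (D C : Vec Bool u) i → lookup D i ≡ true →
          lookup (zipWith _∧_ D C) i ≡ true ⊎ lookup C i ≡ false
∧-split (true ∷ᵛ D) (true  ∷ᵛ C) zero    e = inj₁ refl
∧-split (true ∷ᵛ D) (false ∷ᵛ C) zero    e = inj₂ refl
∧-split (_    ∷ᵛ D) (_     ∷ᵛ C) (suc i) e = ∧-split D C i e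

module DP {n : ℕ} (adj : Fin n → Fin n → Bool) (children : Maybe (Fin n) → List (Fin n)) where

  -- The path from the root to the current position, deepest vertex first, with
  -- the flag telling whether the vertex has been put into the dominating set.
  Path : Set
  Path = List (Fin n × Bool)

  free : Path → ℕ
  free []              = 0
  free ((_ , true)  ∷ Γ) = free Γ
  free ((_ , false) ∷ Γ) = suc (free Γ)

  unselected : (Γ : Path) → Vec (Fin n) (free Γ)
  unselected []                = []ᵛ
  unselected ((_ , true)  ∷ Γ) = unselected Γ
  unselected ((v , false) ∷ Γ) = v ∷ᵛ unselected Γ

  selected : Path → List (Fin n)
  selected []                = []
  selected ((v , true)  ∷ Γ) = v ∷ selected Γ
  selected ((_ , false) ∷ Γ) = selected Γ

  -- Indexed by the set of unselected path vertices that must be dominated.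
  Table : Path → Set
  Table Γ = Vec Bool (free Γ) → ℕ

  nonNeighbours : Fin n → (Γ : Path) → Vec Bool (free Γ)
  nonNeighbours v []                = []ᵛ
  nonNeighbours v ((_ , true)  ∷ Γ) = nonNeighbours v Γ
  nonNeighbours v ((p , false) ∷ Γ) = not (adj v p) ∷ᵛ nonNeighbours v Γ

  dominated : Fin n → Path → Bool
  dominated v []                = false
  dominated v ((p , true)  ∷ Γ) = adj v p ∨ dominated v Γ
  dominated v ((_ , false) ∷ Γ) = dominated v Γ

  -- The selected vertex takes over its neighbours in the demand; what remains is left to the part
  -- finished before.
  select : ∀ v Γ → Table Γ → Table ((v , true) ∷ Γ)
  select v Γ M D = suc (M (zipWith _∧_ D (nonNeighbours v Γ)))

  -- A vertex that must be dominated may also be declared to be dominated, at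
  -- the price of putting it into the dominating set.
  leave : ∀ v Γ → Table Γ → Table ((v , false) ∷ Γ)
  leave v Γ M (b ∷ᵛ D) = fromBool (b ∧ not (dominated v Γ)) + M D

  mutual
    -- The index has a bit for the unselected v only while its subtree is processed; reading the
    -- entry `true ∷ᵛ D` at the end enforces that v is dominated. The number h is fuel for the
    -- recursion through the child lists; by `fuel-pos` it does not run out at a vertex.
    processTree : ℕ → (Γ : Path) → Fin n → Table Γ → Table Γ
    processTree zero    Γ v M D = M D
    processTree (suc h) Γ v M D =
      processForest h ((v , true) ∷ Γ) (children (just v)) (select v Γ M) D ⊓
      processForest h ((v , false) ∷ Γ) (children (just v)) (leave v Γ M) (true ∷ᵛ D)

    processForest : ℕ → (Γ : Path) → List (Fin n) → Table Γ → Table Γ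
    processForest h Γ []       M = M
    processForest h Γ (c ∷ cs) M = processForest h Γ cs (processTree h Γ c M)

  mutual
    tree : ℕ → Fin n → List (Fin n)
    tree zero    v = []
    tree (suc h) v = v ∷ forest h (children (just v))

    forest : ℕ → List (Fin n) → List (Fin n)
    forest h []       = []
    forest h (c ∷ cs) = tree h c ++ forest h cs

  -- Variation and size of the table entries

  Lipschitz : ∀ {u} → (Vec Bool u → ℕ) → Set
  Lipschitz M = ∀ D E → M D ≤ M E + excess D E

  Lipschitz-select : ∀ v Γ {M} → Lipschitz M → Lipschitz (select v Γ M)
  Lipschitz-select v Γ lip D E =
    s≤s (≤-trans (lip _ _) (+-monoʳ-≤ _ (excess-∧ D E (nonNeighbours v Γ))))

  Lipschitz-leave : ∀ v Γ {M} → Lipschitz M → Lipschitz (leave v Γ M)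
  Lipschitz-leave v Γ {M} lip (b ∷ᵛ D) (b′ ∷ᵛ E) = begin
    fromBool (b ∧ nd) + M D                                                ≤⟨ +-mono-≤ (bit b b′ nd) (lip D E) ⟩
    fromBool (b′ ∧ nd) + fromBool (b ∧ not b′) + (M E + excess D E)        ≡⟨ +-interchange (fromBool (b′ ∧ nd)) _ (M E) _ ⟩
    fromBool (b′ ∧ nd) + M E + (fromBool (b ∧ not b′) + excess D E)        ∎
    where
    open ≤-Reasoning
    nd = not (dominated v Γ)
    +-interchange : ∀ a b c d → a + b + (c + d) ≡ a + c + (b + d)
    +-interchange a b c d = trans (+-assoc a b (c + d)) (trans (cong (a +_) (trans (sym (+-assoc b c d))
      (trans (cong (_+ d) (+-comm b c)) (+-assoc c b d)))) (sym (+-assoc a c (b + d))))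
    bit : ∀ b b′ d → fromBool (b ∧ d) ≤ fromBool (b′ ∧ d) + fromBool (b ∧ not b′)
    bit false b′    d     = z≤n
    bit true  b′    false = z≤n
    bit true  true  true  = ≤-refl
    bit true  false true  = ≤-refl

  Lipschitz-⊓ : ∀ {u} {M N : Vec Bool u → ℕ} → Lipschitz M → Lipschitz N → Lipschitz (λ D → M D ⊓ N D)
  Lipschitz-⊓ {M = M} {N} lip lip′ D E =
    ≤-trans (⊓-mono-≤ (lip D E) (lip′ D E)) (≤-reflexive (sym (+-distribʳ-⊓ (excess D E) (M E) (N E))))

  mutual
    Lipschitz-tree : ∀ h Γ v {M} → Lipschitz M → Lipschitz (processTree h Γ v M)
    Lipschitz-tree zero    Γ v lip = lip
    Lipschitz-tree (suc h) Γ v lip = Lipschitz-⊓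
      (Lipschitz-forest h _ (children (just v)) (Lipschitz-select v Γ lip))
      (λ D E → Lipschitz-forest h _ (children (just v)) (Lipschitz-leave v Γ lip) (true ∷ᵛ D) (true ∷ᵛ E))

    Lipschitz-forest : ∀ h Γ cs {M} → Lipschitz M → Lipschitz (processForest h Γ cs M)
    Lipschitz-forest h Γ []       lip = lip
    Lipschitz-forest h Γ (c ∷ cs) lip = Lipschitz-forest h Γ cs (Lipschitz-tree h Γ c lip)

  mutual
    -- The branch that selects every vertex costs one per vertex. Consequently all base values are
    -- at most n and fit into a word.
    tree-bound : ∀ h Γ v {M β} → (∀ D → M D ≤ β) → ∀ D → processTree h Γ v M D ≤ β + length (tree h v)
    tree-bound zero    Γ v {β = β} M≤ D = ≤-trans (M≤ D) (m≤m+n β 0)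
    tree-bound (suc h) Γ v {β = β} M≤ D = ≤-trans (m⊓n≤m _ _)
      (≤-trans (forest-bound h _ (children (just v)) (λ E → s≤s (M≤ _)) D)
               (≤-reflexive (sym (+-suc β _))))

    forest-bound : ∀ h Γ cs {M β} → (∀ D → M D ≤ β) → ∀ D →
                   processForest h Γ cs M D ≤ β + length (forest h cs)
    forest-bound h Γ []       {β = β} M≤ D = ≤-trans (M≤ D) (m≤m+n β 0)
    forest-bound h Γ (c ∷ cs) {β = β} M≤ D = ≤-trans (forest-bound h Γ cs (tree-bound h Γ c M≤) D)
      (≤-reflexive (trans (+-assoc β _ _) (cong (β +_) (sym (length-++ (tree h c))))))

  -- From a table entry to a dominating set

  nonNeighbours-∌ : ∀ v Γ i → lookup (nonNeighbours v Γ) i ≡ false → adj v (lookup (unselected Γ) i) ≡ true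
  nonNeighbours-∌ v ((p , true)  ∷ Γ) i       e = nonNeighbours-∌ v Γ i e
  nonNeighbours-∌ v ((p , false) ∷ Γ) (suc i) e = nonNeighbours-∌ v Γ i e
  nonNeighbours-∌ v ((p , false) ∷ Γ) zero    e with adj v p
  ... | true = refl

  nonNeighbours-∌⁻¹ : ∀ v Γ i → adj v (lookup (unselected Γ) i) ≡ true → lookup (nonNeighbours v Γ) i ≡ false
  nonNeighbours-∌⁻¹ v ((p , true)  ∷ Γ) i       e = nonNeighbours-∌⁻¹ v Γ i e
  nonNeighbours-∌⁻¹ v ((p , false) ∷ Γ) (suc i) e = nonNeighbours-∌⁻¹ v Γ i e
  nonNeighbours-∌⁻¹ v ((p , false) ∷ Γ) zero    e rewrite e = refl

  dominated-∃ : ∀ v Γ → dominated v Γ ≡ true → ∃ λ u → u ∈ selected Γ × adj v u ≡ true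
  dominated-∃ v ((p , false) ∷ Γ) e = dominated-∃ v Γ e
  dominated-∃ v ((p , true)  ∷ Γ) e with adj v p in vp
  ... | true  = p , here refl , vp
  ... | false with dominated-∃ v Γ e
  ...   | u , u∈ , vu = u , there u∈ , vu

  dominated-∈ : ∀ v Γ {u} → (u , true) ∈ Γ → adj v u ≡ true → dominated v Γ ≡ true
  dominated-∈ v ((p , true)  ∷ Γ) (here refl) e rewrite e = refl
  dominated-∈ v ((p , false) ∷ Γ) (there i)   e = dominated-∈ v Γ i e
  dominated-∈ v ((p , true)  ∷ Γ) (there i)   e with adj v p
  ... | true  = refl
  ... | false = dominated-∈ v Γ i e

  module _ (adj-sym : ∀ {u v} → adj u v ≡ true → adj v u ≡ true) where

    -- Traces an entry of the processed table back to an entry D′ of the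
    -- original one; the vertices in L were selected or declared dominated.
    record Traced (Γ : Path) (vs : List (Fin n)) (D D′ : Vec Bool (free Γ)) (L : List (Fin n)) : Set where
      field
        covers  : ∀ {v} → v ∈ vs → v ∈ L ⊎ ∃ λ u → (u ∈ L ⊎ u ∈ selected Γ) × adj v u ≡ true
        carries : ∀ i → lookup D i ≡ true →
                  lookup D′ i ≡ true ⊎ ∃ λ u → u ∈ L × adj (lookup (unselected Γ) i) u ≡ true
    open Traced

    mutual
      -- Follows the choices that attain the minima, last processed child first. The cost is charged
      -- to the vertices of L, and the demand D′ that is left over is passed on to the part finished
      -- before.
      trace-tree : ∀ h Γ v M D → ∃ λ L → ∃ λ D′ →
                   length L + M D′ ≤ processTree h Γ v M D × Traced Γ (tree h v) D D′ L
      trace-tree zero    Γ v M D = [] , D , ≤-refl , record { covers = λ () ; carries = λ _ → inj₁ }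
      trace-tree (suc h) Γ v M D
        with ⊓-sel (processForest h ((v , true) ∷ Γ) (children (just v)) (select v Γ M) D)
                   (processForest h ((v , false) ∷ Γ) (children (just v)) (leave v Γ M) (true ∷ᵛ D))
      ... | inj₁ e with trace-forest h ((v , true) ∷ Γ) (children (just v)) (select v Γ M) D
      ...   | L , E , L≤ , tr =
        v ∷ L , zipWith _∧_ E (nonNeighbours v Γ) ,
        ≤-trans (≤-reflexive (sym (+-suc (length L) _))) (≤-trans L≤ (≤-reflexive (sym e))) ,
        record { covers = cov ; carries = car }
        where
        cov : ∀ {w} → w ∈ tree (suc h) v → w ∈ v ∷ L ⊎ ∃ λ u → (u ∈ v ∷ L ⊎ u ∈ selected Γ) × adj w u ≡ true
        cov (here refl) = inj₁ (here refl)
        cov (there w∈) with covers tr w∈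
        ... | inj₁ w∈L = inj₁ (there w∈L)
        ... | inj₂ (u , inj₁ u∈L , wu)           = inj₂ (u , inj₁ (there u∈L) , wu)
        ... | inj₂ (u , inj₂ (here refl) , wu)   = inj₂ (u , inj₁ (here refl) , wu)
        ... | inj₂ (u , inj₂ (there u∈) , wu)    = inj₂ (u , inj₂ u∈ , wu)
        car : ∀ i → lookup D i ≡ true → _
        car i Di with carries tr i Di
        ... | inj₂ (u , u∈L , e) = inj₂ (u , there u∈L , e)
        ... | inj₁ Ei with ∧-split E (nonNeighbours v Γ) i Ei
        ...   | inj₁ D′i = inj₁ D′i
        ...   | inj₂ ¬i  = inj₂ (v , here refl , adj-sym (nonNeighbours-∌ v Γ i ¬i))
      trace-tree (suc h) Γ v M D | inj₂ e
        with trace-forest h ((v , false) ∷ Γ) (children (just v)) (leave v Γ M) (true ∷ᵛ D)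
      ... | L , (b ∷ᵛ E) , L≤ , tr = finish b (dominated v Γ) refl L≤ (λ i → carries tr i)
        where
        cov : ∀ {K} → (∀ {u} → u ∈ L → u ∈ K) → ∀ {w} → w ∈ forest h (children (just v)) →
              w ∈ K ⊎ ∃ λ u → (u ∈ K ⊎ u ∈ selected Γ) × adj w u ≡ true
        cov L⊆K w∈ with covers tr w∈
        ... | inj₁ w∈L = inj₁ (L⊆K w∈L)
        ... | inj₂ (u , inj₁ u∈L , wu) = inj₂ (u , inj₁ (L⊆K u∈L) , wu)
        ... | inj₂ (u , inj₂ u∈ , wu)  = inj₂ (u , inj₂ u∈ , wu)
        finish : ∀ b d → dominated v Γ ≡ d → length L + (fromBool (b ∧ not d) + M E) ≤ _ →
                 (∀ i → lookup (true ∷ᵛ D) i ≡ true → lookup (b ∷ᵛ E) i ≡ true ⊎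
                    ∃ λ u → u ∈ L × adj (lookup (v ∷ᵛ unselected Γ) i) u ≡ true) →
                 ∃ λ K → ∃ λ D′ → length K + M D′ ≤ processTree (suc h) Γ v M D × Traced Γ (tree (suc h) v) D D′ K
        -- The unit that `leave` charges for declaring v dominated pays for putting v itself into L.
        finish true false _ L≤ car = v ∷ L , E ,
          ≤-trans (≤-reflexive (sym (+-suc (length L) _))) (≤-trans L≤ (≤-reflexive (sym e))) ,
          record { covers  = λ { (here refl) → inj₁ (here refl) ; (there w∈) → cov there w∈ }
                 ; carries = λ i Di → Sum.map₂ (λ { (u , u∈ , pu) → u , there u∈ , pu }) (car (suc i) Di) }
        finish true true d L≤ car = L , E , ≤-trans L≤ (≤-reflexive (sym e)) ,
          record { covers  = λ { (here refl) → inj₂ (let u , u∈ , vu = dominated-∃ v Γ d in u , inj₂ u∈ , vu)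
                               ; (there w∈) → cov (λ u∈ → u∈) w∈ }
                 ; carries = λ i Di → car (suc i) Di }
        -- The demand on v has disappeared on the way through the subtree, so that L contains a
        -- neighbour of v.
        finish false d _ L≤ car = L , E , ≤-trans L≤ (≤-reflexive (sym e)) ,
          record { covers  = λ { (here refl) → [ (λ ()) , (λ { (u , u∈ , vu) → inj₂ (u , inj₁ u∈ , vu) }) ]′ (car zero refl)
                               ; (there w∈) → cov (λ u∈ → u∈) w∈ }
                 ; carries = λ i Di → car (suc i) Di }

      trace-forest : ∀ h Γ cs M D → ∃ λ L → ∃ λ D′ →
                     length L + M D′ ≤ processForest h Γ cs M D × Traced Γ (forest h cs) D D′ L
      trace-forest h Γ []       M D = [] , D , ≤-refl , record { covers = λ () ; carries = λ _ → inj₁ }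
      trace-forest h Γ (c ∷ cs) M D with trace-forest h Γ cs (processTree h Γ c M) D
      ... | L₁ , D₁ , L₁≤ , tr₁ with trace-tree h Γ c M D₁
      ...   | L₂ , D₂ , L₂≤ , tr₂ =
        L₁ ++ L₂ , D₂ ,
        ≤-trans (≤-reflexive (trans (cong (_+ M D₂) (length-++ L₁)) (+-assoc (length L₁) _ _)))
          (≤-trans (+-monoʳ-≤ (length L₁) L₂≤) L₁≤) ,
        record { covers = cov ; carries = car }
        where
        cov : ∀ {v} → v ∈ forest h (c ∷ cs) → v ∈ L₁ ++ L₂ ⊎ ∃ λ u → (u ∈ L₁ ++ L₂ ⊎ u ∈ selected Γ) × adj v u ≡ true
        cov v∈ with ∈-++⁻ (tree h c) v∈
        ... | inj₁ v∈c = Sum.map (∈-++⁺ʳ L₁) (λ { (u , u∈ , vu) → u , Sum.map₁ (∈-++⁺ʳ L₁) u∈ , vu }) (covers tr₂ v∈c)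
        ... | inj₂ v∈cs = Sum.map ∈-++⁺ˡ (λ { (u , u∈ , vu) → u , Sum.map₁ ∈-++⁺ˡ u∈ , vu }) (covers tr₁ v∈cs)
        car : ∀ i → lookup D i ≡ true → _
        car i Di with carries tr₁ i Di
        ... | inj₂ (u , u∈ , e) = inj₂ (u , ∈-++⁺ˡ u∈ , e)
        ... | inj₁ D₁i = Sum.map₂ (λ { (u , u∈ , e) → u , ∈-++⁺ʳ L₁ u∈ , e }) (carries tr₂ i D₁i)

  -- From a dominating set to a bound on the table entries

  mutual
    -- The defining property of the decomposition in the shape of the recursion: a neighbour of v
    -- lies on the path P above v or strictly below v.
    Closed : ℕ → List (Fin n) → Fin n → Set
    Closed zero    P v = ⊤
    Closed (suc h) P v = (∀ u → adj v u ≡ true → u ∈ P ⊎ u ∈ forest h (children (just v))) ×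
                         ClosedForest h (v ∷ P) (children (just v))

    ClosedForest : ℕ → List (Fin n) → List (Fin n) → Set
    ClosedForest h P []       = ⊤
    ClosedForest h P (c ∷ cs) = Closed h P c × ClosedForest h P cs

  module _ (adj-sym : ∀ {u v} → adj u v ≡ true → adj v u ≡ true)
           (X : Fin n → Bool) (dominating : ∀ v → X v ≡ true ⊎ ∃ λ u → X u ≡ true × adj v u ≡ true) where

    chosen : List (Fin n) → ℕ
    chosen vs = sum (map (λ v → fromBool (X v)) vs)

    chosen-++ : ∀ us vs → chosen (us ++ vs) ≡ chosen us + chosen vs
    chosen-++ us vs = trans (cong sum (map-++ _ us vs)) (sum-++ (map _ us) (map _ vs))

    Consistent : Path → Set
    Consistent Γ = All (λ (p , s) → X p ≡ s) Γ

    consistent-∈ : ∀ {Γ u} → Consistent Γ → u ∈ map proj₁ Γ → X u ≡ true → (u , true) ∈ Γ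
    consistent-∈ {(p , s) ∷ Γ} (Xp ∷ _) (here refl) Xu = here (cong (p ,_) (trans (sym Xu) Xp))
    consistent-∈ (_ ∷ con) (there i) Xu = there (consistent-∈ con i Xu)

    -- E stands for the path vertices known to be dominated by the part of X met so far. An entry
    -- that demands more pays one unit for each missing vertex, which can be declared dominated.
    record Bounded (Γ : Path) (M : Table Γ) (c : ℕ) (E : Vec Bool (free Γ)) (vs : List (Fin n))
                   (M′ : Table Γ) : Set where
      field
        E′      : Vec Bool (free Γ)
        grows   : E ⊑ E′
        reaches : ∀ i {u} → u ∈ vs → X u ≡ true → adj (lookup (unselected Γ) i) u ≡ true → lookup E′ i ≡ true
        bound   : ∀ D → M′ D ≤ c + chosen vs + excess D E′
    open Bounded

    mutual
      tree-chosen : ∀ h Γ v {M c E} → Closed h (map proj₁ Γ) v → Consistent Γ →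
                    (∀ D → M D ≤ c + excess D E) → Bounded Γ M c E (tree h v) (processTree h Γ v M)
      tree-chosen zero Γ v {c = c} {E} cl con M≤ = record
        { E′ = E ; grows = λ _ e → e ; reaches = λ _ ()
        ; bound = λ D → subst (λ z → _ ≤ z + excess D E) (sym (+-identityʳ c)) (M≤ D) }
      tree-chosen (suc h) Γ v {M} {c} {E} (cl , cls) con M≤ with X v in Xv
      ... | true = record
        { E′ = E′ IH
        ; grows = λ i e → grows IH i (⊑-∨¬ E C i e)
        ; reaches = λ { i (here refl) _ pu → grows IH i (∨¬-∉ E C i (nonNeighbours-∌⁻¹ v Γ i (adj-sym pu)))
                      ; i (there u∈) → reaches IH i u∈ }
        ; bound = λ D → ≤-trans (m⊓n≤m _ _) (≤-trans (bound IH D) (≤-reflexive (cong (_+ excess D (E′ IH)) (counted D)))) }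
        where
        C = nonNeighbours v Γ
        cs = children (just v)
        IH : Bounded ((v , true) ∷ Γ) (select v Γ M) (suc c) (E ∨¬ C) (forest h cs)
                     (processForest h ((v , true) ∷ Γ) cs (select v Γ M))
        IH = forest-chosen h ((v , true) ∷ Γ) cs cls (Xv ∷ con)
               (λ D → s≤s (≤-trans (M≤ _) (≤-reflexive (cong (c +_) (excess-∨¬ D E C)))))
        counted : ∀ D → suc c + chosen (forest h cs) ≡ c + (fromBool (X v) + chosen (forest h cs))
        counted D = trans (sym (+-suc c _)) (cong (λ b → c + (fromBool b + chosen (forest h cs))) (sym Xv))
      ... | false with forest-chosen h ((v , false) ∷ Γ) (children (just v)) {leave v Γ M} {c} {dominated v Γ ∷ᵛ E} cls (Xv ∷ con)
                        (λ { (b ∷ᵛ D) → ≤-trans (+-monoʳ-≤ (fromBool (b ∧ _)) (M≤ D)) (≤-reflexive (swap (fromBool (b ∧ _)) c _)) })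
        where
        swap : ∀ a b c → a + (b + c) ≡ b + (a + c)
        swap a b c = trans (sym (+-assoc a b c)) (trans (cong (_+ c) (+-comm a b)) (+-assoc b a c))
      ...   | record { E′ = e ∷ᵛ E′ ; grows = gr ; reaches = re ; bound = bd } = record
        { E′ = E′
        ; grows = λ i → gr (suc i)
        ; reaches = λ { i (here refl) Xu → ⊥-elim (absurd (trans (sym Xv) Xu)) ; i (there u∈) → re (suc i) u∈ }
        ; bound = λ D → ≤-trans (m⊓n≤n _ _) (≤-trans (bd (true ∷ᵛ D)) (≤-reflexive (counted D))) }
        where
        absurd : false ≡ true → ⊥
        absurd ()
        -- Here X being dominating enters: a neighbour of v in X lies on the path, and then v was
        -- dominated from the start, or below v, and then v was reached. Hence the entry with bit
        -- `true` carries no surcharge for v.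
        e≡true : e ≡ true
        e≡true with dominating v
        ... | inj₁ Xv′ = ⊥-elim (absurd (trans (sym Xv) Xv′))
        ... | inj₂ (u , Xu , vu) with cl u vu
        ...   | inj₁ u∈Γ = gr zero (dominated-∈ v Γ (consistent-∈ con u∈Γ Xu) vu)
        ...   | inj₂ u∈cs = re zero u∈cs Xu vu
        counted : ∀ D → c + chosen (forest h (children (just v))) + (fromBool (not e) + excess D E′)
                ≡ c + (fromBool (X v) + chosen (forest h (children (just v)))) + excess D E′
        counted D = cong₂ (λ x y → c + x + (fromBool (not y) + excess D E′))
          (sym (cong (λ b → fromBool b + chosen (forest h (children (just v)))) Xv)) e≡true

      forest-chosen : ∀ h Γ cs {M c E} → ClosedForest h (map proj₁ Γ) cs → Consistent Γ →
                      (∀ D → M D ≤ c + excess D E) → Bounded Γ M c E (forest h cs) (processForest h Γ cs M)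
      forest-chosen h Γ [] {c = c} {E} _ con M≤ = record
        { E′ = E ; grows = λ _ e → e ; reaches = λ _ ()
        ; bound = λ D → subst (λ z → _ ≤ z + excess D E) (sym (+-identityʳ c)) (M≤ D) }
      forest-chosen h Γ (v ∷ cs) {M} {c} {E} (cl , cls) con M≤ = record
        { E′ = E′ IH₂
        ; grows = λ i e → grows IH₂ i (grows IH₁ i e)
        ; reaches = λ i u∈ Xu pu → [ (λ u∈v → grows IH₂ i (reaches IH₁ i u∈v Xu pu))
                                   , (λ u∈cs → reaches IH₂ i u∈cs Xu pu) ]′ (∈-++⁻ (tree h v) u∈)
        ; bound = λ D → ≤-trans (bound IH₂ D) (≤-reflexive (cong (_+ excess D (E′ IH₂))
                    (trans (+-assoc c _ _) (cong (c +_) (sym (chosen-++ (tree h v) (forest h cs))))))) }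
        where
        IH₁ = tree-chosen h Γ v {M} {c} {E} cl con M≤
        IH₂ = forest-chosen h Γ cs {processTree h Γ v M} {c + chosen (tree h v)} {E′ IH₁} cls con (bound IH₁)

-- The treedepth decomposition

-- Delete from ys an occurrence of the head of xs: by uniqueness the tail of xs is still contained
-- in the rest.
sum-unique-⊆ : ∀ {n} (f : Fin n → ℕ) {xs ys} → Unique xs → (∀ {v} → v ∈ xs → v ∈ ys) →
               sum (map f xs) ≤ sum (map f ys)
sum-unique-⊆ f {[]} _ _ = z≤n
sum-unique-⊆ f {x ∷ xs} (x∉xs ∷ uniq) incl with ∈-∃++ (incl (here refl))
... | as , bs , refl = begin
  f x + sum (map f xs)                     ≤⟨ +-monoʳ-≤ (f x) (sum-unique-⊆ f uniq rest) ⟩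
  f x + sum (map f (as ++ bs))             ≡⟨ cong (f x +_) (split as bs) ⟩
  f x + (sum (map f as) + sum (map f bs))  ≡⟨ +-assoc (f x) _ _ ⟨
  f x + sum (map f as) + sum (map f bs)    ≡⟨ cong (_+ sum (map f bs)) (+-comm (f x) _) ⟩
  sum (map f as) + f x + sum (map f bs)    ≡⟨ +-assoc (sum (map f as)) _ _ ⟩
  sum (map f as) + (f x + sum (map f bs))  ≡⟨ split as (x ∷ bs) ⟨
  sum (map f (as ++ x ∷ bs))               ∎
  where
  open ≤-Reasoning
  split : ∀ as bs → sum (map f (as ++ bs)) ≡ sum (map f as) + sum (map f bs)
  split as bs = trans (cong sum (map-++ f as bs)) (sum-++ (map f as) (map f bs))
  rest : ∀ {v} → v ∈ xs → v ∈ as ++ bs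
  rest v∈ with ∈-++⁻ as (incl (there v∈))
  ... | inj₁ v∈as          = ∈-++⁺ˡ v∈as
  ... | inj₂ (here refl)   = ⊥-elim (All.lookup x∉xs v∈ refl)
  ... | inj₂ (there v∈bs)  = ∈-++⁺ʳ as v∈bs

sum-1 : ∀ {n} (xs : List (Fin n)) → sum (map (λ _ → 1) xs) ≡ length xs
sum-1 []       = refl
sum-1 (x ∷ xs) = cong suc (sum-1 xs)

length-unique-⊆ : ∀ {n} {xs ys : List (Fin n)} → Unique xs → (∀ {v} → v ∈ xs → v ∈ ys) → length xs ≤ length ys
length-unique-⊆ {xs = xs} {ys} uniq incl = subst₂ _≤_ (sum-1 xs) (sum-1 ys) (sum-unique-⊆ (λ _ → 1) uniq incl)

∣_∣-sum : ∀ {n} (S : Subset n) → sum (map (λ v → fromBool (lookup S v)) (allFin n)) ≡ ∣ S ∣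
∣ S ∣-sum = trans (cong sum (map-tabulate (λ v → v) (λ v → fromBool (lookup S v)))) (go S)
  where
  go : ∀ {n} (S : Subset n) → sum (List.tabulate (λ v → fromBool (lookup S v))) ≡ ∣ S ∣
  go []ᵛ           = refl
  go (true  ∷ᵛ S)  = cong suc (go S)
  go (false ∷ᵛ S)  = go S

fromList : ∀ {n} → List (Fin n) → Subset n
fromList []       = replicate _ false
fromList (v ∷ vs) = fromList vs [ v ]≔ true

∈-fromList : ∀ {n} {vs : List (Fin n)} {v} → v ∈ vs → lookup (fromList vs) v ≡ true
∈-fromList {vs = u ∷ vs} (here refl) = lookup∘update u (fromList vs) true
∈-fromList {vs = u ∷ vs} {v} (there v∈) with v Data.Fin.≟ u
... | yes refl = lookup∘update u (fromList vs) true
... | no v≢u   = trans (lookup∘update′ v≢u (fromList vs) true) (∈-fromList v∈)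

∣fromList∣ : ∀ {n} (vs : List (Fin n)) → ∣ fromList vs ∣ ≤ length vs
∣fromList∣ {n} [] = ≤-reflexive (empty n)
  where
  empty : ∀ n → ∣ replicate n false ∣ ≡ 0
  empty zero    = refl
  empty (suc n) = empty n
∣fromList∣ (v ∷ vs) = ≤-trans (insert (fromList vs) v) (s≤s (∣fromList∣ vs))
  where
  insert : ∀ {n} (S : Subset n) v → ∣ S [ v ]≔ true ∣ ≤ suc ∣ S ∣
  insert (true  ∷ᵛ S) zero    = n≤1+n _
  insert (false ∷ᵛ S) zero    = ≤-refl
  insert (true  ∷ᵛ S) (suc v) = s≤s (insert S v)
  insert (false ∷ᵛ S) (suc v) = insert S v

RootPath-unique : ∀ {n} {parent : Fin n → Maybe (Fin n)} {v k l} →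
                  RootPath parent v k → RootPath parent v l → k ≡ l
RootPath-unique (root e)    (root e′)    = refl
RootPath-unique (root e)    (step e′ q)  with () ← trans (sym e) e′
RootPath-unique (step e p)  (root e′)    with () ← trans (sym e) e′
RootPath-unique (step e p)  (step e′ q)  with refl ← just-injective (trans (sym e) e′) =
  cong suc (RootPath-unique p q)

-- Subtrees, paths to the root, and the final entry

module Forest {n : ℕ} (G : Graph n) (F : RootedForest n) (td : IsTreedepthDecomposition G F)
              (t : ℕ) (depth : HasDepth F t) (I : InputLists G F) where
  open InputLists I

  adj : Fin n → Fin n → Bool
  adj u v = does (adj? G u v)

  adj⇒Adj : ∀ {u v} → adj u v ≡ true → Adj G u v
  adj⇒Adj {u} {v} e with adj? G u v
  ... | yes uv = uv

  Adj⇒adj : ∀ {u v} → Adj G u v → adj u v ≡ true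
  Adj⇒adj {u} {v} = dec-true (adj? G u v)

  adj-sym : ∀ {u v} → adj u v ≡ true → adj v u ≡ true
  adj-sym e = Adj⇒adj (symmetric G (adj⇒Adj e))

  open DP adj children public

  _↟_ : Fin n → Fin n → Set
  u ↟ v = parent F u ≡ just v

  child⇒parent : ∀ {p u} → u ∈ children p → parent F u ≡ p
  child⇒parent {p} {u} = Equivalence.to (children-parent p u)

  parent⇒child : ∀ {p u} → parent F u ≡ p → u ∈ children p
  parent⇒child {p} {u} = Equivalence.from (children-parent p u)

  height : Fin n → ℕ
  height v = proj₁ (rooted F v)

  -- `HasDepth` speaks of leaves only, but a vertex of maximal height is a leaf, because a child
  -- would be higher.
  height≤t : ∀ v → height v ≤ t
  height≤t v = ≤-trans (deepest v) (proj₂ depth d (height d) leaf (proj₂ (rooted F d)))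
    where
    d : Fin n
    d = argmax height v (allFin n)
    deepest : ∀ u → height u ≤ height d
    deepest u = All.lookup (f[xs]≤f[argmax] {f = height} v (allFin n)) (∈-allFin u)
    leaf : Leaf F d
    leaf u u↟d = <-irrefl refl (subst (_≤ height d) (RootPath-unique (proj₂ (rooted F u)) (step u↟d (proj₂ (rooted F d)))) (deepest u))

  RootPath≤t : ∀ {v k} → RootPath (parent F) v k → k ≤ t
  RootPath≤t {v} p = subst (_≤ t) (RootPath-unique (proj₂ (rooted F v)) p) (height≤t v)

  -- A complete path up to a root, deepest vertex first, like `Path` without the flags; its length
  -- is the height of its first vertex.
  data Lineage : List (Fin n) → Set where
    []  : Lineage []
    _∷_ : ∀ {v P} → parent F v ≡ head P → Lineage P → Lineage (v ∷ P)

  Lineage-RootPath : ∀ {v P} → Lineage (v ∷ P) → RootPath (parent F) v (suc (length P))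
  Lineage-RootPath {P = []}    (e ∷ [])  = root e
  Lineage-RootPath {P = _ ∷ _} (e ∷ lin) = step e (Lineage-RootPath lin)

  Lineage≤t : ∀ {v P} → Lineage (v ∷ P) → suc (length P) ≤ t
  Lineage≤t lin = RootPath≤t (Lineage-RootPath lin)

  -- A lineage has at most t vertices, so that the level of v is among the h levels that P leaves
  -- over.
  fuel-pos : ∀ {h v P} → Lineage (v ∷ P) → length P + h ≡ t → ∃ λ h′ → h ≡ suc h′
  fuel-pos {zero}  {P = P} lin e = ⊥-elim (<⇒≱ (Lineage≤t lin) (≤-reflexive (trans (sym e) (+-identityʳ (length P)))))
  fuel-pos {suc h} lin e = h , refl

  down : ∀ {h} (v : Fin n) (P : List (Fin n)) → length P + suc h ≡ t → length (v ∷ P) + h ≡ t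
  down v P e = trans (sym (+-suc (length P) _)) e

  ∈-forest⁺ : ∀ h cs {c u} → c ∈ cs → u ∈ tree h c → u ∈ forest h cs
  ∈-forest⁺ h (c ∷ cs) (here refl) u∈ = ∈-++⁺ˡ u∈
  ∈-forest⁺ h (c ∷ cs) (there c∈)  u∈ = ∈-++⁺ʳ (tree h c) (∈-forest⁺ h cs c∈ u∈)

  ∈-forest⁻ : ∀ h cs {u} → u ∈ forest h cs → ∃ λ c → c ∈ cs × u ∈ tree h c
  ∈-forest⁻ h (c ∷ cs) u∈ with ∈-++⁻ (tree h c) u∈
  ... | inj₁ u∈c = c , here refl , u∈c
  ... | inj₂ u∈cs = let c′ , c′∈ , u∈c′ = ∈-forest⁻ h cs u∈cs in c′ , there c′∈ , u∈c′

  ∈-tree-self : ∀ {h v P} → Lineage (v ∷ P) → length P + h ≡ t → v ∈ tree h v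
  ∈-tree-self lin e with fuel-pos lin e
  ... | h , refl = here refl

  ∈-tree-child : ∀ {h v P x u} → Lineage (v ∷ P) → length P + h ≡ t → x ∈ tree h v → u ↟ x → u ∈ tree h v
  ∈-tree-child {suc h} {v} {P} lin e (here refl) ux =
    there (∈-forest⁺ h _ (parent⇒child ux) (∈-tree-self (ux ∷ lin) (down v P e)))
  ∈-tree-child {suc h} {v} {P} lin e (there x∈) ux with ∈-forest⁻ h (children (just v)) x∈
  ... | c , c∈ , x∈c = there (∈-forest⁺ h _ c∈ (∈-tree-child (child⇒parent c∈ ∷ lin) (down v P e) x∈c ux))

  Ancestor⇒∈ : ∀ {h v P u} → Lineage (v ∷ P) → length P + h ≡ t → Ancestor F v u → u ∈ tree h v
  Ancestor⇒∈ lin e ε        = ∈-tree-self lin e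
  Ancestor⇒∈ lin e (ux ◅ s) = ∈-tree-child lin e (Ancestor⇒∈ lin e s) ux

  ∈⇒Ancestor : ∀ h {v u} → u ∈ tree h v → Ancestor F v u
  ∈⇒Ancestor (suc h) (here refl) = ε
  ∈⇒Ancestor (suc h) {v} (there u∈) with ∈-forest⁻ h (children (just v)) u∈
  ... | c , c∈ , u∈c = append (∈⇒Ancestor h u∈c) (child⇒parent c∈)
    where
    append : ∀ {x y z} → Star _↟_ x y → y ↟ z → Star _↟_ x z
    append ε        yz = yz ◅ ε
    append (xx ◅ s) yz = xx ◅ append s yz

  Ancestor⇒lineage : ∀ {v P u} → Lineage (v ∷ P) → Ancestor F u v → u ∈ v ∷ P
  Ancestor⇒lineage lin ε = here refl
  Ancestor⇒lineage {P = []} (e ∷ lin) (vx ◅ s) with () ← trans (sym e) vx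
  Ancestor⇒lineage {P = p ∷ P} (e ∷ lin) (vx ◅ s) with refl ← just-injective (trans (sym e) vx) =
    there (Ancestor⇒lineage lin s)

  -- Induction along the root path, since the tree of a root is closed under taking children.
  all-vertices : ∀ {v k} → RootPath (parent F) v k → v ∈ forest t (children nothing)
  all-vertices (root e) = ∈-forest⁺ t _ (parent⇒child e) (∈-tree-self (e ∷ []) refl)
  all-vertices (step e p) with ∈-forest⁻ t (children nothing) (all-vertices p)
  ... | c , c∈ , x∈ = ∈-forest⁺ t _ c∈ (∈-tree-child (child⇒parent c∈ ∷ []) refl x∈ e)

  mutual
    -- Adjacent vertices are comparable: descendants of v are found in its tree, ancestors in its
    -- lineage, and irreflexivity excludes v itself.
    closed : ∀ h P v → Lineage (v ∷ P) → length P + h ≡ t → Closed h P v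
    closed zero    P v lin e = tt
    closed (suc h) P v lin e = near , closedForest h (v ∷ P) (children (just v)) lin child⇒parent (down v P e)
      where
      near : ∀ u → adj v u ≡ true → u ∈ P ⊎ u ∈ forest h (children (just v))
      near u vu with td v u (adj⇒Adj vu)
      ... | inj₁ v-anc with Ancestor⇒∈ lin e v-anc
      ...   | here refl = ⊥-elim (irreflexive G refl (adj⇒Adj vu))
      ...   | there u∈  = inj₂ u∈
      near u vu | inj₂ u-anc with Ancestor⇒lineage lin u-anc
      ...   | here refl = ⊥-elim (irreflexive G refl (adj⇒Adj vu))
      ...   | there u∈  = inj₁ u∈

    closedForest : ∀ h P cs → Lineage P → (∀ {c} → c ∈ cs → parent F c ≡ head P) →
                   length P + h ≡ t → ClosedForest h P cs
    closedForest h P []       lin par e = tt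
    closedForest h P (c ∷ cs) lin par e = closed h P c (par (here refl) ∷ lin) e , closedForest h P cs lin (par ∘ there) e

  RootPath-below : ∀ {x y k} → Star _↟_ x y → RootPath (parent F) y k → ∃ λ j → RootPath (parent F) x (j + k)
  RootPath-below ε        p = 0 , p
  RootPath-below (xz ◅ s) p = let j , q = RootPath-below s p in suc j , step xz q

  -- Each step towards the root lowers the height by one, so that a vertex has at most one ancestor
  -- on each level. This makes the trees of siblings disjoint.
  ancestors-level : ∀ {w c c′ k} → Star _↟_ w c → Star _↟_ w c′ →
                    RootPath (parent F) c k → RootPath (parent F) c′ k → c ≡ c′
  ancestors-level ε ε p q = refl
  ancestors-level {k = k} ε (e ◅ s) p q = let j , r = RootPath-below s q in
    ⊥-elim (<-irrefl (RootPath-unique p (step e r)) (s≤s (m≤n+m k j)))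
  ancestors-level {k = k} (e ◅ s) ε p q = let j , r = RootPath-below s p in
    ⊥-elim (<-irrefl (RootPath-unique q (step e r)) (s≤s (m≤n+m k j)))
  ancestors-level (e ◅ s) (e′ ◅ s′) p q with refl ← just-injective (trans (sym e) e′) = ancestors-level s s′ p q

  mutual
    tree-unique : ∀ h P v → Lineage (v ∷ P) → Unique (tree h v)
    tree-unique zero    P v lin = []
    tree-unique (suc h) P v lin =
      All.tabulate (λ { u∈ refl → v∉ u∈ }) ∷ forest-unique h (v ∷ P) _ lin child⇒parent (children-unique (just v))
      where
      v∉ : ¬ (v ∈ forest h (children (just v)))
      v∉ v∈ with ∈-forest⁻ h (children (just v)) v∈
      ... | c , c∈ , v∈c with RootPath-below (∈⇒Ancestor h v∈c) (step (child⇒parent c∈) (Lineage-RootPath lin))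
      ...   | j , r = <-irrefl (RootPath-unique (Lineage-RootPath lin) r) (m≤n+m (2 + length P) j)

    forest-unique : ∀ h P cs → Lineage P → (∀ {c} → c ∈ cs → parent F c ≡ head P) → Unique cs → Unique (forest h cs)
    forest-unique h P []       lin par uniq = []
    forest-unique h P (c ∷ cs) lin par (c∉ ∷ uniq) =
      Unique.++⁺ (tree-unique h P c (par (here refl) ∷ lin)) (forest-unique h P cs lin (par ∘ there) uniq) disjoint
      where
      disjoint : ∀ {w} → ¬ (w ∈ tree h c × w ∈ forest h cs)
      disjoint (w∈c , w∈cs) with ∈-forest⁻ h cs w∈cs
      ... | c′ , c′∈ , w∈c′ = All.lookup c∉ c′∈
        (ancestors-level (∈⇒Ancestor h w∈c) (∈⇒Ancestor h w∈c′)
          (Lineage-RootPath (par (here refl) ∷ lin)) (Lineage-RootPath (par (there c′∈) ∷ lin)))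

  roots : List (Fin n)
  roots = children nothing

  vertices-unique : Unique (forest t roots)
  vertices-unique = forest-unique t [] roots [] child⇒parent (children-unique nothing)

  vertices-length : length (forest t roots) ≤ n
  vertices-length = ≤-trans (length-unique-⊆ vertices-unique (λ {v} _ → ∈-allFin v)) (≤-reflexive (length-tabulate {n = n} (λ v → v)))

  -- Neighbours are distinct and comparable with v. Summed over all vertices this gives O(t n), as
  -- `weight-tree≤` shows.
  degree≤ : ∀ h P v → Lineage (v ∷ P) → length P + suc h ≡ t →
            length (neighbours v) ≤ length P + length (forest h (children (just v)))
  degree≤ h P v lin e = ≤-trans (length-unique-⊆ (neighbours-unique v) incl) (≤-reflexive (length-++ P))
    where
    incl : ∀ {u} → u ∈ neighbours v → u ∈ P ++ forest h (children (just v))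
    incl {u} u∈ = [ ∈-++⁺ˡ , ∈-++⁺ʳ P ]′ (proj₁ (closed (suc h) P v lin e) u (Adj⇒adj (Equivalence.to (neighbours-adj v u) u∈)))

  zeroTable : Table []
  zeroTable _ = 0

  γ : ℕ
  γ = processForest t [] roots zeroTable []ᵛ

  γ≤ : ∀ S → Dominating G S → γ ≤ ∣ S ∣
  γ≤ S dom = begin
    γ                                 ≤⟨ Bounded.bound bnd []ᵛ ⟩
    0 + chosen′ (forest t roots) + _  ≡⟨ cong (chosen′ (forest t roots) +_) (excess-[] (Bounded.E′ bnd)) ⟩
    chosen′ (forest t roots) + 0      ≡⟨ +-identityʳ _ ⟩
    chosen′ (forest t roots)          ≤⟨ sum-unique-⊆ _ vertices-unique (λ {v} _ → ∈-allFin v) ⟩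
    chosen′ (allFin n)                ≡⟨ ∣ S ∣-sum ⟩
    ∣ S ∣                             ∎
    where
    open ≤-Reasoning
    X : Fin n → Bool
    X = lookup S
    chosen′ : List (Fin n) → ℕ
    chosen′ vs = sum (map (λ v → fromBool (X v)) vs)
    excess-[] : ∀ (E : Vec Bool 0) → excess []ᵛ E ≡ 0
    excess-[] []ᵛ = refl
    dom′ : ∀ v → X v ≡ true ⊎ ∃ λ u → X u ≡ true × adj v u ≡ true
    dom′ v = Sum.map []=⇒lookup (λ { (u , u∈ , vu) → u , []=⇒lookup u∈ , Adj⇒adj vu }) (dom v)
    bnd = forest-chosen adj-sym X dom′ t [] roots {zeroTable} {0} {[]ᵛ}
            (closedForest t [] roots [] child⇒parent refl) [] (λ _ → z≤n)

  -- For the empty path there is no selected vertex outside the traced list, so that the list alone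
  -- dominates. The inequality suffices, since `γ≤` supplies the converse.
  γ-attained : ∃ λ S → Dominating G S × ∣ S ∣ ≤ γ
  γ-attained with trace-forest adj-sym t [] roots zeroTable []ᵛ
  ... | L , D′ , L≤ , tr = fromList L , dom ,
    ≤-trans (∣fromList∣ L) (≤-trans (≤-reflexive (sym (+-identityʳ (length L)))) L≤)
    where
    dom : Dominating G (fromList L)
    dom v with Traced.covers tr (all-vertices (proj₂ (rooted F v)))
    ... | inj₁ v∈ = inj₁ (lookup⇒[]= v (fromList L) (∈-fromList v∈))
    ... | inj₂ (u , inj₁ u∈ , vu) = inj₂ (u , lookup⇒[]= u (fromList L) (∈-fromList u∈) , adj⇒Adj vu)

  γ-correct : IsMinDominatingSetSize G γ
  γ-correct = let S , dom , S≤ = γ-attained in (S , dom , ≤-antisym S≤ (γ≤ S dom)) , γ≤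

  -- Without parents no two distinct vertices are comparable, so that there are no edges, and
  -- connectivity leaves one vertex.
  depth-1 : Connected G → t ≤ 1 → n ≤ 1
  depth-1 (v₀ , conn) t≤1 = ≤-trans (≤-reflexive (sym (length-tabulate {n = n} (λ v → v))))
    (length-unique-⊆ {ys = v₀ ∷ []} (Unique.allFin⁺ n) (λ {v} _ → here (star (conn v v₀))))
    where
    no-parent : ∀ {u v} → ¬ (u ↟ v)
    no-parent {u} {v} uv with rooted F v
    ... | _ , p@(root _)   = <⇒≱ ≤-refl (≤-trans (RootPath≤t (step uv p)) t≤1)
    ... | _ , p@(step _ _) = <⇒≱ (s≤s (s≤s z≤n)) (≤-trans (RootPath≤t (step uv p)) t≤1)
    anc : ∀ {u v} → Ancestor F u v → v ≡ u
    anc ε       = refl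
    anc (e ◅ _) = ⊥-elim (no-parent e)
    star : ∀ {u v} → Star (Adj G) u v → u ≡ v
    star ε = refl
    star (_◅_ {u} {v} uv s) = ⊥-elim (irreflexive G ([ (λ a → sym (anc a)) , anc ]′ (td u v uv)) uv)

-- The program and its execution

Reg : Set
Reg = Fin 30

rBase rBits rB rK rF rD rZ rCur rJ rRun rV rA rQ rW rS rX rY rI rFlag rI′ rFlag′ rDeg rC rU rP rSel rN rT rSaved rNew : Reg
rBase  = # 0
rBits  = # 1
rB     = # 2
rK     = # 3
rF     = # 4
rD     = # 5
rZ     = # 6
rCur   = # 7
rJ     = # 8
rRun   = # 9
rV     = # 10
rA     = # 11
rQ     = # 12
rW     = # 13
rS     = # 14
rX     = # 15
rY     = # 16
rI     = # 17
rFlag  = # 18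
rI′    = # 19
rFlag′ = # 20
rDeg   = # 21
rC     = # 22
rU     = # 23
rP     = # 24
rSel   = # 25
rN     = # 26
rT     = # 27
rSaved = # 28
rNew   = # 29

-- Reading leaves the address, the word and the shift in `rQ`, `rW` and `rS`, where `writeCell`
-- reuses them. The value to be written is expected in `rY` and survives there.
readCell writeCell : Cmd 30
readCell =
  calc rQ quo (reg rA) (reg rK) ⨾
  calc rQ add (reg rQ) (reg rF) ⨾
  load rW (reg rQ) ⨾
  calc rS rem (reg rA) (reg rK) ⨾
  calc rS mul (reg rS) (reg rBits) ⨾
  calc rX shr (reg rW) (reg rS) ⨾
  calc rX rem (reg rX) (reg rB)
writeCell =
  readCell ⨾
  calc rX shl (reg rX) (reg rS) ⨾
  calc rW sub (reg rW) (reg rX) ⨾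
  calc rX shl (reg rY) (reg rS) ⨾
  calc rW add (reg rW) (reg rX) ⨾
  store (reg rQ) (reg rW)

quo≡ : ∀ w x y .{{_ : NonZero y}} → evalOp w quo x y ≡ x / y
quo≡ w x (suc y) = refl

rem≡ : ∀ w x y .{{_ : NonZero y}} → evalOp w rem x y ≡ x % y
rem≡ w x (suc y) = refl

n<2^n : ∀ n → n < 2 ^ n
n<2^n zero    = s≤s z≤n
n<2^n (suc n) = begin
  2 + n              ≤⟨ +-mono-≤ {1} {2 ^ n} (m^n>0 2 n) (n<2^n n) ⟩
  2 ^ n + 2 ^ n      ≡⟨ cong (2 ^ n +_) (+-identityʳ (2 ^ n)) ⟨
  2 ^ suc n          ∎
  where open ≤-Reasoning

module CellAccess (O : Oracle) (w m : ℕ) (64<2^w : 64 < 2 ^ w)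
                  (b k F cellCount : ℕ) {{_ : NonZero b}} {{_ : NonZero k}} (kb≤w : k * b ≤ w) (b≤w : b ≤ w)
                  (inMemory : ∀ {a} → a < cellCount → a / k + F < m) (m<2^w : m < 2 ^ w) where
  open Exec O w m 64<2^w public
  open Cells b k F public

  cellConsts : List (Reg × ℕ)
  cellConsts = (rBits , b) ∷ (rB , B) ∷ (rK , k) ∷ (rF , F) ∷ []

  word< : ∀ {x} → x < B ^ k → x < 2 ^ w
  word< x< = <-≤-trans x< (≤-trans (≤-reflexive (trans (^-*-assoc 2 b k) (cong (2 ^_) (*-comm b k)))) (^-monoʳ-≤ 2 kb≤w))

  B≤2^w : B ≤ 2 ^ w
  B≤2^w = ^-monoʳ-≤ 2 b≤w

  private variable
    ρ : Env 30
    μ : Mem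
    Q : Env 30 → Mem → Set

  shift≤ : ∀ a → a % k * b ≤ w
  shift≤ a = ≤-trans (*-monoˡ-≤ b (<⇒≤ (m%n<n a k))) kb≤w

  readE′ : ∀ {a} → Holds ρ cellConsts → ρ rA ≡ a → a < cellCount → Words μ →
           (∀ ρ′ → Frame readCell ρ ρ′ → ρ′ rX ≡ cell μ a → ρ′ rQ ≡ a / k + F →
              ρ′ rW ≡ μ (a / k + F) → ρ′ rS ≡ a % k * b → Q ρ′ μ) →
           Exec readCell ρ μ 7 Q
  readE′ {μ = μ} {a = a} (eb , eB , eK , eF , _) ea a< ws κ = frameE
    (seqE $ calcE ea eK (quo≡ w a k) (≤-<-trans (m≤m+n (a / k) F) (<-trans (inMemory a<) m<2^w)) $
     seqE $ calcE refl eF refl (<-trans (inMemory a<) m<2^w) $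
     seqE $ loadE refl (inMemory a<) refl (word< (ws (a / k))) $
     seqE $ calcE ea eK (rem≡ w a k) (≤-<-trans (≤-trans (m≤m*n (a % k) b) (shift≤ a)) (n<2^n w)) $
     seqE $ calcE refl eb refl (≤-<-trans (shift≤ a) (n<2^n w)) $
     seqE $ calcE refl refl refl (≤-<-trans (m/n≤m (μ (a / k + F)) _ {{m^n≢0 2 (a % k * b)}}) (word< (ws (a / k)))) $
     calcE refl eB (trans (rem≡ w _ B) (digit-shift (a % k) (μ (a / k + F)))) (<-≤-trans (digit-< (a % k) (μ (a / k + F))) B≤2^w) $
     λ keep → κ _ keep refl refl refl refl)

  readE : ∀ {a} → Holds ρ cellConsts → ρ rA ≡ a → a < cellCount → Words μ →
          (∀ ρ′ → Frame readCell ρ ρ′ → ρ′ rX ≡ cell μ a → Q ρ′ μ) →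
          Exec readCell ρ μ 7 Q
  readE hc ea a< ws κ = readE′ hc ea a< ws (λ ρ′ keep ex _ _ _ → κ ρ′ keep ex)

  writeE : ∀ {a y} → Holds ρ cellConsts → ρ rA ≡ a → ρ rY ≡ y → y < B → a < cellCount → Words μ →
           (∀ ρ′ → Frame writeCell ρ ρ′ → Q ρ′ (setCell μ a y)) →
           Exec writeCell ρ μ 12 Q
  writeE {ρ = ρ} {μ = μ} {a = a} {y} hc ea ey y<B a< ws κ = frameE
    (seqE $ readE′ hc ea a< ws λ ρ′ keep eX eQ eW eS →
     seqE $ calcE eX eS refl (word< (≤-<-trans old≤ (ws (a / k)))) $
     seqE $ calcE eW refl refl (word< (≤-<-trans (m∸n≤m word (digit (a % k) word * 2 ^ (a % k * b))) (ws (a / k)))) $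
     seqE $ calcE (proj₁ (keep ((rY , y) ∷ []) (ey , tt))) eS refl (word< (≤-<-trans new≤ new<)) $
     seqE $ calcE refl refl (setDigit-shift (a % k) y word) (word< new<) $
     storeE eQ refl (inMemory a<) $
     λ keep′ → κ _ keep′)
    where
    word = μ (a / k + F)
    old≤ : digit (a % k) word * 2 ^ (a % k * b) ≤ word
    old≤ = digit≤ (a % k) word
    new< : setDigit (a % k) y word < B ^ k
    new< = setDigit-< {x = word} (m%n<n a k) y<B (ws (a / k))
    new≤ : y * 2 ^ (a % k * b) ≤ setDigit (a % k) y word
    new≤ = subst (y * 2 ^ (a % k * b) ≤_) (setDigit-shift (a % k) y word) (m≤n+m _ _)

-- The first bit, that of the deepest unselected vertex, is the lowest one. Leaving a further vertex
-- unselected therefore sends the index x to the pair 2 x and 2 x + 1.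
⟦_⟧ : ∀ {u} → Vec Bool u → ℕ
⟦ []ᵛ ⟧     = 0
⟦ b ∷ᵛ D ⟧  = fromBool b + 2 * ⟦ D ⟧

⟦⟧-< : ∀ {u} (D : Vec Bool u) → ⟦ D ⟧ < 2 ^ u
⟦⟧-< []ᵛ       = s≤s z≤n
⟦⟧-< {suc u} (b ∷ᵛ D)  = begin
  suc (fromBool b + 2 * ⟦ D ⟧)  ≤⟨ s≤s (+-monoˡ-≤ (2 * ⟦ D ⟧) (fromBool≤1 b)) ⟩
  2 + 2 * ⟦ D ⟧                 ≡⟨ *-suc 2 ⟦ D ⟧ ⟨
  2 * suc ⟦ D ⟧                 ≤⟨ *-monoʳ-≤ 2 (⟦⟧-< D) ⟩
  2 ^ suc u                     ∎
  where open ≤-Reasoning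

⟦∅⟧ : ∀ u → ⟦ ∅ {u} ⟧ ≡ 0
⟦∅⟧ zero    = refl
⟦∅⟧ (suc u) = cong (2 *_) (⟦∅⟧ u)

mod-2 : ∀ b x → (fromBool b + 2 * x) % 2 ≡ fromBool b
mod-2 b x = begin
  (fromBool b + 2 * x) % 2  ≡⟨ cong (λ y → (fromBool b + y) % 2) (*-comm 2 x) ⟩
  (fromBool b + x * 2) % 2  ≡⟨ [m+kn]%n≡m%n (fromBool b) x 2 ⟩
  fromBool b % 2            ≡⟨ m<n⇒m%n≡m (s≤s (fromBool≤1 b)) ⟩
  fromBool b                ∎
  where open ≡-Reasoning

half : ∀ b x → (fromBool b + 2 * x) / 2 ≡ x
half b x = *-cancelʳ-≡ _ _ 2 (+-cancelˡ-≡ (fromBool b) _ _ (begin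
  fromBool b + (fromBool b + 2 * x) / 2 * 2                ≡⟨ cong (_+ (fromBool b + 2 * x) / 2 * 2) (mod-2 b x) ⟨
  (fromBool b + 2 * x) % 2 + (fromBool b + 2 * x) / 2 * 2  ≡⟨ m≡m%n+[m/n]*n (fromBool b + 2 * x) 2 ⟨
  fromBool b + 2 * x                                       ≡⟨ cong (fromBool b +_) (*-comm 2 x) ⟩
  fromBool b + x * 2                                       ∎))
  where open ≡-Reasoning

isOdd-bit : ∀ b x → isOdd (fromBool b + 2 * x) ≡ b
isOdd-bit b x rewrite mod-2 b x = bit b
  where
  bit : ∀ b → does (fromBool b ≟ 1) ≡ b
  bit true  = refl
  bit false = refl

bit-split : ∀ x → ∃ λ b → x ≡ fromBool b + 2 * (x / 2)
bit-split x = go (x % 2) (m%n<n x 2) refl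
  where
  go : ∀ r → r < 2 → x % 2 ≡ r → ∃ λ b → x ≡ fromBool b + 2 * (x / 2)
  go 0 _ e = false , trans (m≡m%n+[m/n]*n x 2) (cong₂ _+_ e (*-comm (x / 2) 2))
  go 1 _ e = true , trans (m≡m%n+[m/n]*n x 2) (cong₂ _+_ e (*-comm (x / 2) 2))
  go (suc (suc r)) (s≤s (s≤s ())) e

⟦⟧-surjective : ∀ u x → x < 2 ^ u → ∃ λ (D : Vec Bool u) → ⟦ D ⟧ ≡ x
⟦⟧-surjective zero    zero    _  = []ᵛ , refl
⟦⟧-surjective zero    (suc x) (s≤s ())
⟦⟧-surjective (suc u) x x< with bit-split x
... | b , e with ⟦⟧-surjective u (x / 2) (m<n*o⇒m/o<n (subst (x <_) (*-comm 2 (2 ^ u)) x<))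
...   | D , eD = b ∷ᵛ D , trans (cong (λ y → fromBool b + 2 * y) eD) (sym e)

bitwise-∧ : ∀ {u} w (D C : Vec Bool u) → u ≤ w → bitwise _∧_ w ⟦ D ⟧ ⟦ C ⟧ ≡ ⟦ zipWith _∧_ D C ⟧
bitwise-∧ w []ᵛ []ᵛ _ = zeros w
  where
  zeros : ∀ w → bitwise _∧_ w 0 0 ≡ 0
  zeros zero    = refl
  zeros (suc w) = cong (2 *_) (zeros w)
bitwise-∧ (suc w) (d ∷ᵛ D) (c ∷ᵛ C) (s≤s u≤w)
  rewrite isOdd-bit d ⟦ D ⟧ | isOdd-bit c ⟦ C ⟧ | half d ⟦ D ⟧ | half c ⟦ C ⟧ | bitwise-∧ w D C u≤w = refl

zipWith-∅ : ∀ {u} (C : Vec Bool u) → zipWith _∧_ ∅ C ≡ ∅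
zipWith-∅ []ᵛ      = refl
zipWith-∅ (c ∷ᵛ C) = cong (false ∷ᵛ_) (zipWith-∅ C)

nth-∈ : ∀ {n} {xs : List (Fin n)} {x} → x ∈ xs → ∃ λ i → i < length xs × nth xs i ≡ toℕ x
nth-∈ (here refl) = 0 , s≤s z≤n , refl
nth-∈ (there x∈)  = let i , i< , e = nth-∈ x∈ in suc i , s≤s i< , e

∈-nth : ∀ {n} (xs : List (Fin n)) i {x} → i < length xs → nth xs i ≡ toℕ x → x ∈ xs
∈-nth (y ∷ xs) zero    i<       e = here (toℕ-injective (sym e))
∈-nth (y ∷ xs) (suc i) (s≤s i<) e = there (∈-nth xs i i< e)

nth-< : ∀ {n} (xs : List (Fin n)) {i} → i < length xs → nth xs i < n
nth-< (y ∷ xs) {zero}  _        = toℕ<n y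
nth-< (y ∷ xs) {suc i} (s≤s i<) = nth-< xs i<

nth-++ : ∀ {n} (as : List (Fin n)) {v cs} → nth (as ++ v ∷ cs) (length as) ≡ toℕ v
nth-++ []       = refl
nth-++ (a ∷ as) = nth-++ as

atVertex-toℕ : ∀ {n} (f : Fin n → ℕ) v → atVertex f (toℕ v) ≡ f v
atVertex-toℕ {n} f v with toℕ v <? n
... | yes v<n = cong f (fromℕ<-toℕ v v<n)
... | no v≮n  = ⊥-elim (v≮n (toℕ<n v))

-- Produces the mask of non-neighbours in `rC` and in `rU` whether v is undominated. Walking down
-- from the root and appending bits leaves the bit of the deepest vertex lowest, in accordance with
-- `⟦_⟧`.
scanInner scanBody scan : Cmd 30
scanInner =
  ask rX (neighbour (reg rV) (reg rI′)) ⨾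
  calc rX eq (reg rX) (reg rP) ⨾
  branch (reg rX) (calc rN add (imm 1) (imm 0)) skip
scanBody =
  calc rA mul (reg rI) (imm 4) ⨾
  load rP (reg rA) ⨾
  calc rA add (reg rA) (imm 1) ⨾
  load rSel (reg rA) ⨾
  calc rN add (imm 0) (imm 0) ⨾
  loop rI′ rFlag′ rDeg scanInner ⨾
  branch (reg rSel)
    (branch (reg rN) (calc rU add (imm 0) (imm 0)) skip)
    (calc rC add (reg rC) (reg rC) ⨾ calc rC add (reg rC) (imm 1) ⨾ calc rC sub (reg rC) (reg rN))
scan =
  ask rDeg (degree (reg rV)) ⨾
  calc rC add (imm 0) (imm 0) ⨾
  calc rU add (imm 1) (imm 0) ⨾
  loop rI rFlag rD scanBody

-- Selecting v raises all costs by one, which changes `rBase` only, and the differences are copied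
-- from the masked index. Leaving v out keeps the value at ∅ and with it the base, and `rU` is added
-- to the odd cells.
selectBody selectPass leaveBody leavePass : Cmd 30
selectBody =
  calc rX and (reg rI) (reg rC) ⨾
  calc rA add (reg rCur) (reg rX) ⨾
  readCell ⨾
  calc rY add (reg rX) (imm 0) ⨾
  calc rA add (reg rCur) (reg rZ) ⨾
  calc rA add (reg rA) (reg rI) ⨾
  writeCell
selectPass =
  loop rI rFlag rZ selectBody ⨾
  calc rCur add (reg rCur) (reg rZ) ⨾
  calc rBase add (reg rBase) (imm 1) ⨾
  calc rD add (reg rD) (imm 1) ⨾
  calc rJ add (imm 0) (imm 0)
leaveBody =
  calc rA add (reg rCur) (reg rI) ⨾
  readCell ⨾
  calc rY add (reg rX) (imm 0) ⨾
  calc rA add (reg rCur) (reg rZ) ⨾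
  calc rA add (reg rA) (reg rZ) ⨾
  calc rT add (reg rI) (reg rI) ⨾
  calc rA add (reg rA) (reg rT) ⨾
  writeCell ⨾
  calc rY add (reg rY) (reg rU) ⨾
  calc rA add (reg rA) (imm 1) ⨾
  writeCell
leavePass =
  loop rI rFlag rZ leaveBody ⨾
  calc rCur add (reg rCur) (reg rZ) ⨾
  calc rCur add (reg rCur) (reg rZ) ⨾
  calc rZ add (reg rZ) (reg rZ) ⨾
  calc rD add (reg rD) (imm 1) ⨾
  calc rJ add (imm 0) (imm 0)

-- The new base is needed before any difference can be written, so the minimum at ∅ is computed in
-- advance: from `rSaved`, the base of the table for selected v, and from cell 1 of the other table,
-- where the bit of v is set.
minXY combineBody combinePass : Cmd 30
minXY =
  calc rT lt (reg rX) (reg rY) ⨾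
  branch (reg rT) (calc rY add (reg rX) (imm 0)) skip
combineBody =
  calc rA add (reg rCur) (reg rZ) ⨾
  calc rA add (reg rA) (reg rI) ⨾
  readCell ⨾
  calc rY add (reg rX) (reg rSaved) ⨾
  calc rA add (reg rCur) (reg rZ) ⨾
  calc rA add (reg rA) (reg rZ) ⨾
  calc rT add (reg rI) (reg rI) ⨾
  calc rA add (reg rA) (reg rT) ⨾
  calc rA add (reg rA) (imm 1) ⨾
  readCell ⨾
  calc rX add (reg rX) (reg rBase) ⨾
  minXY ⨾
  calc rY sub (reg rY) (reg rNew) ⨾
  calc rA add (reg rCur) (reg rI) ⨾
  writeCell
combinePass =
  calc rA add (reg rCur) (reg rZ) ⨾
  calc rA add (reg rA) (reg rZ) ⨾
  calc rA add (reg rA) (imm 1) ⨾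
  readCell ⨾
  calc rX add (reg rX) (reg rBase) ⨾
  calc rY add (reg rSaved) (imm 0) ⨾
  minXY ⨾
  calc rNew add (reg rY) (imm 0) ⨾
  loop rI rFlag rZ combineBody ⨾
  calc rBase add (reg rNew) (imm 0)

-- K is a common unit for the bounds: everything below 256 K fits into a word.
record Sizes (n t : ℕ) : Set where
  field
    w b k cellCount F m K : ℕ
    K≥1        : 1 ≤ K
    2^t≤K      : 2 ^ t ≤ K
    n≤K        : n ≤ K
    256K≤2^w   : 256 * K ≤ 2 ^ w
    {{b≢0}}    : NonZero b
    {{k≢0}}    : NonZero k
    kb≤w       : k * b ≤ w
    b≤w        : b ≤ w
    t<b        : t < b
    F≡         : F ≡ b * 4
    cellCount≡ : cellCount ≡ 8 * 2 ^ t
    b≤K        : b ≤ K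
    2^b≤2K     : 2 ^ b ≤ 2 * K
    inMemory   : ∀ {a} → a < cellCount → a / k + F < m
    m≤         : m ≤ 13 * K

-- Overflow bounds and the path on the stack

module Setting {n : ℕ} (G : Graph n) (F′ : RootedForest n) (td : IsTreedepthDecomposition G F′)
               (t : ℕ) (depth : HasDepth F′ t) (I : InputLists G F′) (sizes : Sizes n t) where
  open InputLists I public
  open Forest G F′ td t depth I public
  open Sizes sizes public

  fit : ∀ q {x} {l : T (q ≤ᵇ 255)} → x ≤ q * K → x < 2 ^ w
  fit q {x} {l} x≤ = <-≤-trans (s≤s x≤) (≤-trans (+-mono-≤ K≥1 (*-monoˡ-≤ K (≤ᵇ⇒≤ q 255 l))) 256K≤2^w)

  64<2^w : 64 < 2 ^ w
  64<2^w = fit 64 (≤-trans (≤-reflexive (sym (*-identityʳ 64))) (*-monoʳ-≤ 64 K≥1))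

  infixl 6 _⊕_
  _⊕_ : ∀ {p q x y} → x ≤ p * K → y ≤ q * K → x + y ≤ (p + q) * K
  _⊕_ {p} {q} x≤ y≤ = ≤-trans (+-mono-≤ x≤ y≤) (≤-reflexive (sym (*-distribʳ-+ K p q)))

  unit : ∀ {x} → x ≤ K → x ≤ 1 * K
  unit x≤ = ≤-trans x≤ (≤-reflexive (sym (*-identityˡ K)))

  one : 1 ≤ 1 * K
  one = unit K≥1

  cellCount≤ : cellCount ≤ 8 * K
  cellCount≤ = ≤-trans (≤-reflexive cellCount≡) (*-monoʳ-≤ 8 2^t≤K)

  F≤ : F ≤ 4 * K
  F≤ = ≤-trans (≤-reflexive (trans F≡ (*-comm b 4))) (*-monoʳ-≤ 4 b≤K)

  m<2^w : m < 2 ^ w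
  m<2^w = fit 13 m≤

  stackInMemory : ∀ {a} → a < F → a < m
  stackInMemory a< = <-trans a< (≤-<-trans (m≤n+m F (0 / k)) (inMemory (subst (0 <_) (sym cellCount≡) (≤-trans (m^n>0 2 t) (m≤n*m (2 ^ t) 8)))))

  open CellAccess (oracle I) w m 64<2^w b k F cellCount kb≤w b≤w inMemory m<2^w public

  -- Only fields 0 and 1, which `scan` consults from all deeper levels. The saved fields 2 and 3
  -- concern the visit of their own level and are tracked there by separate equations.
  Stack : Mem → Path → Set
  Stack μ []            = ⊤
  Stack μ ((v , s) ∷ Γ) = μ (length Γ * 4) ≡ toℕ v × μ (length Γ * 4 + 1) ≡ fromBool s × Stack μ Γ

  -- The i vertices nearest to the root. `scan` meets the path in this order, whereas a `Path`
  -- begins with its deepest vertex.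
  bottom : ℕ → Path → Path
  bottom i []      = []
  bottom i (x ∷ Γ) = if length Γ <ᵇ i then x ∷ Γ else bottom i Γ

  bottom-all : ∀ Γ → bottom (length Γ) Γ ≡ Γ
  bottom-all []      = refl
  bottom-all (x ∷ Γ) rewrite dec-true (length Γ <? suc (length Γ)) ≤-refl = refl

  bottom-0 : ∀ Γ → bottom 0 Γ ≡ []
  bottom-0 []      = refl
  bottom-0 (x ∷ Γ) = bottom-0 Γ

  bottom-suc : ∀ {μ} Γ i → i < length Γ → Stack μ Γ → ∃ λ v → ∃ λ s →
               bottom (suc i) Γ ≡ (v , s) ∷ bottom i Γ × μ (i * 4) ≡ toℕ v × μ (i * 4 + 1) ≡ fromBool s
  bottom-suc (x@(v , s) ∷ Γ) i (s≤s i≤) (ev , es , st) with m≤n⇒m<n∨m≡n i≤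
  ... | inj₂ refl rewrite dec-true (length Γ <? suc (length Γ)) ≤-refl
                        | dec-false (length Γ <? length Γ) (<-irrefl refl) | bottom-all Γ = v , s , refl , ev , es
  ... | inj₁ i<   rewrite dec-false (length Γ <? suc i) (λ q → <⇒≱ i< (s≤s⁻¹ q))
                        | dec-false (length Γ <? i) (λ q → <⇒≱ i< (<⇒≤ q)) = bottom-suc Γ i i< st

  free≤ : ∀ Γ → free Γ ≤ length Γ
  free≤ []              = z≤n
  free≤ ((_ , true)  ∷ Γ) = m≤n⇒m≤1+n (free≤ Γ)
  free≤ ((_ , false) ∷ Γ) = s≤s (free≤ Γ)

  free-bottom≤ : ∀ i Γ → free (bottom i Γ) ≤ length Γ
  free-bottom≤ i []      = z≤n
  free-bottom≤ i (x ∷ Γ) with length Γ <ᵇ i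
  ... | true  = free≤ (x ∷ Γ)
  ... | false = m≤n⇒m≤1+n (free-bottom≤ i Γ)

  private variable
    ρ : Env 30
    μ : Mem
    Q : Env 30 → Mem → Set

  degree≤n : ∀ v → length (neighbours v) ≤ n
  degree≤n v = ≤-trans (length-unique-⊆ (neighbours-unique v) (λ {u} _ → ∈-allFin u)) (≤-reflexive (length-tabulate {n = n} (λ v → v)))

  bit≤ : ∀ b → fromBool b < 2 ^ w
  bit≤ b = ≤-<-trans (fromBool≤1 b) 1<2^w

  scanLoopE : ∀ v p → ρ rV ≡ toℕ v → ρ rP ≡ toℕ p → ρ rN ≡ 0 → ρ rDeg ≡ length (neighbours v) →
              (∀ ρ′ → Frame (loop rI′ rFlag′ rDeg scanInner) ρ ρ′ → ρ′ rN ≡ fromBool (adj v p) → Q ρ′ μ) →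
              Exec (loop rI′ rFlag′ rDeg scanInner) ρ μ (loopTime (length (neighbours v)) 4) Q
  scanLoopE {Q = Q} {μ = μ} v p eV eP eN eDeg κ = noStoreE $ frameE $
    loopE Inv (fit 1 (unit (≤-trans (degree≤n v) n≤K))) eDeg (λ h → h) (λ h → h)
      (eV , eP , inj₂ (eN , λ _ ())) body done
    where
    ns = neighbours v
    Inv : ℕ → Env 30 → Mem → Set
    Inv j ρ μ = ρ rV ≡ toℕ v × ρ rP ≡ toℕ p ×
                ((ρ rN ≡ 1 × p ∈ ns) ⊎ (ρ rN ≡ 0 × (∀ i → i < j → nth ns i ≢ toℕ p)))
    body : ∀ j ρ μ → j < length ns → ρ rI′ ≡ j → Inv j ρ μ → Exec scanInner ρ μ 4 (Inv (suc j))
    body j ρ μ j< ej (eV , eP , found) =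
      seqE $ askE (_ , _ , eV , ej , refl) (atVertex-toℕ (λ x → nth (neighbours x) j) v) (fit 1 (unit (≤-trans (<⇒≤ (nth-< ns j<)) n≤K))) $
      seqE $ calcE refl eP refl (bit≤ (does (nth ns j ≟ toℕ p))) $
      test (nth ns j ≟ toℕ p)
      where
      ρ₁ = set (set ρ rX (nth ns j)) rX (fromBool (does (nth ns j ≟ toℕ p)))
      test : Dec (nth ns j ≡ toℕ p) → Exec (branch (reg rX) (calc rN add (imm 1) (imm 0)) skip) ρ₁ μ 2 (Inv (suc j))
      test (yes e) = branchE₁ {v = 1} (cong fromBool (dec-true (nth ns j ≟ toℕ p) e)) (λ ())
        (calcE refl refl refl 1<2^w (eV , eP , inj₁ (refl , ∈-nth ns j j< e)))
      test (no ne) = branchE₀ (cong fromBool (dec-false (nth ns j ≟ toℕ p) ne)) (skipE (eV , eP , next found))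
        where
        next : (ρ rN ≡ 1 × p ∈ ns) ⊎ (ρ rN ≡ 0 × (∀ i → i < j → nth ns i ≢ toℕ p)) →
               (ρ rN ≡ 1 × p ∈ ns) ⊎ (ρ rN ≡ 0 × (∀ i → i < suc j → nth ns i ≢ toℕ p))
        next (inj₁ f) = inj₁ f
        next (inj₂ (e , none)) = inj₂ (e , λ i i< → [ none i , (λ { refl → ne }) ]′ (m≤n⇒m<n∨m≡n (s≤s⁻¹ i<)))
    done : ∀ ρ′ μ′ → Inv (length ns) ρ′ μ′ → _
    done ρ′ μ′ (_ , _ , inj₁ (e , p∈)) keep refl =
      κ ρ′ keep (trans e (cong fromBool (sym (Adj⇒adj (Equivalence.to (neighbours-adj v p) p∈)))))
    done ρ′ μ′ (_ , _ , inj₂ (e , none)) keep refl =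
      κ ρ′ keep (trans e (cong fromBool (sym (dec-false (adj? G v p)
        λ vp → let i , i< , ei = nth-∈ (Equivalence.from (neighbours-adj v p) vp) in none i i< ei))))

-- Verification of the scan and of the three table passes

module Passes {n : ℕ} (G : Graph n) (F′ : RootedForest n) (td : IsTreedepthDecomposition G F′)
              (t : ℕ) (depth : HasDepth F′ t) (I : InputLists G F′) (sizes : Sizes n t) where
  open Setting G F′ td t depth I sizes public

  private variable
    ρ : Env 30
    μ : Mem
    Q : Env 30 → Mem → Set

  slot< : ∀ {i} f → f < 4 → i < t → i * 4 + f < F
  slot< {i} f f< i< = begin-strict
    i * 4 + f    <⟨ +-monoʳ-< (i * 4) f< ⟩
    i * 4 + 4    ≡⟨ +-comm (i * 4) 4 ⟩
    suc i * 4    ≤⟨ *-monoˡ-≤ 4 (≤-trans i< (<⇒≤ t<b)) ⟩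
    b * 4        ≡⟨ F≡ ⟨
    F            ∎
    where open ≤-Reasoning

  slotFit : ∀ {i} f → f < 4 → i < t → i * 4 + f < 2 ^ w
  slotFit f f< i< = fit 4 (≤-trans (<⇒≤ (slot< f f< i<)) F≤)

  slot₀< : ∀ {i} → i < t → i * 4 < F
  slot₀< {i} i< = subst (_< F) (+-identityʳ (i * 4)) (slot< 0 (s≤s z≤n) i<)

  slot₀Fit : ∀ {i} → i < t → i * 4 < 2 ^ w
  slot₀Fit i< = fit 4 (≤-trans (<⇒≤ (slot₀< i<)) F≤)

  vertexFit : ∀ (v : Fin n) → toℕ v < 2 ^ w
  vertexFit v = fit 1 (unit (≤-trans (<⇒≤ (toℕ<n v)) n≤K))

  t≤K : t ≤ K
  t≤K = ≤-trans (<⇒≤ t<b) b≤K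

  mask≤ : ∀ {u} (D : Vec Bool u) → u ≤ t → ⟦ D ⟧ ≤ K
  mask≤ D u≤ = ≤-trans (<⇒≤ (⟦⟧-< D)) (≤-trans (^-monoʳ-≤ 2 u≤) 2^t≤K)

  -- How `scanBody` appends the negated adjacency bit to the mask without branching on it.
  double-bit : ∀ c a → c + c + 1 ∸ fromBool a ≡ fromBool (not a) + 2 * c
  double-bit c false = trans (+-comm (c + c) 1) (cong (λ x → suc (c + x)) (sym (+-identityʳ c)))
  double-bit c true  = trans (m+n∸n≡m (c + c) 1) (cong (c +_) (sym (+-identityʳ c)))

  scanTime : ℕ → ℕ → ℕ
  scanTime d deg = 3 + loopTime d (9 + loopTime deg 4)

  scanE : ∀ Γ v → ρ rV ≡ toℕ v → ρ rD ≡ length Γ → Stack μ Γ → length Γ < t →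
          (∀ ρ′ → Frame scan ρ ρ′ → ρ′ rC ≡ ⟦ nonNeighbours v Γ ⟧ → ρ′ rU ≡ fromBool (not (dominated v Γ)) → Q ρ′ μ) →
          Exec scan ρ μ (scanTime (length Γ) (length (neighbours v))) Q
  scanE {μ = μ₀} {Q = Q} Γ v eV eD st d< κ = frameE $
    seqE $ askE (_ , eV , refl) (atVertex-toℕ (λ x → length (neighbours x)) v) (fit 1 (unit (≤-trans (degree≤n v) n≤K))) $
    seqE $ calcE refl refl refl 0<2^w $
    seqE $ calcE refl refl refl 1<2^w $
    loopE Inv (fit 1 (unit (≤-trans (<⇒≤ d<) t≤K))) eD (λ h → h) (λ h → h)
      (refl , eV , refl , cong ⟦nonNeighbours⟧ (sym (bottom-0 Γ)) , cong undominated (sym (bottom-0 Γ)))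
      body (λ { ρ′ μ′ (refl , _ , _ , eC , eU) keep →
        κ ρ′ keep (trans eC (cong ⟦nonNeighbours⟧ (bottom-all Γ))) (trans eU (cong undominated (bottom-all Γ))) })
    where
    ⟦nonNeighbours⟧ undominated : Path → ℕ
    ⟦nonNeighbours⟧ Δ = ⟦ nonNeighbours v Δ ⟧
    undominated Δ = fromBool (not (dominated v Δ))
    deg = length (neighbours v)
    Inv : ℕ → Env 30 → Mem → Set
    Inv i ρ μ = μ ≡ μ₀ × ρ rV ≡ toℕ v × ρ rDeg ≡ deg ×
                ρ rC ≡ ⟦nonNeighbours⟧ (bottom i Γ) × ρ rU ≡ undominated (bottom i Γ)
    body : ∀ i ρ μ → i < length Γ → ρ rI ≡ i → Inv i ρ μ → Exec scanBody ρ μ (9 + loopTime deg 4) (Inv (suc i))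
    body i ρ .μ₀ i< eI (refl , eV , eDeg , eC , eU) with bottom-suc Γ i i< st
    ... | p , s , eb , ep , es =
      weaken (≤-reflexive (cong (5 +_) (+-comm (loopTime deg 4) 4))) $
      seqE $ calcE eI refl refl (slot₀Fit i<t) $
      seqE $ loadE refl (stackInMemory (slot₀< i<t)) ep (vertexFit p) $
      seqE $ calcE refl refl refl (slotFit 1 (s≤s (s≤s z≤n)) i<t) $
      seqE $ loadE refl (stackInMemory (slot< 1 (s≤s (s≤s z≤n)) i<t)) es (bit≤ s) $
      seqE $ calcE refl refl refl 0<2^w $
      seqE $ scanLoopE v p eV refl refl eDeg λ ρ′ keep eN →
      finish s eb ρ′ eN (keep ((rV , toℕ v) ∷ (rDeg , deg) ∷ (rC , _) ∷ (rU , _) ∷ (rSel , fromBool s) ∷ []) (eV , eDeg , eC , eU , refl , tt))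
      where
      i<t : i < t
      i<t = <-trans i< d<
      c = ⟦nonNeighbours⟧ (bottom i Γ)
      c≤ : c ≤ 1 * K
      c≤ = unit (mask≤ (nonNeighbours v (bottom i Γ)) (≤-trans (free-bottom≤ i Γ) (<⇒≤ d<)))
      finish : ∀ s → bottom (suc i) Γ ≡ (p , s) ∷ bottom i Γ → ∀ ρ′ → ρ′ rN ≡ fromBool (adj v p) →
               Holds ρ′ ((rV , toℕ v) ∷ (rDeg , deg) ∷ (rC , c) ∷ (rU , undominated (bottom i Γ)) ∷ (rSel , fromBool s) ∷ []) →
               Exec (branch (reg rSel)
                      (branch (reg rN) (calc rU add (imm 0) (imm 0)) skip)
                      (calc rC add (reg rC) (reg rC) ⨾ calc rC add (reg rC) (imm 1) ⨾ calc rC sub (reg rC) (reg rN)))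
                    ρ′ μ₀ 4 (Inv (suc i))
      finish false eb ρ′ eN (eV , eDeg , eC , eU , eS , _) =
        branchE₀ eS $
        seqE $ calcE eC eC refl (fit 2 (_⊕_ {1} {1} c≤ c≤)) $
        seqE $ calcE refl refl refl (fit 3 (_⊕_ {2} {1} (_⊕_ {1} {1} c≤ c≤) one)) $
        calcE refl eN refl (fit 3 (≤-trans (m∸n≤m (c + c + 1) (fromBool (adj v p))) (_⊕_ {2} {1} (_⊕_ {1} {1} c≤ c≤) one)))
          (refl , eV , eDeg , trans (double-bit c (adj v p)) (cong ⟦nonNeighbours⟧ (sym eb)) , trans eU (cong undominated (sym eb)))
      finish true eb ρ′ eN (eV , eDeg , eC , eU , eS , _) =
        branchE₁ eS (λ ()) (weaken (s≤s (s≤s z≤n)) (inner (adj v p) refl))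
        where
        eC′ : ρ′ rC ≡ ⟦nonNeighbours⟧ (bottom (suc i) Γ)
        eC′ = trans eC (cong ⟦nonNeighbours⟧ (sym eb))
        inner : ∀ a → adj v p ≡ a → Exec (branch (reg rN) (calc rU add (imm 0) (imm 0)) skip) ρ′ μ₀ 2 (Inv (suc i))
        inner true ea = branchE₁ (trans eN (cong fromBool ea)) (λ ())
          (calcE refl refl refl 0<2^w (refl , eV , eDeg , eC′ ,
            sym (trans (cong undominated eb) (cong (λ a → fromBool (not (a ∨ dominated v (bottom i Γ)))) ea))))
        inner false ea = branchE₀ (trans eN (cong fromBool ea))
          (skipE (refl , eV , eDeg , eC′ ,
            trans eU (sym (trans (cong undominated eb) (cong (λ a → fromBool (not (a ∨ dominated v (bottom i Γ)))) ea)))))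

  -- The registers fixed between iterations of the main loop; `es` takes those that matter only
  -- within a pass.
  fullRegs : (β d z cur j : ℕ) → List (Reg × ℕ) → List (Reg × ℕ)
  fullRegs β d z cur j es =
    (rBits , b) ∷ (rB , B) ∷ (rK , k) ∷ (rF , F) ∷
    (rBase , β) ∷ (rD , d) ∷ (rZ , z) ∷ (rCur , cur) ∷ (rJ , j) ∷ (rRun , 1) ∷ es

  cellFit : ∀ {a} → a ≤ cellCount → a < 2 ^ w
  cellFit a≤ = fit 8 (≤-trans a≤ cellCount≤)

  module Pass (β d z cur j : ℕ) (u : ℕ) (z≡ : z ≡ 2 ^ u) (u≤d : u ≤ d) (d<t : d < t)
              (β≤ : β ≤ n) (room : cur + 4 * z ≤ cellCount) where

    u≤t : u ≤ t
    u≤t = ≤-trans u≤d (<⇒≤ d<t)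

    z≤K : z ≤ K
    z≤K = ≤-trans (≤-reflexive z≡) (≤-trans (^-monoʳ-≤ 2 u≤t) 2^t≤K)

    -- `first` and `second` bound the addresses in the current table and in that for selected v,
    -- `third` and `fourth` the even and the odd cells of the table for unselected v.
    fourth : ∀ {i} → i < z → suc (cur + z + z + (i + i) + 1) ≤ cellCount
    fourth {i} i< = begin
      suc (cur + z + z + (i + i) + 1)   ≡⟨ lem cur z i ⟩
      cur + (z + z + (suc i + suc i))   ≤⟨ +-monoʳ-≤ cur (+-monoʳ-≤ (z + z) (+-mono-≤ i< i<)) ⟩
      cur + (z + z + (z + z))           ≡⟨ lem′ cur z ⟩
      cur + 4 * z                       ≤⟨ room ⟩
      cellCount                         ∎
      where
      open ≤-Reasoning
      lem : ∀ c z i → suc (c + z + z + (i + i) + 1) ≡ c + (z + z + (suc i + suc i))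
      lem = solve-∀
      lem′ : ∀ c z → c + (z + z + (z + z)) ≡ c + 4 * z
      lem′ = solve-∀

    third : ∀ {i} → i < z → cur + z + z + (i + i) < cellCount
    third i< = <-trans (≤-reflexive (+-comm 1 _)) (fourth i<)

    second≤ : cur + z + z ≤ cellCount
    second≤ = ≤-trans (≤-trans (≤-reflexive (+-assoc cur z z)) (+-monoʳ-≤ cur (+-monoʳ-≤ z (m≤m+n z (2 * z))))) room

    second : ∀ {i} → i < z → cur + z + i < cellCount
    second i< = <-≤-trans (+-monoʳ-< (cur + z) i<) second≤

    first≤ : cur + z ≤ cellCount
    first≤ = ≤-trans (m≤m+n (cur + z) z) second≤

    first : ∀ {i} → i < z → cur + i < cellCount
    first i< = <-≤-trans (+-monoʳ-< cur i<) first≤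

    dFit : d + 1 < 2 ^ w
    dFit = fit 1 (unit (≤-trans (≤-reflexive (+-comm d 1)) (≤-trans d<t t≤K)))

    cell<B : ∀ μ a → cell μ a < B
    cell<B μ a = digit-< (a % k) _

    iFit : ∀ {i} → i < z → i + i < 2 ^ w
    iFit i< = fit 2 (_⊕_ {1} {1} (unit (≤-trans (<⇒≤ i<) z≤K)) (unit (≤-trans (<⇒≤ i<) z≤K)))

    selectE : ∀ (C : Vec Bool u) → Holds ρ (fullRegs β d z cur j ((rC , ⟦ C ⟧) ∷ [])) → Words μ →
      (∀ ρ′ μ′ → Holds ρ′ (fullRegs (β + 1) (d + 1) z (cur + z) 0 []) → Kept (cur + z) μ μ′ →
         (∀ (D : Vec Bool u) → cell μ′ (cur + z + ⟦ D ⟧) ≡ cell μ (cur + ⟦ zipWith _∧_ D C ⟧)) → Q ρ′ μ′) →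
      Exec selectPass ρ μ (loopTime z 24 + 4) Q
    selectE {μ = μ₀} {Q = Q} C (eb , eB , eK , eF , eβ , ed , ez , hs) ws κ =
      seqE $ loopE Inv (fit 1 (unit z≤K)) ez (λ h → h) (λ h → h)
        ((eb , eB , eK , eF , eβ , ed , ez , hs) , kept-refl ws , λ _ ()) body done
      where
      es = fullRegs β d z cur j ((rC , ⟦ C ⟧) ∷ [])
      src : ℕ → ℕ
      src x = cur + bitwise _∧_ w x ⟦ C ⟧
      u≤w : u ≤ w
      u≤w = ≤-trans u≤t (≤-trans (<⇒≤ t<b) b≤w)
      masked : ∀ {i} → i < z → bitwise _∧_ w i ⟦ C ⟧ < z
      masked {i} i< with ⟦⟧-surjective u i (subst (i <_) z≡ i<)
      ... | D , refl = subst₂ _<_ (sym (bitwise-∧ w D C u≤w)) (sym z≡) (⟦⟧-< (zipWith _∧_ D C))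
      Inv : ℕ → Env 30 → Mem → Set
      Inv i ρ μ = Holds ρ es × Kept (cur + z) μ₀ μ × (∀ x → x < i → cell μ (cur + z + x) ≡ cell μ₀ (src x))
      body : ∀ i ρ μ → i < z → ρ rI ≡ i → Inv i ρ μ → Exec selectBody ρ μ 24 (Inv (suc i))
      body i ρ μ i< eI (h@(eb , eB , eK , eF , eβ , ed , ez , ecur , ej , er , eC , _) , kp , copied) =
        seqE $ calcE eI eC refl (fit 1 (unit (≤-trans (<⇒≤ (masked i<)) z≤K))) $
        seqE $ calcE ecur refl refl (cellFit (<⇒≤ (first (masked i<)))) $
        seqE $ readE (eb , eB , eK , eF , tt) refl (first (masked i<)) (words kp) λ ρ₁ keep₁ eX →
        let h₁ = keep₁ es h
            eI₁ = proj₁ (keep₁ ((rI , i) ∷ []) (eI , tt)) in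
        next h₁ eX eI₁
        where
        next : ∀ {ρ₁} → Holds ρ₁ es → ρ₁ rX ≡ cell μ (src i) → ρ₁ rI ≡ i →
               Exec (calc rY add (reg rX) (imm 0) ⨾ calc rA add (reg rCur) (reg rZ) ⨾
                     calc rA add (reg rA) (reg rI) ⨾ writeCell) ρ₁ μ 15 (Inv (suc i))
        next h₁@(eb , eB , eK , eF , eβ , ed , ez , ecur , ej , er , eC , _) eX eI₁ =
          seqE $ calcE eX refl (+-identityʳ _) (<-≤-trans (cell<B μ (src i)) B≤2^w) $
          seqE $ calcE ecur ez refl (cellFit first≤) $
          seqE $ calcE refl eI₁ refl (cellFit (<⇒≤ (second i<))) $
          writeE (eb , eB , eK , eF , tt) refl refl (cell<B μ (src i)) (second i<) (words kp) λ ρ₂ keep₂ →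
          keep₂ es h₁ , kept-setCell (m≤m+n (cur + z) i) (cell<B μ (src i)) kp ,
          λ x x≤ → [ (λ x< → trans (setCell-other μ (cell<B μ (src i)) (λ e → <⇒≢ x< (+-cancelˡ-≡ (cur + z) x i e))) (copied x x<))
                   , (λ { refl → trans (setCell-same μ (cur + z + i) (cell<B μ (src i)))
                                       (cells kp (src i) (+-monoʳ-< cur (masked i<))) }) ]′ (m≤n⇒m<n∨m≡n (s≤s⁻¹ x≤))
      done : ∀ ρ μ → Inv z ρ μ → Exec (calc rCur add (reg rCur) (reg rZ) ⨾ calc rBase add (reg rBase) (imm 1) ⨾
               calc rD add (reg rD) (imm 1) ⨾ calc rJ add (imm 0) (imm 0)) ρ μ 4 Q
      done ρ μ (h@(eb , eB , eK , eF , eβ , ed , ez , ecur , ej , er , eC , _) , kp , copied) =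
        seqE $ calcE ecur ez refl (cellFit first≤) $
        seqE $ calcE eβ refl refl (fit 2 (_⊕_ {1} {1} (unit (≤-trans β≤ n≤K)) one)) $
        seqE $ calcE ed refl refl dFit $
        calcE refl refl refl 0<2^w $
        κ _ μ (eb , eB , eK , eF , refl , refl , ez , refl , refl , er , tt) kp
          λ D → trans (copied ⟦ D ⟧ (subst (⟦ D ⟧ <_) (sym z≡) (⟦⟧-< D)))
                      (cong (λ x → cell μ₀ (cur + x)) (bitwise-∧ w D C u≤w))

    -- Adding `ud` must not overflow a cell. This is a hypothesis here, which `switchE` obtains from
    -- the Lipschitz property.
    leaveE : ∀ ud → ud ≤ 1 → Holds ρ (fullRegs β d z cur j ((rU , ud) ∷ [])) → Words μ →
      (∀ {x} → x < z → cell μ (cur + x) + ud < B) →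
      (∀ ρ′ μ′ → Holds ρ′ (fullRegs β (d + 1) (z + z) (cur + z + z) 0 []) → Kept (cur + z + z) μ μ′ →
         (∀ x → x < z → cell μ′ (cur + z + z + (x + x)) ≡ cell μ (cur + x) ×
                        cell μ′ (cur + z + z + (x + x) + 1) ≡ cell μ (cur + x) + ud) → Q ρ′ μ′) →
      Exec leavePass ρ μ (loopTime z 39 + 5) Q
    leaveE {μ = μ₀} {Q = Q} ud ud≤ (eb , eB , eK , eF , eβ , ed , ez , hs) ws small κ =
      seqE $ loopE Inv (fit 1 (unit z≤K)) ez (λ h → h) (λ h → h)
        ((eb , eB , eK , eF , eβ , ed , ez , hs) , kept-refl ws , λ _ ()) body done
      where
      es = fullRegs β d z cur j ((rU , ud) ∷ [])
      even odd : ℕ → ℕ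
      even x = cur + z + z + (x + x)
      odd x = even x + 1
      even< : ∀ {x i} → x < i → odd x < even i
      even< {x} {i} x<i = begin-strict
        cur + z + z + (x + x) + 1    ≡⟨ +-assoc (cur + z + z) (x + x) 1 ⟩
        cur + z + z + (x + x + 1)    <⟨ +-monoʳ-< (cur + z + z) (≤-trans (≤-reflexive (lem x)) (+-mono-≤ x<i x<i)) ⟩
        cur + z + z + (i + i)        ∎
        where
        open ≤-Reasoning
        lem : ∀ x → suc (x + x + 1) ≡ suc x + suc x
        lem = solve-∀
      even<odd : ∀ x → even x < odd x
      even<odd x = ≤-reflexive (+-comm 1 (even x))
      Inv : ℕ → Env 30 → Mem → Set
      Inv i ρ μ = Holds ρ es × Kept (cur + z + z) μ₀ μ ×
                  (∀ x → x < i → cell μ (even x) ≡ cell μ₀ (cur + x) × cell μ (odd x) ≡ cell μ₀ (cur + x) + ud)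
      body : ∀ i ρ μ → i < z → ρ rI ≡ i → Inv i ρ μ → Exec leaveBody ρ μ 39 (Inv (suc i))
      body i ρ μ i< eI (h@(eb , eB , eK , eF , eβ , ed , ez , ecur , ej , er , eU , _) , kp , copied) =
        seqE $ calcE ecur eI refl (cellFit (<⇒≤ (first i<))) $
        seqE $ readE (eb , eB , eK , eF , tt) refl (first i<) (words kp) λ ρ₁ keep₁ eX →
        next (keep₁ es h) (trans eX same) (proj₁ (keep₁ ((rI , i) ∷ []) (eI , tt)))
        where
        y = cell μ₀ (cur + i)
        same : cell μ (cur + i) ≡ y
        same = cells kp (cur + i) (<-≤-trans (+-monoʳ-< cur i<) (m≤m+n (cur + z) z))
        y<B : y < B
        y<B = cell<B μ₀ (cur + i)
        μ₁ = setCell μ (even i) y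
        kp₁ : Kept (cur + z + z) μ₀ μ₁
        kp₁ = kept-setCell (m≤m+n (cur + z + z) (i + i)) y<B kp
        μ₂ = setCell μ₁ (odd i) (y + ud)
        after : ∀ x → x < suc i → cell μ₂ (even x) ≡ cell μ₀ (cur + x) × cell μ₂ (odd x) ≡ cell μ₀ (cur + x) + ud
        after x x≤ with m≤n⇒m<n∨m≡n (s≤s⁻¹ x≤)
        ... | inj₂ refl =
          trans (setCell-other μ₁ (small i<) (<⇒≢ (even<odd i))) (setCell-same μ (even i) y<B) ,
          setCell-same μ₁ (odd i) (small i<)
        ... | inj₁ x<i =
          trans (setCell-other μ₁ (small i<) (<⇒≢ (<-trans (<-trans (even<odd x) (even< x<i)) (even<odd i))))
            (trans (setCell-other μ y<B (<⇒≢ (<-trans (even<odd x) (even< x<i)))) (proj₁ (copied x x<i))) ,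
          trans (setCell-other μ₁ (small i<) (<⇒≢ (<-trans (even< x<i) (even<odd i))))
            (trans (setCell-other μ y<B (<⇒≢ (even< x<i))) (proj₂ (copied x x<i)))
        next : ∀ {ρ₁} → Holds ρ₁ es → ρ₁ rX ≡ y → ρ₁ rI ≡ i →
               Exec (calc rY add (reg rX) (imm 0) ⨾ calc rA add (reg rCur) (reg rZ) ⨾
                     calc rA add (reg rA) (reg rZ) ⨾ calc rT add (reg rI) (reg rI) ⨾
                     calc rA add (reg rA) (reg rT) ⨾ writeCell ⨾ calc rY add (reg rY) (reg rU) ⨾
                     calc rA add (reg rA) (imm 1) ⨾ writeCell) ρ₁ μ 31 (Inv (suc i))
        next h₁@(eb , eB , eK , eF , eβ , ed , ez , ecur , ej , er , eU , _) eX eI₁ =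
          seqE $ calcE eX refl (+-identityʳ y) (<-≤-trans y<B B≤2^w) $
          seqE $ calcE ecur ez refl (cellFit first≤) $
          seqE $ calcE refl ez refl (cellFit second≤) $
          seqE $ calcE eI₁ eI₁ refl (iFit i<) $
          seqE $ calcE refl refl refl (cellFit (<⇒≤ (third i<))) $
          seqE $ writeE (eb , eB , eK , eF , tt) refl refl y<B (third i<) (words kp) λ ρ₂ keep₂ →
          last (keep₂ (fullRegs β d z cur j ((rU , ud) ∷ (rY , y) ∷ (rA , even i) ∷ []))
                 (eb , eB , eK , eF , eβ , ed , ez , ecur , ej , er , eU , refl , refl , tt))
          where
          last : ∀ {ρ₂} → Holds ρ₂ (fullRegs β d z cur j ((rU , ud) ∷ (rY , y) ∷ (rA , even i) ∷ [])) →
                 Exec (calc rY add (reg rY) (reg rU) ⨾ calc rA add (reg rA) (imm 1) ⨾ writeCell) ρ₂ μ₁ 14 (Inv (suc i))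
          last (eb , eB , eK , eF , eβ , ed , ez , ecur , ej , er , eU , eY , eA , _) =
            seqE $ calcE eY eU refl (<-≤-trans (small i<) B≤2^w) $
            seqE $ calcE eA refl refl (cellFit (<⇒≤ (fourth i<))) $
            writeE (eb , eB , eK , eF , tt) refl refl (small i<) (fourth i<) (words kp₁) λ ρ₃ keep₃ →
            keep₃ es (eb , eB , eK , eF , eβ , ed , ez , ecur , ej , er , eU , tt) ,
            kept-setCell (≤-trans (m≤m+n (cur + z + z) (i + i)) (m≤m+n (even i) 1)) (small i<) kp₁ , after
      done : ∀ ρ μ → Inv z ρ μ → Exec (calc rCur add (reg rCur) (reg rZ) ⨾ calc rCur add (reg rCur) (reg rZ) ⨾
               calc rZ add (reg rZ) (reg rZ) ⨾ calc rD add (reg rD) (imm 1) ⨾ calc rJ add (imm 0) (imm 0)) ρ μ 5 Q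
      done ρ μ ((eb , eB , eK , eF , eβ , ed , ez , ecur , ej , er , eU , _) , kp , copied) =
        seqE $ calcE ecur ez refl (cellFit first≤) $
        seqE $ calcE refl ez refl (cellFit second≤) $
        seqE $ calcE ez ez refl (fit 2 (_⊕_ {1} {1} (unit z≤K) (unit z≤K))) $
        seqE $ calcE ed refl refl dFit $
        calcE refl refl refl 0<2^w $
        κ _ μ (eb , eB , eK , eF , eβ , refl , refl , refl , refl , er , tt) kp copied

    cell≤ : ∀ μ a → cell μ a ≤ 2 * K
    cell≤ μ a = ≤-trans (<⇒≤ (cell<B μ a)) 2^b≤2K

    combineE : ∀ β′ → β′ ≤ n → Holds ρ (fullRegs β d z cur j ((rSaved , β′) ∷ [])) → Words μ →
      let ν   = (cell μ (cur + z + z + 1) + β) ⊓ β′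
          f x = (cell μ (cur + z + z + (x + x) + 1) + β) ⊓ (cell μ (cur + z + x) + β′) ∸ ν in
      (∀ {x} → x < z → f x < B) →
      (∀ ρ′ μ′ → Holds ρ′ (fullRegs ν d z cur j []) → Kept cur μ μ′ →
         (∀ x → x < z → cell μ′ (cur + x) ≡ f x) → Q ρ′ μ′) →
      Exec combinePass ρ μ (16 + (loopTime z 40 + 1)) Q
    combineE {μ = μ₀} {Q = Q} β′ β′≤ h₀@(eb , eB , eK , eF , eβ , ed , ez , ecur , ej , er , eS , _) ws small κ =
      seqE $ calcE ecur ez refl (cellFit first≤) $
      seqE $ calcE refl ez refl (cellFit second≤) $
      seqE $ calcE refl refl refl (cellFit (<⇒≤ base<)) $
      seqE $ readE (eb , eB , eK , eF , tt) refl base< ws λ ρ₁ keep₁ eX → prelude (keep₁ es h₀) eX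
      where
      es = fullRegs β d z cur j ((rSaved , β′) ∷ [])
      ν : ℕ
      ν = (cell μ₀ (cur + z + z + 1) + β) ⊓ β′
      f : ℕ → ℕ
      f x = (cell μ₀ (cur + z + z + (x + x) + 1) + β) ⊓ (cell μ₀ (cur + z + x) + β′) ∸ ν
      es′ = fullRegs β d z cur j ((rSaved , β′) ∷ (rNew , ν) ∷ [])
      0<z : 0 < z
      0<z = subst (0 <_) (sym z≡) (m^n>0 2 u)
      base< : cur + z + z + 1 < cellCount
      base< = subst (λ x → x + 1 < cellCount) (+-identityʳ (cur + z + z)) (fourth 0<z)
      valFit : ∀ μ a {v} → v ≤ n → cell μ a + v ≤ 3 * K
      valFit μ a v≤ = _⊕_ {2} {1} (cell≤ μ a) (unit (≤-trans v≤ n≤K))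
      -- The pass overwrites the current table in place, but the two tables that it reads begin at
      -- cur + z and keep their contents.
      Inv : ℕ → Env 30 → Mem → Set
      Inv i ρ μ = Holds ρ es′ × Kept cur μ₀ μ × (∀ a → cur + z ≤ a → cell μ a ≡ cell μ₀ a) ×
                  (∀ x → x < i → cell μ (cur + x) ≡ f x)
      minE : ∀ {ρ μ Q x y} → ρ rX ≡ x → ρ rY ≡ y → x < 2 ^ w →
             (∀ ρ′ → Frame minXY ρ ρ′ → ρ′ rY ≡ x ⊓ y → Q ρ′ μ) → Exec minXY ρ μ 3 Q
      minE {x = x} {y} eX eY x< κ = frameE $ seqE $ calcE eX eY refl (bit≤ (does (x <? y))) (test (x <? y))
        where
        test : Dec (x < y) → Exec (branch (reg rT) (calc rY add (reg rX) (imm 0)) skip)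
                 (set _ rT (fromBool (does (x <? y)))) _ 2 _
        test (yes x<y) = branchE₁ (cong fromBool (dec-true (x <? y) x<y)) (λ ())
          (calcE eX refl (+-identityʳ x) x< (λ keep → κ _ keep (sym (m≤n⇒m⊓n≡m (<⇒≤ x<y)))))
        test (no x≮y) = branchE₀ (cong fromBool (dec-false (x <? y) x≮y))
          (skipE (λ keep → κ _ keep (trans eY (sym (m≥n⇒m⊓n≡n (≮⇒≥ x≮y))))))
      body : ∀ i ρ μ → i < z → ρ rI ≡ i → Inv i ρ μ → Exec combineBody ρ μ 40 (Inv (suc i))
      body i ρ μ i< eI (h@(eb , eB , eK , eF , eβ , ed , ez , ecur , ej , er , eS , eN , _) , kp , above , copied) =
        seqE $ calcE ecur ez refl (cellFit first≤) $
        seqE $ calcE refl eI refl (cellFit (<⇒≤ (second i<))) $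
        seqE $ readE (eb , eB , eK , eF , tt) refl (second i<) (words kp) λ ρ₁ keep₁ eX →
        next (keep₁ es′ h) (trans eX (above _ (m≤m+n (cur + z) i))) (proj₁ (keep₁ ((rI , i) ∷ []) (eI , tt)))
        where
        y = cell μ₀ (cur + z + i) + β′
        x = cell μ₀ (cur + z + z + (i + i) + 1) + β
        last : ∀ {ρ₃} → Holds ρ₃ es′ → ρ₃ rY ≡ x ⊓ y → ρ₃ rI ≡ i →
               Exec (calc rY sub (reg rY) (reg rNew) ⨾ calc rA add (reg rCur) (reg rI) ⨾ writeCell) ρ₃ μ 14 (Inv (suc i))
        last h₃@(eb , eB , eK , eF , eβ , ed , ez , ecur , ej , er , eS , eN , _) eY eI₃ =
          seqE $ calcE eY eN refl (<-≤-trans (small i<) B≤2^w) $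
          seqE $ calcE ecur eI₃ refl (cellFit (<⇒≤ (first i<))) $
          writeE (eb , eB , eK , eF , tt) refl refl (small i<) (first i<) (words kp) λ ρ₄ keep₄ →
          keep₄ es′ h₃ , kept-setCell (m≤m+n cur i) (small i<) kp ,
          (λ a a≥ → trans (setCell-other μ (small i<) (λ e → <⇒≢ (<-≤-trans (+-monoʳ-< cur i<) a≥) (sym e))) (above a a≥)) ,
          λ x′ x′≤ → [ (λ x′< → trans (setCell-other μ (small i<) (λ e → <⇒≢ x′< (+-cancelˡ-≡ cur x′ i e))) (copied x′ x′<))
                     , (λ { refl → setCell-same μ (cur + i) (small i<) }) ]′ (m≤n⇒m<n∨m≡n (s≤s⁻¹ x′≤))
        mid : ∀ {ρ₂} → Holds ρ₂ es′ → ρ₂ rX ≡ cell μ₀ (cur + z + z + (i + i) + 1) → ρ₂ rY ≡ y → ρ₂ rI ≡ i →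
              Exec (calc rX add (reg rX) (reg rBase) ⨾ minXY ⨾ calc rY sub (reg rY) (reg rNew) ⨾
                    calc rA add (reg rCur) (reg rI) ⨾ writeCell) ρ₂ μ 18 (Inv (suc i))
        mid h₂@(eb , eB , eK , eF , eβ , ed , ez , ecur , ej , er , eS , eN , _) eX eY eI₂ =
          seqE $ calcE eX eβ refl (fit 3 (valFit μ₀ (cur + z + z + (i + i) + 1) β≤)) $
          seqE $ minE refl eY (fit 3 (valFit μ₀ (cur + z + z + (i + i) + 1) β≤)) λ ρ₃ keep₃ eY₃ →
          last (keep₃ es′ h₂) eY₃ (proj₁ (keep₃ ((rI , i) ∷ []) (eI₂ , tt)))
        next : ∀ {ρ₁} → Holds ρ₁ es′ → ρ₁ rX ≡ cell μ₀ (cur + z + i) → ρ₁ rI ≡ i →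
               Exec (calc rY add (reg rX) (reg rSaved) ⨾ calc rA add (reg rCur) (reg rZ) ⨾
                     calc rA add (reg rA) (reg rZ) ⨾ calc rT add (reg rI) (reg rI) ⨾
                     calc rA add (reg rA) (reg rT) ⨾ calc rA add (reg rA) (imm 1) ⨾ readCell ⨾
                     calc rX add (reg rX) (reg rBase) ⨾ minXY ⨾ calc rY sub (reg rY) (reg rNew) ⨾
                     calc rA add (reg rCur) (reg rI) ⨾ writeCell) ρ₁ μ 31 (Inv (suc i))
        next h₁@(eb , eB , eK , eF , eβ , ed , ez , ecur , ej , er , eS , eN , _) eX eI₁ =
          seqE $ calcE eX eS refl (fit 3 (valFit μ₀ (cur + z + i) β′≤)) $
          seqE $ calcE ecur ez refl (cellFit first≤) $
          seqE $ calcE refl ez refl (cellFit second≤) $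
          seqE $ calcE eI₁ eI₁ refl (iFit i<) $
          seqE $ calcE refl refl refl (cellFit (<⇒≤ (third i<))) $
          seqE $ calcE refl refl refl (cellFit (<⇒≤ (fourth i<))) $
          seqE $ readE (eb , eB , eK , eF , tt) refl (fourth i<) (words kp) λ ρ₂ keep₂ eX₂ →
          mid (keep₂ es′ h₁) (trans eX₂ (above _ (≤-trans (m≤m+n (cur + z) z) (≤-trans (m≤m+n (cur + z + z) (i + i)) (m≤m+n _ 1)))))
            (proj₁ (keep₂ ((rY , y) ∷ []) (refl , tt))) (proj₁ (keep₂ ((rI , i) ∷ []) (eI₁ , tt)))
      νFit : ν < 2 ^ w
      νFit = fit 1 (unit (≤-trans (m⊓n≤n _ β′) (≤-trans β′≤ n≤K)))
      done : ∀ ρ μ → Inv z ρ μ → Exec (calc rBase add (reg rNew) (imm 0)) ρ μ 1 Q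
      done ρ μ ((eb , eB , eK , eF , eβ , ed , ez , ecur , ej , er , eS , eN , _) , kp , _ , copied) =
        calcE eN refl (+-identityʳ ν) νFit $
        κ _ μ (eb , eB , eK , eF , refl , ed , ez , ecur , ej , er , tt) kp copied
      pass : ∀ {ρ₂} → Holds ρ₂ es → ρ₂ rY ≡ ν →
             Exec (calc rNew add (reg rY) (imm 0) ⨾ loop rI rFlag rZ combineBody ⨾
                   calc rBase add (reg rNew) (imm 0)) ρ₂ μ₀ (1 + (loopTime z 40 + 1)) Q
      pass (eb , eB , eK , eF , eβ , ed , ez , ecur , ej , er , eS , _) eY =
        seqE $ calcE eY refl (+-identityʳ ν) νFit $
        seqE $ loopE Inv (fit 1 (unit z≤K)) ez (λ h → h) (λ h → h)
          ((eb , eB , eK , eF , eβ , ed , ez , ecur , ej , er , eS , refl , tt) , kept-refl ws , (λ _ _ → refl) , λ _ ()) body done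
      prelude : ∀ {ρ₁} → Holds ρ₁ es → ρ₁ rX ≡ cell μ₀ (cur + z + z + 1) →
                Exec (calc rX add (reg rX) (reg rBase) ⨾ calc rY add (reg rSaved) (imm 0) ⨾ minXY ⨾
                      calc rNew add (reg rY) (imm 0) ⨾ loop rI rFlag rZ combineBody ⨾
                      calc rBase add (reg rNew) (imm 0)) ρ₁ μ₀ (6 + (loopTime z 40 + 1)) Q
      prelude h₁@(eb , eB , eK , eF , eβ , ed , ez , ecur , ej , er , eS , _) eX =
        seqE $ calcE eX eβ refl (fit 3 (valFit μ₀ (cur + z + z + 1) β≤)) $
        seqE $ calcE eS refl (+-identityʳ β′) (fit 1 (unit (≤-trans β′≤ n≤K))) $
        seqE $ minE refl refl (fit 3 (valFit μ₀ (cur + z + z + 1) β≤)) λ ρ₂ keep₂ eY₂ →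
        pass (keep₂ es h₁) eY₂

-- Word 4 i + f of the stack describes the i-th path vertex: the vertex (f = 0),
-- whether it is selected (1), its index among its siblings (2), and a saved base
-- value (3), namely that of the parent's table while v is selected and that of
-- the result for selected v afterwards.  The table of the current path occupies
-- z cells from cur on; the tables made from it for a child v start at cur + z if
-- v is selected (z cells), and at cur + z + z otherwise (2 z cells).
countChildren fetchChild descend switch return mainBody main : Cmd 30
countChildren =
  branch (reg rD)
    (calc rA sub (reg rD) (imm 1) ⨾ calc rA mul (reg rA) (imm 4) ⨾ load rP (reg rA) ⨾ ask rN (childCount (reg rP)))
    (ask rN rootCount)
fetchChild =
  branch (reg rD) (ask rV (childAt (reg rP) (reg rJ))) (ask rV (rootAt (reg rJ)))
descend =
  fetchChild ⨾
  calc rA mul (reg rD) (imm 4) ⨾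
  store (reg rA) (reg rV) ⨾
  calc rA add (reg rA) (imm 1) ⨾
  store (reg rA) (imm 1) ⨾
  calc rA add (reg rA) (imm 1) ⨾
  store (reg rA) (reg rJ) ⨾
  calc rA add (reg rA) (imm 1) ⨾
  store (reg rA) (reg rBase) ⨾
  scan ⨾
  selectPass
switch =
  store (reg rA) (imm 0) ⨾
  calc rA add (reg rA) (imm 2) ⨾
  load rSaved (reg rA) ⨾
  store (reg rA) (reg rBase) ⨾
  calc rBase add (reg rSaved) (imm 0) ⨾
  calc rCur sub (reg rCur) (reg rZ) ⨾
  scan ⨾
  leavePass
return =
  calc rA add (reg rA) (imm 1) ⨾
  load rJ (reg rA) ⨾
  calc rJ add (reg rJ) (imm 1) ⨾
  calc rA add (reg rA) (imm 1) ⨾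
  load rSaved (reg rA) ⨾
  calc rZ quo (reg rZ) (imm 2) ⨾
  calc rCur sub (reg rCur) (reg rZ) ⨾
  calc rCur sub (reg rCur) (reg rZ) ⨾
  combinePass
mainBody =
  countChildren ⨾
  calc rX lt (reg rJ) (reg rN) ⨾
  branch (reg rX)
    descend
    (branch (reg rD)
      (calc rD sub (reg rD) (imm 1) ⨾
       calc rA mul (reg rD) (imm 4) ⨾
       load rV (reg rA) ⨾
       calc rA add (reg rA) (imm 1) ⨾
       load rX (reg rA) ⨾
       branch (reg rX) switch return)
      (calc rRun add (imm 0) (imm 0)))
main = while (reg rRun) mainBody

-- Single iterations of the main loop

module Steps {n : ℕ} (G : Graph n) (F′ : RootedForest n) (td : IsTreedepthDecomposition G F′)
             (t : ℕ) (depth : HasDepth F′ t) (I : InputLists G F′) (sizes : Sizes n t) where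
  open Passes G F′ td t depth I sizes public

  private variable
    ρ : Env 30
    μ : Mem
    Q : Env 30 → Mem → Set

  top : Path → Maybe (Fin n)
  top Γ = head (map proj₁ Γ)

  Stored : ∀ {u} → Mem → ℕ → ℕ → (Vec Bool u → ℕ) → Set
  Stored μ cur β M = ∀ D → β + cell μ (cur + ⟦ D ⟧) ≡ M D

  -- The state at the head of the main loop: j children of the top vertex (or j roots) are finished,
  -- and M already accounts for them.
  record Conf (Γ : Path) (M : Table Γ) (cur j : ℕ) (ρ : Env 30) (μ : Mem) : Set where
    field
      regsOK  : Holds ρ (fullRegs (M ∅) (length Γ) (2 ^ free Γ) cur j [])
      stackOK : Stack μ Γ
      tableOK : Stored μ cur (M ∅) M
      wordsOK : Words μ
  open Conf public

  -- The starts of the tables grow like a geometric series: one level moves `cur` by at most 2 · 2 ^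
  -- free Γ, while the right side doubles. Together with the two tables built from the current one
  -- this leads to 8 · 2 ^ t cells.
  Room : Path → ℕ → Set
  Room Γ cur = cur + 2 * 2 ^ free Γ ≤ 4 * 2 ^ length Γ

  2^free≤ : ∀ Γ → 2 ^ free Γ ≤ 2 ^ length Γ
  2^free≤ Γ = ^-monoʳ-≤ 2 (free≤ Γ)

  room-select : ∀ {Γ v cur} → Room Γ cur → Room ((v , true) ∷ Γ) (cur + 2 ^ free Γ)
  room-select {Γ} {v} {cur} r = begin
    cur + z + 2 * z           ≡⟨ lem cur z ⟩
    cur + 2 * z + z           ≤⟨ +-mono-≤ r (2^free≤ Γ) ⟩
    4 * y + y                 ≤⟨ +-monoʳ-≤ (4 * y) (m≤n*m y 4) ⟩
    4 * y + 4 * y             ≡⟨ lem′ y ⟩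
    4 * (2 * y)               ∎
    where
    open ≤-Reasoning
    z = 2 ^ free Γ
    y = 2 ^ length Γ
    lem : ∀ c z → c + z + 2 * z ≡ c + 2 * z + z
    lem = solve-∀
    lem′ : ∀ y → 4 * y + 4 * y ≡ 4 * (2 * y)
    lem′ = solve-∀

  room-leave : ∀ {Γ v cur} → Room Γ cur → Room ((v , false) ∷ Γ) (cur + 2 ^ free Γ + 2 ^ free Γ)
  room-leave {Γ} {v} {cur} r = begin
    cur + z + z + 2 * (2 * z)    ≡⟨ lem cur z ⟩
    cur + 2 * z + 4 * z          ≤⟨ +-mono-≤ r (*-monoʳ-≤ 4 (2^free≤ Γ)) ⟩
    4 * y + 4 * y                ≡⟨ lem′ y ⟩
    4 * (2 * y)                  ∎
    where
    open ≤-Reasoning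
    z = 2 ^ free Γ
    y = 2 ^ length Γ
    lem : ∀ c z → c + z + z + 2 * (2 * z) ≡ c + 2 * z + 4 * z
    lem = solve-∀
    lem′ : ∀ y → 4 * y + 4 * y ≡ 4 * (2 * y)
    lem′ = solve-∀

  room-cells : ∀ {Γ cur} → length Γ < t → Room Γ cur → cur + 4 * 2 ^ free Γ ≤ cellCount
  room-cells {Γ} {cur} d<t r = begin
    cur + 4 * z                  ≡⟨ lem cur z ⟩
    cur + 2 * z + 2 * z          ≤⟨ +-mono-≤ r (*-mono-≤ {2} {4} (s≤s (s≤s z≤n)) (2^free≤ Γ)) ⟩
    4 * y + 4 * y                ≡⟨ lem′ y ⟩
    8 * y                        ≤⟨ *-monoʳ-≤ 8 (^-monoʳ-≤ 2 (<⇒≤ d<t)) ⟩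
    8 * 2 ^ t                    ≡⟨ cellCount≡ ⟨
    cellCount                    ∎
    where
    open ≤-Reasoning
    z = 2 ^ free Γ
    y = 2 ^ length Γ
    lem : ∀ c z → c + 4 * z ≡ c + 2 * z + 2 * z
    lem = solve-∀
    lem′ : ∀ y → 4 * y + 4 * y ≡ 8 * y
    lem′ = solve-∀

  stack-kept : ∀ {μ μ′} Γ → (∀ a → a < length Γ * 4 → μ′ a ≡ μ a) → Stack μ Γ → Stack μ′ Γ
  stack-kept []            same _               = tt
  stack-kept ((v , s) ∷ Γ) same (ev , es , st) =
    trans (same _ (m<n+m (length Γ * 4) {4} (s≤s z≤n))) ev ,
    trans (same _ (≤-trans (≤-reflexive (cong suc (+-comm (length Γ * 4) 1))) (+-monoˡ-≤ (length Γ * 4) {2} {4} (s≤s (s≤s z≤n))))) es ,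
    stack-kept Γ (λ a a< → same a (<-trans a< (m<n+m (length Γ * 4) {4} (s≤s z≤n)))) st

  childCount≤ : ∀ p → length (children p) ≤ n
  childCount≤ p = ≤-trans (length-unique-⊆ (children-unique p) (λ {u} _ → ∈-allFin u)) (≤-reflexive (length-tabulate {n = n} (λ v → v)))

  countFit : ∀ p → length (children p) < 2 ^ w
  countFit p = fit 1 (unit (≤-trans (childCount≤ p) n≤K))

  ParentReg : Env 30 → Path → Set
  ParentReg ρ []            = ⊤
  ParentReg ρ ((p , _) ∷ _) = ρ rP ≡ toℕ p

  countE : ∀ Γ → length Γ ≤ t → ρ rD ≡ length Γ → Stack μ Γ →
           (∀ ρ′ → Frame countChildren ρ ρ′ → ρ′ rN ≡ length (children (top Γ)) → ParentReg ρ′ Γ → Q ρ′ μ) →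
           Exec countChildren ρ μ 5 Q
  countE [] d≤t eD st κ = frameE $ branchE₀ eD $ weaken (s≤s z≤n) $
    askE refl refl (countFit nothing) λ keep → κ _ keep refl tt
  countE ((p , s) ∷ Γ) d≤t eD (ep , _) κ = frameE $ branchE₁ eD (λ ()) $
    seqE $ calcE eD refl refl (fit 1 (unit (≤-trans (<⇒≤ d≤t) t≤K))) $
    seqE $ calcE refl refl refl (slot₀Fit d≤t) $
    seqE $ loadE refl (stackInMemory (slot₀< d≤t)) ep (vertexFit p) $
    askE (_ , refl , refl) (atVertex-toℕ (λ x → length (children (just x))) p) (countFit (just p)) $
    λ keep → κ _ keep refl refl

  fetchE : ∀ Γ {v : Fin n} {j} → ρ rD ≡ length Γ → ParentReg ρ Γ → ρ rJ ≡ j → nth (children (top Γ)) j ≡ toℕ v →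
           (∀ ρ′ → Frame fetchChild ρ ρ′ → ρ′ rV ≡ toℕ v → Q ρ′ μ) → Exec fetchChild ρ μ 2 Q
  fetchE [] {v} eD pr ej ev κ = frameE $ branchE₀ eD $ askE (_ , ej , refl) ev (vertexFit v) $
    λ keep → κ _ keep refl
  fetchE ((p , s) ∷ Γ) {v} {j} eD pr ej ev κ = frameE $ branchE₁ eD (λ ()) $
    askE (_ , _ , pr , ej , refl) (trans (atVertex-toℕ (λ x → nth (children (just x)) j) p) ev) (vertexFit v) $
    λ keep → κ _ keep refl

  -- A common bound for the three iterations spent on a visit: 60 covers the straight-line
  -- instructions, and 40 is the longest loop body, that of `combinePass`.
  stepTime : ℕ → ℕ → ℕ → ℕ
  stepTime d deg z = 60 + (scanTime d deg + loopTime z 40)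

  loopTime-≤ : ∀ z {a b} → a ≤ b → loopTime z a ≤ loopTime z b
  loopTime-≤ z a≤b = +-monoʳ-≤ 3 (*-monoʳ-≤ z (+-monoʳ-≤ 3 a≤b))

  stepTime-≤ : ∀ a c s z {l} → l ≤ 40 → a + c ≤ 60 → a + (s + (loopTime z l + c)) ≤ 60 + (s + loopTime z 40)
  stepTime-≤ a c s z {l} l≤ ac≤ = begin
    a + (s + (loopTime z l + c))    ≡⟨ lem a c s (loopTime z l) ⟩
    a + c + (s + loopTime z l)      ≤⟨ +-mono-≤ ac≤ (+-monoʳ-≤ s (loopTime-≤ z l≤)) ⟩
    60 + (s + loopTime z 40)        ∎
    where
    open ≤-Reasoning
    lem : ∀ a c s l → a + (s + (l + c)) ≡ a + c + (s + l)
    lem = solve-∀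

  -- Weaker than `Kept`: processing a subtree overwrites the stack words of its own levels and
  -- protects only those below level d.
  record Unchanged (d lo : ℕ) (μ μ′ : Mem) : Set where
    constructor unchanged
    field
      stackSame : ∀ a → a < d * 4 → μ′ a ≡ μ a
      cellsSame : ∀ a → a < lo → cell μ′ a ≡ cell μ a
  open Unchanged public

  module Step (Γ : Path) (v : Fin n) (M : Table Γ) (cur : ℕ) (d<t : length Γ < t) (room : Room Γ cur)
              (lip : Lipschitz M) (M≤n : M ∅ ≤ n) where
    d z β deg : ℕ
    d = length Γ
    z = 2 ^ free Γ
    β = M ∅
    deg = length (neighbours v)

    slot : ℕ → ℕ
    slot f = d * 4 + f

    slot<F : ∀ {f} → f < 4 → slot f < F
    slot<F f< = slot< _ f< d<t

    stack≢ : ∀ {f a} → a < d * 4 → a ≢ slot f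
    stack≢ {f} a< refl = <⇒≱ a< (m≤m+n (d * 4) f)

    slot≢ : ∀ {f f′} → f ≢ f′ → slot f ≢ slot f′
    slot≢ ne e = ne (+-cancelˡ-≡ (d * 4) _ _ e)

    descendE : ∀ {j} → nth (children (top Γ)) j ≡ toℕ v → j < length (children (top Γ)) →
      Conf Γ M cur j ρ μ →
      (∀ ρ′ μ′ → Conf ((v , true) ∷ Γ) (select v Γ M) (cur + z) 0 ρ′ μ′ → Unchanged d (cur + z) μ μ′ →
         μ′ (slot 2) ≡ j → μ′ (slot 3) ≡ β → Q ρ′ μ′) →
      Exec mainBody ρ μ (stepTime d deg z) Q
    descendE {ρ = ρ₀} {μ = μ₀} {Q = Q} {j = j} ev j< conf κ =
      weaken (stepTime-≤ 17 4 (scanTime d deg) z (≤ᵇ⇒≤ 24 40 tt) (≤ᵇ⇒≤ 21 60 tt)) $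
      start (regsOK conf)
      where
      es = fullRegs β d z cur j []
      es′ = fullRegs β d z cur j ((rV , toℕ v) ∷ [])
      μ₁ μ₂ μ₃ μ₄ : Mem
      μ₁ = poke μ₀ (d * 4) (toℕ v)
      μ₂ = poke μ₁ (slot 1) 1
      μ₃ = poke μ₂ (slot 2) j
      μ₄ = poke μ₃ (slot 3) β
      d4≢ : ∀ {f} → f ≢ 0 → d * 4 ≢ slot f
      d4≢ ne e = slot≢ (ne ∘ sym) (trans (+-identityʳ (d * 4)) e)
      below : ∀ a → a < d * 4 → μ₄ a ≡ μ₀ a
      below a a< = trans (poke-other μ₃ β (stack≢ a<)) (trans (poke-other μ₂ j (stack≢ a<))
        (trans (poke-other μ₁ 1 (stack≢ a<)) (poke-other μ₀ (toℕ v) (<⇒≢ a<))))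
      at0 : μ₄ (d * 4) ≡ toℕ v
      at0 = trans (poke-other μ₃ β (d4≢ λ ())) (trans (poke-other μ₂ j (d4≢ λ ()))
        (trans (poke-other μ₁ 1 (d4≢ λ ())) (poke-same μ₀ (d * 4) (toℕ v))))
      at1 : μ₄ (slot 1) ≡ 1
      at1 = trans (poke-other μ₃ β (slot≢ λ ())) (trans (poke-other μ₂ j (slot≢ λ ())) (poke-same μ₁ (slot 1) 1))
      at2 : μ₄ (slot 2) ≡ j
      at2 = trans (poke-other μ₃ β (slot≢ λ ())) (poke-same μ₂ (slot 2) j)
      at3 : μ₄ (slot 3) ≡ β
      at3 = poke-same μ₃ (slot 3) β
      f0 : d * 4 < F
      f0 = slot₀< d<t
      f1 : slot 1 < F
      f1 = slot<F (≤ᵇ⇒≤ 2 4 tt)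
      f2 : slot 2 < F
      f2 = slot<F (≤ᵇ⇒≤ 3 4 tt)
      f3 : slot 3 < F
      f3 = slot<F (≤ᵇ⇒≤ 4 4 tt)
      cells₄ : ∀ a → cell μ₄ a ≡ cell μ₀ a
      cells₄ a = trans (cell-poke {μ₃} a f3) (trans (cell-poke {μ₂} a f2) (trans (cell-poke {μ₁} a f1) (cell-poke {μ₀} a f0)))
      words₄ : Words μ₄
      words₄ = poke-words {μ₃} f3 (poke-words {μ₂} f2 (poke-words {μ₁} f1 (poke-words {μ₀} f0 (wordsOK conf))))
      stack₄ : Stack μ₄ Γ
      stack₄ = stack-kept Γ below (stackOK conf)
      C = nonNeighbours v Γ
      finish : ∀ {ρ} → Holds ρ (fullRegs β d z cur j ((rC , ⟦ C ⟧) ∷ [])) → Exec selectPass ρ μ₄ (loopTime z 24 + 4) Q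
      finish h = Pass.selectE β d z cur j (free Γ) refl (free≤ Γ) d<t M≤n (room-cells {Γ} {cur} d<t room) C h words₄
        λ ρ′ μ′ (eb , eB , eK , eF , eβ , ed , ez , ecur , ej , er , _) kp copied →
        κ ρ′ μ′ (record
          { regsOK = eb , eB , eK , eF , trans eβ (trans (+-comm β 1) (cong (λ D → suc (M D)) (sym (zipWith-∅ C)))) ,
                     trans ed (+-comm d 1) , ez , ecur , ej , er , tt
          ; stackOK = trans (stack kp _ f0) at0 , trans (stack kp _ f1) at1 ,
                      stack-kept Γ (λ a a< → stack kp a (<-trans a< f0)) stack₄
          ; tableOK = λ D → trans (cong₂ (λ x y → suc (M x) + y) (zipWith-∅ C) (trans (copied D) (cells₄ _)))
                                  (cong suc (tableOK conf (zipWith _∧_ D C)))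
          ; wordsOK = words kp })
          (unchanged (λ a a< → trans (stack kp a (<-trans a< f0)) (below a a<)) (λ a a< → trans (cells kp a a<) (cells₄ a)))
          (trans (stack kp _ f2) at2) (trans (stack kp _ f3) at3)
      push : ∀ {ρ} → Holds ρ es′ →
             Exec (calc rA mul (reg rD) (imm 4) ⨾ store (reg rA) (reg rV) ⨾ calc rA add (reg rA) (imm 1) ⨾
                   store (reg rA) (imm 1) ⨾ calc rA add (reg rA) (imm 1) ⨾ store (reg rA) (reg rJ) ⨾
                   calc rA add (reg rA) (imm 1) ⨾ store (reg rA) (reg rBase) ⨾ scan ⨾ selectPass)
                  ρ μ₀ (8 + (scanTime d deg + (loopTime z 24 + 4))) Q
      push h@(eb , eB , eK , eF , eβ , ed , ez , ecur , ej , er , eV , _) =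
        seqE $ calcE ed refl refl (slot₀Fit d<t) $
        seqE $ storeE refl eV (stackInMemory f0) $
        seqE $ calcE refl refl refl (slotFit 1 (≤ᵇ⇒≤ 2 4 tt) d<t) $
        seqE $ storeE refl refl (stackInMemory f1) $
        seqE $ calcE refl refl (+-assoc (d * 4) 1 1) (slotFit 2 (≤ᵇ⇒≤ 3 4 tt) d<t) $
        seqE $ storeE refl ej (stackInMemory f2) $
        seqE $ calcE refl refl (+-assoc (d * 4) 2 1) (slotFit 3 (≤ᵇ⇒≤ 4 4 tt) d<t) $
        seqE $ storeE refl eβ (stackInMemory f3) $
        seqE $ scanE Γ v eV ed stack₄ d<t λ ρ′ keep eC eU →
        finish (let eb , eB , eK , eF , eβ , ed , ez , ecur , ej , er , _ = keep es (eb , eB , eK , eF , eβ , ed , ez , ecur , ej , er , tt) in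
                eb , eB , eK , eF , eβ , ed , ez , ecur , ej , er , eC , tt)
      start : Holds ρ₀ es → Exec mainBody ρ₀ μ₀ (17 + (scanTime d deg + (loopTime z 24 + 4))) Q
      start h@(eb , eB , eK , eF , eβ , ed , ez , ecur , ej , er , _) =
        seqE $ countE Γ (<⇒≤ d<t) ed (stackOK conf) λ ρ₁ keep₁ eN pr →
        let h₁@(_ , _ , _ , _ , _ , ed₁ , _ , _ , ej₁ , _) = keep₁ es h in
        seqE $ calcE ej₁ eN refl (bit≤ (does (j <? length (children (top Γ))))) $
        branchE₁ (fromBool-< j<) (λ ()) $
        seqE $ fetchE Γ ed₁ (parent-set Γ pr) ej₁ ev λ ρ₂ keep₂ eV →
        push (let eb , eB , eK , eF , eβ , ed , ez , ecur , ej , er , _ = keep₂ es h₁ in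
              eb , eB , eK , eF , eβ , ed , ez , ecur , ej , er , eV , tt)
        where
        parent-set : ∀ Γ {ρ x} → ParentReg ρ Γ → ParentReg (set ρ rX x) Γ
        parent-set []            pr = pr
        parent-set ((_ , _) ∷ _) pr = pr

    doubled : ∀ x → cur + z + z + (x + x) ≡ cur + z + z + 2 * x
    doubled x = cong (λ y → cur + z + z + (x + y)) (sym (+-identityʳ x))

    ascendE : ∀ s {M′ : Table ((v , s) ∷ Γ)} {cur′ j q} → length (children (just v)) ≤ j →
      Conf ((v , s) ∷ Γ) M′ cur′ j ρ μ →
      (∀ ρ′ → Holds ρ′ (fullRegs (M′ ∅) d (2 ^ free ((v , s) ∷ Γ)) cur′ j ((rV , toℕ v) ∷ (rA , slot 1) ∷ [])) →
         Exec (if s then switch else return) ρ′ μ q Q) →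
      Exec mainBody ρ μ (14 + q) Q
    ascendE {ρ = ρ₀} {μ = μ₀} {Q = Q} s {M′} {cur′} {j} {q} j≥ conf κ = start (regsOK conf)
      where
      z′ = 2 ^ free ((v , s) ∷ Γ)
      es = fullRegs (M′ ∅) (suc d) z′ cur′ j []
      ev : μ₀ (d * 4) ≡ toℕ v
      ev = proj₁ (stackOK conf)
      e₁ : μ₀ (slot 1) ≡ fromBool s
      e₁ = proj₁ (proj₂ (stackOK conf))
      f1 : slot 1 < F
      f1 = slot<F (≤ᵇ⇒≤ 2 4 tt)
      dispatch : ∀ s {ρ q} → ρ rX ≡ fromBool s → Exec (if s then switch else return) ρ μ₀ q Q →
                 Exec (branch (reg rX) switch return) ρ μ₀ (suc q) Q
      dispatch true  e x = branchE₁ e (λ ()) x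
      dispatch false e x = branchE₀ e x
      start : Holds ρ₀ es → Exec mainBody ρ₀ μ₀ (14 + q) Q
      start h =
        seqE $ countE ((v , s) ∷ Γ) d<t (proj₁ (proj₂ (proj₂ (proj₂ (proj₂ (proj₂ h)))))) (stackOK conf) λ ρ₁ keep₁ eN _ →
        next (keep₁ es h) eN
        where
        next : ∀ {ρ₁} → Holds ρ₁ es → ρ₁ rN ≡ length (children (just v)) → Exec _ ρ₁ μ₀ (9 + q) Q
        next (eb , eB , eK , eF , eβ , ed , ez , ecur , ej , er , _) eN =
          seqE $ calcE ej eN refl (bit≤ (does (j <? length (children (just v))))) $
          branchE₀ (cong fromBool (dec-false (j <? length (children (just v))) (≤⇒≯ j≥))) $
          branchE₁ ed (λ ()) $
          seqE $ calcE ed refl refl (fit 1 (unit (≤-trans (<⇒≤ d<t) t≤K))) $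
          seqE $ calcE refl refl refl (slot₀Fit d<t) $
          seqE $ loadE refl (stackInMemory (slot₀< d<t)) ev (vertexFit v) $
          seqE $ calcE refl refl refl (slotFit 1 (≤ᵇ⇒≤ 2 4 tt) d<t) $
          seqE $ loadE refl (stackInMemory f1) e₁ (bit≤ s) $
          dispatch s refl (κ _ (eb , eB , eK , eF , eβ , refl , ez , ecur , ej , er , refl , refl , tt))

    -- Comparison with ∅: a difference is at most ∣D∣.
    small-excess : ∀ {N : Table Γ} {x : Vec Bool (free Γ) → ℕ} → Lipschitz N → (∀ D → N ∅ + x D ≡ N D) → ∀ D → x D ≤ free Γ
    small-excess {N} {x} lip e D = +-cancelˡ-≤ (N ∅) (x D) (free Γ)
      (≤-trans (≤-reflexive (e D)) (≤-trans (lip D ∅) (+-monoʳ-≤ (N ∅) (excess≤ D ∅))))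

    u<B : free Γ + 1 < B
    u<B = ≤-<-trans (≤-trans (≤-reflexive (+-comm (free Γ) 1)) (≤-trans (s≤s (free≤ Γ)) (≤-trans d<t (<⇒≤ t<b)))) (n<2^n b)

    -- The second choice starts again from M, whose cells lie below everything written for the
    -- first. Its base returns from slot 3, which then receives the base of the result M₁.
    switchE : ∀ {M₁ : Table ((v , true) ∷ Γ)} {j c} → length (children (just v)) ≤ c → M₁ ∅ ≤ n →
      Conf ((v , true) ∷ Γ) M₁ (cur + z) c ρ μ → Stored μ cur β M → μ (slot 2) ≡ j → μ (slot 3) ≡ β →
      (∀ ρ′ μ′ → Conf ((v , false) ∷ Γ) (leave v Γ M) (cur + z + z) 0 ρ′ μ′ → Unchanged d (cur + z + z) μ μ′ →
         μ′ (slot 2) ≡ j → μ′ (slot 3) ≡ M₁ ∅ → Q ρ′ μ′) →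
      Exec mainBody ρ μ (stepTime d deg z) Q
    switchE {ρ = ρ₀} {μ = μ₀} {Q = Q} {M₁} {j} {c} c≥ M₁≤ conf stored at2 at3 κ =
      weaken (stepTime-≤ 20 5 (scanTime d deg) z (≤ᵇ⇒≤ 39 40 tt) (≤ᵇ⇒≤ 25 60 tt)) $
      ascendE true c≥ conf λ ρ₁ h → pop h
      where
      es = fullRegs β d z cur c []
      f0 : d * 4 < F
      f0 = slot₀< d<t
      f1 : slot 1 < F
      f1 = slot<F (≤ᵇ⇒≤ 2 4 tt)
      f2 : slot 2 < F
      f2 = slot<F (≤ᵇ⇒≤ 3 4 tt)
      f3 : slot 3 < F
      f3 = slot<F (≤ᵇ⇒≤ 4 4 tt)
      μ₁ μ₂ : Mem
      μ₁ = poke μ₀ (slot 1) 0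
      μ₂ = poke μ₁ (slot 3) (M₁ ∅)
      below : ∀ a → a < d * 4 → μ₂ a ≡ μ₀ a
      below a a< = trans (poke-other μ₁ (M₁ ∅) (stack≢ a<)) (poke-other μ₀ 0 (stack≢ a<))
      d4≢ : ∀ {f} → f ≢ 0 → d * 4 ≢ slot f
      d4≢ ne e = slot≢ (ne ∘ sym) (trans (+-identityʳ (d * 4)) e)
      b0 : μ₂ (d * 4) ≡ toℕ v
      b0 = trans (poke-other μ₁ (M₁ ∅) (d4≢ λ ())) (trans (poke-other μ₀ 0 (d4≢ λ ())) (proj₁ (stackOK conf)))
      b1 : μ₂ (slot 1) ≡ 0
      b1 = trans (poke-other μ₁ (M₁ ∅) (slot≢ λ ())) (poke-same μ₀ (slot 1) 0)
      b2 : μ₂ (slot 2) ≡ j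
      b2 = trans (poke-other μ₁ (M₁ ∅) (slot≢ λ ())) (trans (poke-other μ₀ 0 (slot≢ λ ())) at2)
      b3 : μ₂ (slot 3) ≡ M₁ ∅
      b3 = poke-same μ₁ (slot 3) (M₁ ∅)
      cells₂ : ∀ a → cell μ₂ a ≡ cell μ₀ a
      cells₂ a = trans (cell-poke {μ₁} a f3) (cell-poke {μ₀} a f1)
      words₂ : Words μ₂
      words₂ = poke-words {μ₁} f3 (poke-words {μ₀} f1 (wordsOK conf))
      stack₂ : Stack μ₂ Γ
      stack₂ = stack-kept Γ below (proj₂ (proj₂ (stackOK conf)))
      ud = fromBool (not (dominated v Γ))
      small : ∀ {x} → x < z → cell μ₂ (cur + x) + ud < B
      small {x} x< with ⟦⟧-surjective (free Γ) x x<
      ... | D , refl = ≤-<-trans (+-mono-≤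
        (≤-trans (≤-reflexive (cells₂ _)) (small-excess {x = λ D → cell μ₀ (cur + ⟦ D ⟧)} lip stored D))
        (fromBool≤1 (not (dominated v Γ)))) u<B
      finish : ∀ {ρ} → Holds ρ (fullRegs β d z cur c ((rU , ud) ∷ [])) → Exec leavePass ρ μ₂ (loopTime z 39 + 5) Q
      finish h = Pass.leaveE β d z cur c (free Γ) refl (free≤ Γ) d<t M≤n (room-cells {Γ} {cur} d<t room)
        ud (fromBool≤1 (not (dominated v Γ))) h words₂ small
        λ ρ′ μ′ (eb , eB , eK , eF , eβ , ed , ez , ecur , ej , er , _) kp copied →
        κ ρ′ μ′ (record
          { regsOK = eb , eB , eK , eF , eβ , trans ed (+-comm d 1) ,
                     trans ez (cong (z +_) (sym (+-identityʳ z))) , ecur , ej , er , tt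
          ; stackOK = trans (stack kp _ f0) b0 , trans (stack kp _ f1) b1 ,
                      stack-kept Γ (λ a a< → stack kp a (<-trans a< f0)) stack₂
          ; tableOK = table {μ′} copied
          ; wordsOK = words kp })
          (unchanged (λ a a< → trans (stack kp a (<-trans a< f0)) (below a a<)) (λ a a< → trans (cells kp a a<) (cells₂ a)))
          (trans (stack kp _ f2) b2) (trans (stack kp _ f3) b3)
        where
        table : ∀ {μ′} → (∀ x → x < z → cell μ′ (cur + z + z + (x + x)) ≡ cell μ₂ (cur + x) ×
                                        cell μ′ (cur + z + z + (x + x) + 1) ≡ cell μ₂ (cur + x) + ud) →
                Stored μ′ (cur + z + z) β (leave v Γ M)
        table {μ′} copied (false ∷ᵛ D) = trans (cong (β +_) (trans (cong (cell μ′) (sym (doubled ⟦ D ⟧)))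
          (trans (proj₁ (copied ⟦ D ⟧ (⟦⟧-< D))) (cells₂ _)))) (stored D)
        table {μ′} copied (true ∷ᵛ D) = begin
          β + cell μ′ (cur + z + z + suc (2 * ⟦ D ⟧))        ≡⟨ cong (λ a → β + cell μ′ a) (trans (+-suc _ _) (trans (+-comm 1 _) (cong (_+ 1) (sym (doubled ⟦ D ⟧))))) ⟩
          β + cell μ′ (cur + z + z + (⟦ D ⟧ + ⟦ D ⟧) + 1)    ≡⟨ cong (β +_) (trans (proj₂ (copied ⟦ D ⟧ (⟦⟧-< D))) (cong (_+ ud) (cells₂ _))) ⟩
          β + (cell μ₀ (cur + ⟦ D ⟧) + ud)                   ≡⟨ +-assoc β _ ud ⟨
          β + cell μ₀ (cur + ⟦ D ⟧) + ud                     ≡⟨ cong (_+ ud) (stored D) ⟩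
          M D + ud                                           ≡⟨ +-comm (M D) ud ⟩
          ud + M D                                           ∎
          where open ≡-Reasoning
      pop : ∀ {ρ} → Holds ρ (fullRegs (M₁ ∅) d z (cur + z) c ((rV , toℕ v) ∷ (rA , slot 1) ∷ [])) →
            Exec switch ρ μ₀ (6 + (scanTime d deg + (loopTime z 39 + 5))) Q
      pop (eb , eB , eK , eF , eβ , ed , ez , ecur , ej , er , eV , eA , _) =
        seqE $ storeE eA refl (stackInMemory f1) $
        seqE $ calcE eA refl (+-assoc (d * 4) 1 2) (slotFit 3 (≤ᵇ⇒≤ 4 4 tt) d<t) $
        seqE $ loadE refl (stackInMemory f3) (trans (poke-other μ₀ 0 (slot≢ λ ())) at3) (fit 1 (unit (≤-trans M≤n n≤K))) $
        seqE $ storeE refl eβ (stackInMemory f3) $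
        seqE $ calcE refl refl (+-identityʳ β) (fit 1 (unit (≤-trans M≤n n≤K))) $
        seqE $ calcE ecur ez (m+n∸n≡m cur z) (cellFit (≤-trans (m≤m+n cur (4 * z)) (room-cells {Γ} {cur} d<t room))) $
        seqE $ scanE Γ v eV ed stack₂ d<t λ ρ′ keep eC eU →
        finish (let eb , eB , eK , eF , eβ , ed , ez , ecur , ej , er , _ = keep es (eb , eB , eK , eF , refl , ed , ez , refl , ej , er , tt) in
                eb , eB , eK , eF , eβ , ed , ez , ecur , ej , er , eU , tt)

    returnE : ∀ {M₁ : Table ((v , true) ∷ Γ)} {M₀ : Table ((v , false) ∷ Γ)} {j c} →
      length (children (just v)) ≤ c → M₁ ∅ ≤ n → M₀ ∅ ≤ n → j < n →
      Lipschitz (λ D → M₁ D ⊓ M₀ (true ∷ᵛ D)) →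
      Conf ((v , false) ∷ Γ) M₀ (cur + z + z) c ρ μ → Stored μ (cur + z) (M₁ ∅) M₁ →
      μ (slot 2) ≡ j → μ (slot 3) ≡ M₁ ∅ →
      (∀ ρ′ μ′ → Conf Γ (λ D → M₁ D ⊓ M₀ (true ∷ᵛ D)) cur (suc j) ρ′ μ′ → Unchanged d cur μ μ′ → Q ρ′ μ′) →
      Exec mainBody ρ μ (stepTime d deg z) Q
    returnE {ρ = ρ₀} {μ = μ₀} {Q = Q} {M₁} {M₀} {j} {c} c≥ M₁≤ M₀≤ j<n lip′ conf stored at2 at3 κ =
      weaken (≤-trans (stepTime-≤ 38 1 0 z ≤-refl (≤ᵇ⇒≤ 39 60 tt)) (+-monoʳ-≤ 60 (m≤n+m (loopTime z 40) (scanTime d deg)))) $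
      ascendE false c≥ conf λ ρ₁ h → pop h
      where
      N : Table Γ
      N D = M₁ D ⊓ M₀ (true ∷ᵛ D)
      f0 : d * 4 < F
      f0 = slot₀< d<t
      f2 : slot 2 < F
      f2 = slot<F (≤ᵇ⇒≤ 3 4 tt)
      f3 : slot 3 < F
      f3 = slot<F (≤ᵇ⇒≤ 4 4 tt)
      stack₀ : Stack μ₀ Γ
      stack₀ = proj₂ (proj₂ (stackOK conf))
      ν : ℕ
      ν = (cell μ₀ (cur + z + z + 1) + M₀ ∅) ⊓ M₁ ∅
      f : ℕ → ℕ
      f x = (cell μ₀ (cur + z + z + (x + x) + 1) + M₀ ∅) ⊓ (cell μ₀ (cur + z + x) + M₁ ∅) ∸ ν
      odd-cell : ∀ D → cell μ₀ (cur + z + z + (⟦ D ⟧ + ⟦ D ⟧) + 1) + M₀ ∅ ≡ M₀ (true ∷ᵛ D)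
      odd-cell D = trans (+-comm _ (M₀ ∅)) (trans (cong (λ a → M₀ ∅ + cell μ₀ a)
        (trans (cong (_+ 1) (doubled ⟦ D ⟧)) (trans (+-comm _ 1) (sym (+-suc _ _))))) (tableOK conf (true ∷ᵛ D)))
      -- Index 1 encodes `true ∷ᵛ ∅`, and the entry of the other table at ∅ is its base.
      ν≡ : ν ≡ N ∅
      ν≡ = trans (cong (λ x → (x ⊓ M₁ ∅)) (trans (cong (λ a → cell μ₀ (a + 1) + M₀ ∅)
             (sym (trans (cong (λ x → cur + z + z + (x + x)) (⟦∅⟧ (free Γ))) (+-identityʳ (cur + z + z))))) (odd-cell ∅)))
             (⊓-comm (M₀ (true ∷ᵛ ∅)) (M₁ ∅))
      f≡ : ∀ D → f ⟦ D ⟧ ≡ N D ∸ N ∅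
      f≡ D = cong₂ _∸_ (trans (cong₂ _⊓_ (odd-cell D) (trans (+-comm _ (M₁ ∅)) (stored D))) (⊓-comm (M₀ (true ∷ᵛ D)) (M₁ D))) ν≡
      -- The Lipschitz property at ∅ makes this the least entry, so that the truncated subtraction
      -- in `f` is exact.
      N∅≤ : ∀ D → N ∅ ≤ N D
      N∅≤ D = ≤-trans (lip′ ∅ D) (≤-reflexive (trans (cong (N D +_) (excess-∅ D)) (+-identityʳ (N D))))
      total : ∀ D → N ∅ + f ⟦ D ⟧ ≡ N D
      total D = trans (cong (N ∅ +_) (f≡ D)) (m+[n∸m]≡n (N∅≤ D))
      small : ∀ {x} → x < z → f x < B
      small {x} x< with ⟦⟧-surjective (free Γ) x x<
      ... | D , refl = ≤-<-trans (small-excess {N} {λ D → f ⟦ D ⟧} lip′ total D) (≤-<-trans (m≤m+n (free Γ) 1) u<B)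
      jFit : suc j < 2 ^ w
      jFit = fit 1 (unit (≤-trans j<n n≤K))
      pop : ∀ {ρ} → Holds ρ (fullRegs (M₀ ∅) d (2 * z) (cur + z + z) c ((rV , toℕ v) ∷ (rA , slot 1) ∷ [])) →
            Exec return ρ μ₀ (24 + (loopTime z 40 + 1)) Q
      pop (eb , eB , eK , eF , eβ , ed , ez , ecur , ej , er , eV , eA , _) =
        seqE $ calcE eA refl (+-assoc (d * 4) 1 1) (slotFit 2 (≤ᵇ⇒≤ 3 4 tt) d<t) $
        seqE $ loadE refl (stackInMemory f2) at2 (<-trans (n<1+n j) jFit) $
        seqE $ calcE refl refl (+-comm j 1) jFit $
        seqE $ calcE refl refl (+-assoc (d * 4) 2 1) (slotFit 3 (≤ᵇ⇒≤ 4 4 tt) d<t) $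
        seqE $ loadE refl (stackInMemory f3) at3 (fit 1 (unit (≤-trans M₁≤ n≤K))) $
        seqE $ calcE ez refl (trans (cong (_/ 2) (*-comm 2 z)) (m*n/n≡m z 2)) (fit 1 (unit (≤-trans (^-monoʳ-≤ 2 (≤-trans (free≤ Γ) (<⇒≤ d<t))) 2^t≤K))) $
        seqE $ calcE ecur refl (m+n∸n≡m (cur + z) z) (cellFit (≤-trans (+-monoʳ-≤ cur (m≤m+n z (3 * z))) (room-cells {Γ} {cur} d<t room))) $
        seqE $ calcE refl refl (m+n∸n≡m cur z) (cellFit (≤-trans (m≤m+n cur (4 * z)) (room-cells {Γ} {cur} d<t room))) $
        Pass.combineE (M₀ ∅) d z cur (suc j) (free Γ) refl (free≤ Γ) d<t M₀≤ (room-cells {Γ} {cur} d<t room)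
          (M₁ ∅) M₁≤ (eb , eB , eK , eF , eβ , ed , refl , refl , refl , er , refl , tt) (wordsOK conf) small
          λ ρ′ μ′ (eb , eB , eK , eF , eβ , ed , ez , ecur , ej , er , _) kp copied →
          κ ρ′ μ′ (record
            { regsOK = eb , eB , eK , eF , trans eβ ν≡ , ed , ez , ecur , ej , er , tt
            ; stackOK = stack-kept Γ (λ a a< → stack kp a (<-trans a< f0)) stack₀
            ; tableOK = λ D → trans (cong (N ∅ +_) (copied ⟦ D ⟧ (⟦⟧-< D))) (total D)
            ; wordsOK = words kp })
            (unchanged (λ a a< → stack kp a (<-trans a< f0)) (cells kp))

  finishE : ∀ {M : Table []} {j} → length (children nothing) ≤ j → Conf [] M 0 j ρ μ →
            (∀ ρ′ μ′ → ρ′ rRun ≡ 0 → ρ′ rBase ≡ M []ᵛ → Q ρ′ μ′) →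
            Exec mainBody ρ μ 9 Q
  finishE {ρ = ρ₀} {μ = μ₀} {M = M} {j} j≥ conf κ = start (regsOK conf)
    where
    es = fullRegs (M []ᵛ) 0 1 0 j []
    start : Holds ρ₀ es → Exec mainBody ρ₀ μ₀ 9 _
    start h =
      seqE $ countE [] z≤n (proj₁ (proj₂ (proj₂ (proj₂ (proj₂ (proj₂ h)))))) tt λ ρ₁ keep₁ eN _ →
      let eb , eB , eK , eF , eβ , ed , ez , ecur , ej , er , _ = keep₁ es h in
      seqE $ calcE ej eN refl (bit≤ (does (j <? length (children nothing)))) $
      branchE₀ (cong fromBool (dec-false (j <? length (children nothing)) (≤⇒≯ j≥))) $
      branchE₀ ed $
      calcE refl refl refl 0<2^w $
      κ _ _ refl eβ

-- The main loop follows the recursion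

module Simulation {n : ℕ} (G : Graph n) (F′ : RootedForest n) (td : IsTreedepthDecomposition G F′)
                  (t : ℕ) (depth : HasDepth F′ t) (I : InputLists G F′) (sizes : Sizes n t) where
  open Steps G F′ td t depth I sizes public

  private variable
    ρ : Env 30
    μ : Mem
    Q : Env 30 → Mem → Set
    N : ℕ

  mutual
    -- The three iterations are those of `descend`, `switch` and `return`, each with one test of the
    -- main loop. The children are visited once per choice, and only the choice not to select v
    -- enlarges the index.
    treeTime : ℕ → ℕ → ℕ → Fin n → ℕ
    treeTime zero    d u v = 0
    treeTime (suc h) d u v =
      3 * suc (stepTime d (length (neighbours v)) (2 ^ u)) +
      (forestTime h (suc d) u (children (just v)) + forestTime h (suc d) (suc u) (children (just v)))

    forestTime : ℕ → ℕ → ℕ → List (Fin n) → ℕ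
    forestTime h d u []       = 0
    forestTime h d u (c ∷ cs) = treeTime h d u c + forestTime h d u cs

  stored-kept : ∀ {μ μ′ u d cur β lo} {M : Vec Bool u → ℕ} → Unchanged d lo μ μ′ →
                cur + 2 ^ u ≤ lo → Stored μ cur β M → Stored μ′ cur β M
  stored-kept {cur = cur} {β} un ≤lo st D =
    trans (cong (β +_) (cellsSame un _ (<-≤-trans (+-monoʳ-< cur (⟦⟧-< D)) ≤lo))) (st D)

  unchanged-trans : ∀ {d d′ lo lo′ μ₁ μ₂ μ₃} → d ≤ d′ → lo ≤ lo′ →
                    Unchanged d lo μ₁ μ₂ → Unchanged d′ lo′ μ₂ μ₃ → Unchanged d lo μ₁ μ₃
  unchanged-trans d≤ lo≤ un un′ = unchanged
    (λ a a< → trans (stackSame un′ a (<-≤-trans a< (*-monoˡ-≤ 4 d≤))) (stackSame un a a<))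
    (λ a a< → trans (cellsSame un′ a (<-≤-trans a< lo≤)) (cellsSame un a a<))

  unchanged-weaken : ∀ {d lo lo′ μ₁ μ₂} → lo ≤ lo′ → Unchanged d lo′ μ₁ μ₂ → Unchanged d lo μ₁ μ₂
  unchanged-weaken lo≤ un = unchanged (stackSame un) (λ a a< → cellsSame un a (<-≤-trans a< lo≤))

  running : ∀ {Γ M cur j} → Conf Γ M cur j ρ μ → ρ rRun ≡ 1
  running conf = proj₁ (proj₂ (proj₂ (proj₂ (proj₂ (proj₂ (proj₂ (proj₂ (proj₂ (proj₂ (regsOK conf))))))))))

  mutual
    -- A subtree has no command of its own: it is a run of consecutive iterations of the one loop
    -- `main`. What follows it is therefore handed over as a continuation that takes N steps. The
    -- bound α grows by one per vertex and keeps all base values at most n.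
    simulate-tree : ∀ h Γ v M cur {j α} → Lineage (v ∷ map proj₁ Γ) → length (map proj₁ Γ) + h ≡ t →
      Room Γ cur → Lipschitz M → (∀ D → M D ≤ α) → α + length (tree h v) ≤ n →
      nth (children (top Γ)) j ≡ toℕ v → j < length (children (top Γ)) → Conf Γ M cur j ρ μ →
      (∀ ρ′ μ′ → Conf Γ (processTree h Γ v M) cur (suc j) ρ′ μ′ → Unchanged (length Γ) cur μ μ′ →
         Exec main ρ′ μ′ N Q) →
      Exec main ρ μ (treeTime h (length Γ) (free Γ) v + N) Q
    simulate-tree zero Γ v M cur lin e = λ _ _ _ _ _ _ _ _ → ⊥-elim (case (fuel-pos lin e))
      where
      case : (∃ λ h → 0 ≡ suc h) → ⊥
      case ()
    simulate-tree {N = N} (suc h) Γ v M cur {j} {α} lin e room lip M≤ size ev j< conf κ =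
      weaken (≤-reflexive (arith (stepTime d deg z) (forestTime h (suc d) (free Γ) cs) (forestTime h (suc d) (suc (free Γ)) cs) N)) $
      whileE₁ (running conf) (λ ()) $ S.descendE ev j< conf λ ρ₁ μ₁ conf₁ un₁ e2 e3 →
      simulate-forest h ((v , true) ∷ Γ) cs (select v Γ M) (cur + z) lin child⇒parent e′ (room-select {Γ} {v} {cur} room)
        (Lipschitz-select v Γ lip) {α = suc α} (λ D → s≤s (M≤ _)) size′ (λ i _ → refl) refl conf₁ λ ρ₂ μ₂ conf₂ un₂ →
      whileE₁ (running conf₂) (λ ()) $ S.switchE ≤-refl (M₁≤n ∅) conf₂
        (stored-kept {M = M} un₂ ≤-refl (stored-kept {M = M} un₁ ≤-refl (tableOK conf)))
        (trans (stackSame un₂ _ slot2<) e2) (trans (stackSame un₂ _ slot3<) e3) λ ρ₃ μ₃ conf₃ un₃ e2′ e3′ →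
      simulate-forest h ((v , false) ∷ Γ) cs (leave v Γ M) (cur + z + z) lin child⇒parent e′ (room-leave {Γ} {v} {cur} room)
        (Lipschitz-leave v Γ lip) {α = suc α} (λ { (b ∷ᵛ D) → +-mono-≤ (fromBool≤1 (b ∧ _)) (M≤ D) }) size′ (λ i _ → refl) refl conf₃
        λ ρ₄ μ₄ conf₄ un₄ →
      whileE₁ (running conf₄) (λ ()) $ S.returnE ≤-refl (M₁≤n ∅) (M₀≤n ∅)
        (<-≤-trans j< (childCount≤ (top Γ))) (Lipschitz-tree (suc h) Γ v lip) conf₄
        (stored-kept {M = M₁} un₄ ≤-refl (stored-kept {M = M₁} un₃ ≤-refl (tableOK conf₂)))
        (trans (stackSame un₄ _ slot2<) e2′) (trans (stackSame un₄ _ slot3<) e3′) λ ρ₅ μ₅ conf₅ un₅ →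
      κ ρ₅ μ₅ conf₅
        (unchanged-trans {lo′ = cur} ≤-refl ≤-refl
          (unchanged-trans {d′ = suc d} (n≤1+n d) (≤-trans (m≤m+n cur z) (m≤m+n (cur + z) z))
            (unchanged-trans ≤-refl (≤-trans (m≤m+n cur z) (m≤m+n (cur + z) z))
              (unchanged-trans {d′ = suc d} (n≤1+n d) (m≤m+n cur z) (unchanged-weaken (m≤m+n cur z) un₁) un₂)
              un₃) un₄) un₅)
      where
      d z deg : ℕ
      d = length Γ
      z = 2 ^ free Γ
      deg = length (neighbours v)
      cs = children (just v)
      d<t : d < t
      d<t = subst (_< t) (length-map proj₁ Γ) (Lineage≤t lin)
      size′ : suc α + length (forest h cs) ≤ n
      size′ = ≤-trans (≤-reflexive (sym (+-suc α _))) size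
      M∅≤n : M ∅ ≤ n
      M∅≤n = ≤-trans (M≤ ∅) (≤-trans (m≤m+n α _) size)
      module S = Step Γ v M cur d<t room lip M∅≤n
      M₁ = processForest h ((v , true) ∷ Γ) cs (select v Γ M)
      M₁≤n : ∀ D → M₁ D ≤ n
      M₁≤n D = ≤-trans (forest-bound h ((v , true) ∷ Γ) cs (λ D → s≤s (M≤ _)) D) size′
      M₀≤n : ∀ D → processForest h ((v , false) ∷ Γ) cs (leave v Γ M) D ≤ n
      M₀≤n D = ≤-trans (forest-bound h ((v , false) ∷ Γ) cs (λ { (b ∷ᵛ D) → +-mono-≤ (fromBool≤1 (b ∧ _)) (M≤ D) }) D) size′
      e′ : suc (length (map proj₁ Γ)) + h ≡ t
      e′ = down v (map proj₁ Γ) e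
      slot2< : d * 4 + 2 < suc d * 4
      slot2< = ≤-trans (+-monoʳ-< (d * 4) {2} {4} (≤ᵇ⇒≤ 3 4 tt)) (≤-reflexive (+-comm (d * 4) 4))
      slot3< : d * 4 + 3 < suc d * 4
      slot3< = ≤-trans (+-monoʳ-< (d * 4) {3} {4} (≤ᵇ⇒≤ 4 4 tt)) (≤-reflexive (+-comm (d * 4) 4))
      arith : ∀ s f g N → suc (s + (f + suc (s + (g + suc (s + N))))) ≡ 3 * suc s + (f + g) + N
      arith = solve-∀

    simulate-forest : ∀ h Γ cs M cur {j} → Lineage (map proj₁ Γ) → (∀ {c} → c ∈ cs → parent F′ c ≡ top Γ) →
      length (map proj₁ Γ) + h ≡ t → Room Γ cur → Lipschitz M → ∀ {α} → (∀ D → M D ≤ α) →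
      α + length (forest h cs) ≤ n →
      (∀ i → i < length cs → nth (children (top Γ)) (j + i) ≡ nth cs i) → j + length cs ≡ length (children (top Γ)) →
      Conf Γ M cur j ρ μ →
      (∀ ρ′ μ′ → Conf Γ (processForest h Γ cs M) cur (length (children (top Γ))) ρ′ μ′ →
         Unchanged (length Γ) cur μ μ′ → Exec main ρ′ μ′ N Q) →
      Exec main ρ μ (forestTime h (length Γ) (free Γ) cs + N) Q
    simulate-forest {ρ = ρ} {μ = μ} h Γ [] M cur {j} lin par e room lip M≤ size nth≡ j≡ conf κ =
      κ _ _ (subst (λ j → Conf Γ M cur j ρ μ) (trans (sym (+-identityʳ j)) j≡) conf) (unchanged (λ _ _ → refl) (λ _ _ → refl))
    simulate-forest {N = N} h Γ (c ∷ cs) M cur {j} lin par e room lip {α} M≤ size nth≡ j≡ conf κ =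
      weaken (≤-reflexive (sym (+-assoc (treeTime h (length Γ) (free Γ) c) _ N))) $
      simulate-tree h Γ c M cur (par (here refl) ∷ lin) e room lip M≤
        (≤-trans (+-monoʳ-≤ α (≤-trans (m≤m+n (length (tree h c)) _) (≤-reflexive (sym (length-++ (tree h c)))))) size)
        (trans (cong (nth (children (top Γ))) (sym (+-identityʳ j))) (nth≡ 0 (s≤s z≤n)))
        (subst (j <_) j≡ (m<m+n j (s≤s z≤n))) conf λ ρ₁ μ₁ conf₁ un₁ →
      simulate-forest h Γ cs (processTree h Γ c M) cur lin (par ∘ there) e room (Lipschitz-tree h Γ c lip)
        (tree-bound h Γ c M≤)
        (≤-trans (≤-reflexive (trans (+-assoc α _ _) (cong (α +_) (sym (length-++ (tree h c)))))) size)
        (λ i i< → trans (cong (nth (children (top Γ))) (sym (+-suc j i))) (nth≡ (suc i) (s≤s i<)))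
        (trans (sym (+-suc j (length cs))) j≡) conf₁ λ ρ₂ μ₂ conf₂ un₂ →
      κ ρ₂ μ₂ conf₂ (unchanged-trans ≤-refl ≤-refl un₁ un₂)

-- The program learns t from the word size, which is 8 (t + ⌈log₂ n⌉ + 1).
wordLoop logLoop setup : Cmd 30
wordLoop = while (reg rX) (calc rX add (reg rX) (reg rX) ⨾ calc rW add (reg rW) (imm 1))
logLoop = while (reg rFlag) (calc rX add (reg rX) (reg rX) ⨾ calc rS add (reg rS) (imm 1) ⨾ calc rFlag lt (reg rX) (reg rN))
setup =
  calc rX add (imm 1) (imm 0) ⨾
  wordLoop ⨾
  calc rX add (imm 1) (imm 0) ⨾
  ask rN order ⨾
  calc rFlag lt (reg rX) (reg rN) ⨾
  logLoop ⨾
  calc rBits quo (reg rW) (imm 8) ⨾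
  calc rBits sub (reg rBits) (reg rS) ⨾
  calc rK quo (reg rW) (reg rBits) ⨾
  calc rB shl (imm 1) (reg rBits) ⨾
  calc rF mul (reg rBits) (imm 4) ⨾
  calc rZ add (imm 1) (imm 0) ⨾
  calc rRun add (imm 1) (imm 0)

solver : Program
solver = program 29 (setup ⨾ main)

-- Initialisation and the complete run

module Run {n : ℕ} (G : Graph n) (F′ : RootedForest n) (td : IsTreedepthDecomposition G F′)
           (t : ℕ) (depth : HasDepth F′ t) (I : InputLists G F′) (sizes : Sizes n t)
           (L : ℕ) (n≤2^L : n ≤ 2 ^ L) (L-least : ∀ i → n ≤ 2 ^ i → L ≤ i) where
  open Simulation G F′ td t depth I sizes public

  module _ (w≡ : w ≡ 8 * (t + L + 1)) (b≡ : b ≡ suc t) (k≡ : k ≡ w / b) (2^L≤K : 2 ^ L ≤ K) where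

    private variable
      ρ : Env 30
      μ : Mem
      Q : Env 30 → Mem → Set

    fixed : List (Reg × ℕ)
    fixed = (rBase , 0) ∷ (rD , 0) ∷ (rCur , 0) ∷ (rJ , 0) ∷ []

    double : ∀ i → 2 ^ i + 2 ^ i ≡ 2 ^ suc i
    double i = cong (2 ^ i +_) (sym (+-identityʳ (2 ^ i)))

    -- Modulo 2 ^ w the power 2 ^ i is nonzero for i < w and vanishes for i = w, so that the number
    -- of doublings is the word length.
    wordLoopE : ∀ r i → r + i ≡ w → Holds ρ ((rS , 0) ∷ fixed) → ρ rX ≡ truncate w (2 ^ i) → ρ rW ≡ i →
                (∀ ρ′ → Holds ρ′ ((rS , 0) ∷ fixed) → ρ′ rW ≡ w → Q ρ′ μ) →
                Exec wordLoop ρ μ (suc (r * 3)) Q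
    wordLoopE zero i refl h eX eW κ = whileE₀ (trans eX (n%n≡0 (2 ^ i) {{m^n≢0 2 i}})) (κ _ h eW)
    wordLoopE (suc r) i r+i h eX eW κ =
      whileE₁ (trans eX (truncate-< i<)) (2^≢0 i) $
      seqE $ calcE-mod (trans eX (truncate-< i<)) (trans eX (truncate-< i<)) (cong (truncate w) (double i)) $
      calcE eW refl (+-comm i 1) (≤-<-trans i<w (n<2^n w)) $
      wordLoopE r (suc i) (trans (+-suc r i) r+i) h refl refl κ
      where
      i<w : i < w
      i<w = subst (suc i ≤_) r+i (s≤s (m≤n+m i r))
      i< : 2 ^ i < 2 ^ w
      i< = ^-monoʳ-< 2 (s≤s (s≤s z≤n)) i<w
      2^≢0 : ∀ i → 2 ^ i ≢ 0
      2^≢0 i e = <⇒≢ (m^n>0 2 i) (sym e)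

    -- The loop stops at the first power of two that reaches n; `L-least` ensures that its exponent
    -- is not smaller than L.
    logLoopE : ∀ r i → r + i ≡ L → Holds ρ ((rW , w) ∷ fixed) → ρ rX ≡ 2 ^ i → ρ rS ≡ i → ρ rN ≡ n →
               ρ rFlag ≡ fromBool (does (2 ^ i <? n)) →
               (∀ ρ′ → Holds ρ′ ((rW , w) ∷ fixed) → ρ′ rS ≡ L → Q ρ′ μ) →
               Exec logLoop ρ μ (suc (r * 4)) Q
    logLoopE {ρ = ρ₀} {Q = Q} {μ = μ₀} r i r+i h eX eS eN ef κ with 2 ^ i <? n
    ... | no ≮n = weaken (s≤s z≤n) (whileE₀ (trans ef (cong fromBool (dec-false (2 ^ i <? n) ≮n)))
        (κ _ h (trans eS (≤-antisym (≤-trans (m≤n+m i r) (≤-reflexive r+i)) (L-least i (≮⇒≥ ≮n))))))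
    ... | yes <n = continue r r+i
      where
      continue : ∀ r → r + i ≡ L → Exec logLoop ρ₀ μ₀ (suc (r * 4)) Q
      continue zero    refl = ⊥-elim (<⇒≱ <n n≤2^L)
      continue (suc r) r+i  =
        whileE₁ (trans ef (cong fromBool (dec-true (2 ^ i <? n) <n))) (λ ()) $
        seqE $ calcE eX eX (double i) (fit 1 (unit (≤-trans (^-monoʳ-≤ 2 i<L) 2^L≤K))) $
        seqE $ calcE eS refl (+-comm i 1) (fit 1 (unit (≤-trans (≤-trans i<L (<⇒≤ (n<2^n L))) 2^L≤K))) $
        calcE refl eN refl (bit≤ (does (2 ^ suc i <? n))) $
        logLoopE r (suc i) (trans (+-suc r i) r+i) h refl refl eN refl κ
        where
        i<L : i < L
        i<L = subst (suc i ≤_) r+i (s≤s (m≤n+m i r))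

    quotient : ∀ x → (8 * x) / 8 ≡ x
    quotient x = trans (cong (_/ 8) (*-comm 8 x)) (m*n/n≡m x 8)

    setupE : (∀ ρ′ → Conf [] zeroTable 0 0 ρ′ (λ _ → 0) → Q ρ′ (λ _ → 0)) →
             Exec setup (λ _ → 0) (λ _ → 0) (13 + (w * 3 + L * 4)) Q
    setupE {Q = Q} κ =
      weaken (≤-reflexive (lem (w * 3) (L * 4))) $
      seqE $ calcE refl refl refl 1<2^w $
      seqE $ wordLoopE w 0 (+-identityʳ w) (refl , refl , refl , refl , refl , tt) (sym (truncate-< 1<2^w)) refl
        λ ρ₁ (eS , e₁ , e₂ , e₃ , e₄ , _) eW →
      seqE $ calcE refl refl refl 1<2^w $
      seqE $ askE refl refl (fit 1 (unit n≤K)) $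
      seqE $ calcE refl refl refl (bit≤ (does (1 <? n))) $
      seqE $ logLoopE L 0 (+-identityʳ L) (eW , e₁ , e₂ , e₃ , e₄ , tt) refl eS refl refl
        λ ρ₂ (eW , e₁ , e₂ , e₃ , e₄ , _) eS →
      seqE $ calcE eW refl (trans (cong (_/ 8) w≡) (quotient (t + L + 1))) (≤-<-trans (≤-trans (m≤n*m (t + L + 1) 8) (≤-reflexive (sym w≡))) (n<2^n w)) $
      seqE $ calcE refl eS b-value (≤-<-trans b≤w (n<2^n w)) $
      seqE $ calcE eW refl (trans (quo≡ w w b) (sym k≡)) (≤-<-trans (≤-trans (m≤m*n k b) kb≤w) (n<2^n w)) $
      seqE $ calcE refl refl (*-identityˡ (2 ^ b)) (fit 2 2^b≤2K) $
      seqE $ calcE refl refl (sym F≡) (fit 4 F≤) $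
      seqE $ calcE refl refl refl 1<2^w $
      calcE refl refl refl 1<2^w $
      κ _ (record
        { regsOK = refl , refl , refl , refl , e₁ , e₂ , refl , e₃ , e₄ , refl , tt
        ; stackOK = tt
        -- The zero memory already represents `zeroTable` with base 0.
        ; tableOK = λ D → digit-zero (⟦ D ⟧ % k)
        ; wordsOK = λ _ → m^n>0 B k })
      where
      lem : ∀ x y → 1 + (suc x + (1 + (1 + (1 + (suc y + 7))))) ≡ 13 + (x + y)
      lem = solve-∀
      -- An eighth of the word length is t + L + 1; removing L, which the program has just computed,
      -- leaves t + 1.
      b-value : t + L + 1 ∸ L ≡ b
      b-value = trans (cong (_∸ L) (trans (+-comm (t + L) 1) (cong suc (+-comm t L))))
        (trans (cong (_∸ L) (sym (+-suc L t))) (trans (m+n∸m≡n L (suc t)) (sym b≡)))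

    -- The summand 11 consists of the last iteration with 9 steps, its test, and the failing test
    -- after it.
    runTime : ℕ
    runTime = 13 + (w * 3 + L * 4) + (forestTime t 0 0 roots + 11)

    -- `rBase` is the output register 0, and for the empty path the base is the only entry of the
    -- table.
    runE : Exec (setup ⨾ main) (λ _ → 0) (λ _ → 0) runTime (λ ρ μ → ρ rBase ≡ γ)
    runE = seqE $ setupE λ ρ₁ conf →
      simulate-forest t [] roots zeroTable 0 [] child⇒parent refl (≤ᵇ⇒≤ 2 4 tt) (λ _ _ → z≤n)
        {α = 0} (λ _ → z≤n) vertices-length (λ i _ → refl) refl conf λ ρ₂ μ₂ conf₂ un →
      whileE₁ (running conf₂) (λ ()) $ finishE ≤-refl conf₂ λ ρ₃ μ₃ er eβ →
      whileE₀ er eβ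

    solves : ∃ λ τ → Computes solver (oracle I) w γ τ ((30 + m) * w) × τ ≤ runTime
    solves = computes runE

-- Time and space

n≤2^⌈log₂n⌉ : ∀ n → n ≤ 2 ^ ⌈log₂ n ⌉
n≤2^⌈log₂n⌉ n = go n n ≤-refl
  where
  go : ∀ f n → n ≤ f → n ≤ 2 ^ ⌈log₂ n ⌉
  go f       zero                _        = z≤n
  go f       (suc zero)          _        = ≤-refl
  go (suc f) n@(suc (suc n-2)) (s≤s n-1≤f) = begin
    n                              ≡⟨ ⌊n/2⌋+⌈n/2⌉≡n n ⟨
    ⌊ n /2⌋ + ⌈ n /2⌉              ≤⟨ +-monoˡ-≤ ⌈ n /2⌉ (⌊n/2⌋≤⌈n/2⌉ n) ⟩
    ⌈ n /2⌉ + ⌈ n /2⌉              ≡⟨ cong (⌈ n /2⌉ +_) (+-identityʳ ⌈ n /2⌉) ⟨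
    2 * ⌈ n /2⌉                    ≤⟨ *-monoʳ-≤ 2 (go f ⌈ n /2⌉ (≤-trans (s≤s⁻¹ (⌈n/2⌉<n n-2)) n-1≤f)) ⟩
    2 ^ suc ⌈log₂ ⌈ n /2⌉ ⌉        ≡⟨ cong (λ l → 2 ^ suc l) (⌈log₂⌈n/2⌉⌉≡⌈log₂n⌉∸1 n) ⟩
    2 ^ suc (⌈log₂ n ⌉ ∸ 1)        ≡⟨ cong (2 ^_) (m+[n∸m]≡n (⌈log₂⌉-mono-≤ {2} {n} (s≤s (s≤s z≤n)))) ⟩
    2 ^ ⌈log₂ n ⌉                  ∎
    where open ≤-Reasoning

⌈log₂⌉-least : ∀ n i → n ≤ 2 ^ i → ⌈log₂ n ⌉ ≤ i
⌈log₂⌉-least n i n≤ = ≤-trans (⌈log₂⌉-mono-≤ n≤) (≤-reflexive (⌈log₂2^n⌉≡n i))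

-- With K = 2 ^ (t + L) the factor 8 in w yields 256 K ≤ 2 ^ w. The memory consists of four stack
-- words for each of t + 1 levels, the packed cells, and one word for the rounding in the division
-- by k.
sizes : ∀ n t L → n ≤ 2 ^ L → Sizes n t
sizes n t L n≤2^L = record
  { w = w ; b = b ; k = k ; cellCount = cellCount ; F = b * 4 ; m = cellCount / k + b * 4 + 1 ; K = K
  ; K≥1 = K≥1 ; 2^t≤K = 2^t≤K ; n≤K = ≤-trans n≤2^L (^-monoʳ-≤ 2 (m≤n+m L t))
  ; 256K≤2^w = 256K≤2^w ; kb≤w = m/n*n≤m w b ; b≤w = b≤w ; t<b = ≤-refl ; F≡ = refl ; cellCount≡ = refl
  ; b≤K = b≤K ; 2^b≤2K = *-monoʳ-≤ 2 2^t≤K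
  ; inMemory = λ {a} a< → subst (suc (a / k + b * 4) ≤_) (+-comm 1 (cellCount / k + b * 4))
                 (s≤s (+-monoˡ-≤ (b * 4) (/-monoˡ-≤ k (<⇒≤ a<))))
  ; m≤ = ≤-trans (+-mono-≤ (+-mono-≤ (≤-trans (m/n≤m cellCount k) (*-monoʳ-≤ 8 2^t≤K)) (*-monoˡ-≤ 4 b≤K)) K≥1)
           (≤-reflexive (lem K)) }
  where
  w b k cellCount K : ℕ
  w = 8 * (t + L + 1)
  b = suc t
  cellCount = 8 * 2 ^ t
  K = 2 ^ (t + L)
  b≤w : b ≤ w
  b≤w = ≤-trans (≤-trans (≤-reflexive (+-comm 1 t)) (+-monoˡ-≤ 1 (m≤m+n t L))) (m≤n*m (t + L + 1) 8)
  k = w / b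
  instance
    k≢0 : NonZero k
    k≢0 = >-nonZero (m≥n⇒m/n>0 b≤w)
  K≥1 : 1 ≤ K
  K≥1 = m^n>0 2 (t + L)
  2^t≤K : 2 ^ t ≤ K
  2^t≤K = ^-monoʳ-≤ 2 (m≤m+n t L)
  b≤K : b ≤ K
  b≤K = ≤-trans (n<2^n t) 2^t≤K
  256K≤2^w : 256 * K ≤ 2 ^ w
  256K≤2^w = begin
    2 ^ 8 * 2 ^ (t + L)      ≡⟨ ^-distribˡ-+-* 2 8 (t + L) ⟨
    2 ^ (8 + (t + L))        ≤⟨ ^-monoʳ-≤ 2 (≤-trans (+-monoʳ-≤ 8 (m≤n*m (t + L) 8)) (≤-reflexive (sym (trans (cong (8 *_) (+-comm (t + L) 1)) (*-suc 8 (t + L)))))) ⟩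
    2 ^ w                    ∎
    where open ≤-Reasoning
  lem : ∀ K → 8 * K + K * 4 + K ≡ 13 * K
  lem = solve-∀

-- From t to t + 1 the left side grows by the factor 2 (1 + 1/t)², which is at most 3 from t = 5 on;
-- the earlier values are computed.
t²2^t≤4·3^t : ∀ t → t * t * 2 ^ t ≤ 4 * 3 ^ t
t²2^t≤4·3^t 0 = z≤n
t²2^t≤4·3^t 1 = ≤ᵇ⇒≤ 2 12 tt
t²2^t≤4·3^t 2 = ≤ᵇ⇒≤ 16 36 tt
t²2^t≤4·3^t 3 = ≤ᵇ⇒≤ 72 108 tt
t²2^t≤4·3^t 4 = ≤ᵇ⇒≤ 256 324 tt
t²2^t≤4·3^t (suc (suc (suc (suc (suc s))))) = go s
  where
  go : ∀ s → (5 + s) * (5 + s) * 2 ^ (5 + s) ≤ 4 * 3 ^ (5 + s)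
  go zero    = ≤ᵇ⇒≤ 800 972 tt
  go (suc s) = begin
    (6 + s) * (6 + s) * (2 * P)                         ≡⟨ lem₁ s P ⟩
    (72 + 24 * s + 2 * (s * s)) * P                     ≤⟨ *-monoˡ-≤ P (+-mono-≤ (+-mono-≤ (≤ᵇ⇒≤ 72 75 tt) (*-monoˡ-≤ s (≤ᵇ⇒≤ 24 30 tt))) (*-monoˡ-≤ (s * s) (≤ᵇ⇒≤ 2 3 tt))) ⟩
    (75 + 30 * s + 3 * (s * s)) * P                     ≡⟨ lem₂ s P ⟩
    3 * ((5 + s) * (5 + s) * P)                         ≤⟨ *-monoʳ-≤ 3 (go s) ⟩
    3 * (4 * R)                                         ≡⟨ lem₃ R ⟩
    4 * (3 * R)                                         ∎
    where
    open ≤-Reasoning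
    P R : ℕ
    P = 2 ^ (5 + s)
    R = 3 ^ (5 + s)
    lem₁ : ∀ s P → (6 + s) * (6 + s) * (2 * P) ≡ (72 + 24 * s + 2 * (s * s)) * P
    lem₁ = solve-∀
    lem₂ : ∀ s P → (75 + 30 * s + 3 * (s * s)) * P ≡ 3 * ((5 + s) * (5 + s) * P)
    lem₂ = solve-∀
    lem₃ : ∀ R → 3 * (4 * R) ≡ 4 * (3 * R)
    lem₃ = solve-∀

n<3^n : ∀ n → n < 3 ^ n
n<3^n n = <-≤-trans (n<2^n n) (^-monoˡ-≤ n (s≤s (s≤s z≤n)))

-- Total time of the traversal

module Bounds {n : ℕ} (G : Graph n) (F′ : RootedForest n) (td : IsTreedepthDecomposition G F′)
              (t : ℕ) (depth : HasDepth F′ t) (I : InputLists G F′) (sizes : Sizes n t) where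
  open Simulation G F′ td t depth I sizes

  weight : List (Fin n) → ℕ
  weight vs = sum (map (λ v → suc (length (neighbours v))) vs)

  weight-++ : ∀ us vs → weight (us ++ vs) ≡ weight us + weight vs
  weight-++ us vs = trans (cong sum (map-++ _ us vs)) (sum-++ (map _ us) (map _ vs))

  mutual
    -- Double counting: a vertex is charged at most t for itself and its neighbours above, and one
    -- by each proper ancestor within the tree, which may have it as a neighbour below. A tree of h
    -- levels has fewer than h such ancestors.
    weight-tree≤ : ∀ h P v → Lineage (v ∷ P) → length P + h ≡ t → weight (tree h v) ≤ (t + h) * length (tree h v)
    weight-tree≤ zero    P v lin e = z≤n
    weight-tree≤ (suc h) P v lin e = begin
      suc deg + weight (forest h cs)           ≤⟨ +-mono-≤ (s≤s (degree≤ h P v lin e)) (weight-forest≤ h (v ∷ P) cs lin child⇒parent (down v P e)) ⟩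
      suc (length P) + f + (t + h) * f         ≤⟨ +-monoˡ-≤ ((t + h) * f) (+-monoˡ-≤ f (Lineage≤t lin)) ⟩
      t + f + (t + h) * f                      ≤⟨ m≤n+m _ (suc h) ⟩
      suc h + (t + f + (t + h) * f)            ≡⟨ lem t h f ⟩
      (t + suc h) * suc f                      ∎
      where
      open ≤-Reasoning
      cs = children (just v)
      deg f : ℕ
      deg = length (neighbours v)
      f = length (forest h cs)
      lem : ∀ t h f → suc h + (t + f + (t + h) * f) ≡ (t + suc h) * suc f
      lem = solve-∀

    weight-forest≤ : ∀ h P cs → Lineage P → (∀ {c} → c ∈ cs → parent F′ c ≡ head P) → length P + h ≡ t →
                     weight (forest h cs) ≤ (t + h) * length (forest h cs)
    weight-forest≤ h P []       lin par e = z≤n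
    weight-forest≤ h P (c ∷ cs) lin par e = begin
      weight (tree h c ++ forest h cs)                                        ≡⟨ weight-++ (tree h c) (forest h cs) ⟩
      weight (tree h c) + weight (forest h cs)                                ≤⟨ +-mono-≤ (weight-tree≤ h P c (par (here refl) ∷ lin) e) (weight-forest≤ h P cs lin (par ∘ there) e) ⟩
      (t + h) * length (tree h c) + (t + h) * length (forest h cs)            ≡⟨ *-distribˡ-+ (t + h) (length (tree h c)) _ ⟨
      (t + h) * (length (tree h c) + length (forest h cs))                    ≡⟨ cong ((t + h) *_) (length-++ (tree h c)) ⟨
      (t + h) * length (tree h c ++ forest h cs)                              ∎
      where open ≤-Reasoning

  -- The first term pays for the scans, of which a vertex sees at most 2 ^ h, one per selection
  -- above it within the h levels. The second pays for the table entries.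
  budget : ℕ → ℕ → List (Fin n) → ℕ
  budget h u vs = t * (2 ^ h * weight vs) + 2 ^ u * (3 ^ h * length vs)

  budget-++ : ∀ h u us vs → budget h u us + budget h u vs ≡ budget h u (us ++ vs)
  budget-++ h u us vs =
    trans (lem t (2 ^ h) (weight us) (weight vs) (2 ^ u) (3 ^ h) (length us) (length vs))
      (sym (cong₂ (λ x y → t * (2 ^ h * x) + 2 ^ u * (3 ^ h * y)) (weight-++ us vs) (length-++ us)))
    where
    lem : ∀ t p a b q r c d → t * (p * a) + q * (r * c) + (t * (p * b) + q * (r * d)) ≡ t * (p * (a + b)) + q * (r * (c + d))
    lem = solve-∀

  -- The constant 70 is charged to the z ≥ 1 table entries, which cost 43 steps each; this gives
  -- 113.
  step≤ : ∀ {d} deg {z} → d ≤ t → 1 ≤ z → suc (stepTime d deg z) ≤ 113 * (t * suc deg + z)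
  step≤ {d} deg {z} d≤t 1≤z = begin
    suc (stepTime d deg z)                               ≡⟨ lem₁ d deg z ⟩
    70 * 1 + d * (15 + deg * 7) + z * 43                 ≤⟨ +-monoˡ-≤ (z * 43) (+-mono-≤ (*-monoʳ-≤ 70 1≤z) (*-mono-≤ d≤t (+-monoʳ-≤ 15 (*-monoʳ-≤ deg {7} {15} (≤ᵇ⇒≤ 7 15 tt))))) ⟩
    70 * z + t * (15 + deg * 15) + z * 43                ≤⟨ m≤m+n _ (98 * (t * suc deg)) ⟩
    70 * z + t * (15 + deg * 15) + z * 43 + 98 * (t * suc deg)  ≡⟨ lem₂ t deg z ⟩
    113 * (t * suc deg + z)                              ∎
    where
    open ≤-Reasoning
    lem₁ : ∀ d g z → suc (60 + (3 + (3 + d * (3 + (9 + (3 + g * 7)))) + (3 + z * 43))) ≡ 70 * 1 + d * (15 + g * 7) + z * 43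
    lem₁ = solve-∀
    lem₂ : ∀ t g z → 70 * z + t * (15 + g * 15) + z * 43 + 98 * (t * suc g) ≡ 113 * (t * suc g + z)
    lem₂ = solve-∀

  -- The two choices for v double the size of the table in one case only, so that
  -- the cost per vertex grows by the factor 1 + 2 with each level.
  mutual
    treeTime≤ : ∀ h d u v → d + h ≤ t → treeTime h d u v ≤ 339 * budget h u (tree h v)
    treeTime≤ zero    d u v _  = z≤n
    treeTime≤ (suc h) d u v d+h = begin
      3 * suc (stepTime d deg z) + (forestTime h (suc d) u cs + forestTime h (suc d) (suc u) cs)
        ≤⟨ +-mono-≤ (*-monoʳ-≤ 3 (step≤ deg (≤-trans (m≤m+n d (suc h)) d+h) (m^n>0 2 u)))
             (+-mono-≤ (forestTime≤ h (suc d) u cs d+h′) (forestTime≤ h (suc d) (suc u) cs d+h′)) ⟩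
      3 * (113 * (t * suc deg + z)) + (339 * (t * (p * W) + z * (r * f)) + 339 * (t * (p * W) + 2 * z * (r * f)))
        ≡⟨ lem₁ t deg z p W r f ⟩
      339 * (t * (1 * suc deg) + z * 1 + (t * (2 * p * W) + z * (3 * r * f)))
        ≤⟨ *-monoʳ-≤ 339 (+-monoˡ-≤ (t * (2 * p * W) + z * (3 * r * f))
             (+-mono-≤ (*-monoʳ-≤ t (*-monoˡ-≤ (suc deg) (m^n>0 2 (suc h)))) (*-monoʳ-≤ z (m^n>0 3 (suc h))))) ⟩
      339 * (t * (2 * p * suc deg) + z * (3 * r) + (t * (2 * p * W) + z * (3 * r * f)))
        ≡⟨ cong (339 *_) (lem₂ t deg z (2 * p) W (3 * r) f) ⟩
      339 * (t * (2 * p * (suc deg + W)) + z * (3 * r * suc f))  ∎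
      where
      open ≤-Reasoning
      cs = children (just v)
      deg z p r f W : ℕ
      deg = length (neighbours v)
      z = 2 ^ u
      p = 2 ^ h
      r = 3 ^ h
      f = length (forest h cs)
      W = weight (forest h cs)
      d+h′ : suc d + h ≤ t
      d+h′ = ≤-trans (≤-reflexive (sym (+-suc d h))) d+h
      lem₁ : ∀ t g z p W r f → 3 * (113 * (t * suc g + z)) + (339 * (t * (p * W) + z * (r * f)) + 339 * (t * (p * W) + 2 * z * (r * f)))
             ≡ 339 * (t * (1 * suc g) + z * 1 + (t * (2 * p * W) + z * (3 * r * f)))
      lem₁ = solve-∀
      lem₂ : ∀ t g z p W r f → t * (p * suc g) + z * r + (t * (p * W) + z * (r * f)) ≡ t * (p * (suc g + W)) + z * (r * suc f)
      lem₂ = solve-∀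

    forestTime≤ : ∀ h d u cs → d + h ≤ t → forestTime h d u cs ≤ 339 * budget h u (forest h cs)
    forestTime≤ h d u []       d+h = z≤n
    forestTime≤ h d u (c ∷ cs) d+h = ≤-trans (+-mono-≤ (treeTime≤ h d u c d+h) (forestTime≤ h d u cs d+h))
      (≤-reflexive (trans (sym (*-distribˡ-+ 339 (budget h u (tree h c)) _)) (cong (339 *_) (budget-++ h u (tree h c) (forest h cs)))))

  -- The scans contribute 2 t² 2^t n ≤ 8 · 3^t n and the tables 3^t n, each with the factor 339 = 3
  -- · 113, and 9 · 339 = 3051.
  allTime≤ : forestTime t 0 0 roots ≤ 3051 * (3 ^ t * n)
  allTime≤ = begin
    forestTime t 0 0 roots                                             ≤⟨ forestTime≤ t 0 0 roots ≤-refl ⟩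
    339 * (t * (2 ^ t * weight vs) + 1 * (3 ^ t * length vs))
      ≤⟨ *-monoʳ-≤ 339 (+-mono-≤ (*-monoʳ-≤ t (*-monoʳ-≤ (2 ^ t) W≤)) (*-monoʳ-≤ 1 (*-monoʳ-≤ (3 ^ t) vertices-length))) ⟩
    339 * (t * (2 ^ t * ((t + t) * n)) + 1 * (3 ^ t * n))              ≡⟨ lem₁ t (2 ^ t) n (3 ^ t) ⟩
    339 * (2 * (t * t * 2 ^ t) * n + 3 ^ t * n)                        ≤⟨ *-monoʳ-≤ 339 (+-monoˡ-≤ (3 ^ t * n) (*-monoˡ-≤ n (*-monoʳ-≤ 2 (t²2^t≤4·3^t t)))) ⟩
    339 * (2 * (4 * 3 ^ t) * n + 3 ^ t * n)                            ≡⟨ lem₂ (3 ^ t) n ⟩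
    3051 * (3 ^ t * n)                                                 ∎
    where
    open ≤-Reasoning
    vs = forest t roots
    W≤ : weight vs ≤ (t + t) * n
    W≤ = ≤-trans (weight-forest≤ t [] roots [] child⇒parent refl) (*-monoʳ-≤ (t + t) vertices-length)
    lem₁ : ∀ t p n r → 339 * (t * (p * ((t + t) * n)) + 1 * (r * n)) ≡ 339 * (2 * (t * t * p) * n + r * n)
    lem₁ = solve-∀
    lem₂ : ∀ r n → 339 * (2 * (4 * r) * n + r * n) ≡ 3051 * (r * n)
    lem₂ = solve-∀

-- Rounding in k = w / b wastes at most half a word, so that w ≤ 2 k b and the tables take O(2^t b)
-- bits. Registers and stack are O(t) words of O(t + L) bits, where t² is absorbed by 2^t t.
space≤ : ∀ {n} t L (s : Sizes n t) → 1 ≤ t → let open Sizes s in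
         w ≡ 8 * (t + L + 1) → b ≡ suc t → k ≡ w / b → m ≡ cellCount / k + F + 1 →
         (30 + m) * w ≤ 656 * (2 ^ t * t + t * L)
space≤ t L s 1≤t w≡ b≡ k≡ m≡ = begin
  (30 + m) * w                                            ≡⟨ cong (λ m → (30 + m) * w) m≡ ⟩
  (30 + (cellCount / k + F + 1)) * w                      ≡⟨ cong (λ F → (30 + (cellCount / k + F + 1)) * w) F≡ ⟩
  (30 + (cellCount / k + b * 4 + 1)) * w                  ≡⟨ lem₁ (cellCount / k) b w ⟩
  (31 + b * 4) * w + cellCount / k * w                    ≤⟨ +-mono-≤ (*-mono-≤ (+-mono-≤ (*-monoʳ-≤ 31 1≤t) (*-monoˡ-≤ 4 b≤2t)) w≤) cells≤ ⟩
  (31 * t + (t + t) * 4) * (16 * t + 8 * L) + 16 * 2 ^ t * (t + t)  ≡⟨ lem₂ t L (2 ^ t) ⟩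
  624 * (t * t) + 312 * (t * L) + 32 * (2 ^ t * t)        ≤⟨ +-monoˡ-≤ (32 * (2 ^ t * t)) (+-mono-≤ (*-monoʳ-≤ 624 (*-monoˡ-≤ t (<⇒≤ (n<2^n t)))) (*-monoˡ-≤ (t * L) {312} {656} (≤ᵇ⇒≤ 312 656 tt))) ⟩
  624 * (2 ^ t * t) + 656 * (t * L) + 32 * (2 ^ t * t)    ≡⟨ lem₃ (2 ^ t * t) (t * L) ⟩
  656 * (2 ^ t * t + t * L)                               ∎
  where
  open Sizes s
  open ≤-Reasoning
  b≤2t : b ≤ t + t
  b≤2t = ≤-trans (≤-reflexive b≡) (+-monoˡ-≤ t 1≤t)
  w≤ : w ≤ 16 * t + 8 * L
  w≤ = ≤-trans (≤-reflexive w≡) (≤-trans (*-monoʳ-≤ 8 (+-monoʳ-≤ (t + L) 1≤t)) (≤-reflexive (lem t L)))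
    where
    lem : ∀ t L → 8 * (t + L + t) ≡ 16 * t + 8 * L
    lem = solve-∀
  w≤2kb : w ≤ k * (b + b)
  w≤2kb = begin
    w                    ≡⟨ m≡m%n+[m/n]*n w b ⟩
    w % b + w / b * b    ≡⟨ cong (λ k → w % b + k * b) k≡ ⟨
    w % b + k * b        ≤⟨ +-monoˡ-≤ (k * b) (≤-trans (m%n≤n w b) (m≤n*m b k)) ⟩
    k * b + k * b        ≡⟨ *-distribˡ-+ k b b ⟨
    k * (b + b)          ∎
  cells≤ : cellCount / k * w ≤ 16 * 2 ^ t * (t + t)
  cells≤ = begin
    cellCount / k * w              ≤⟨ *-monoʳ-≤ (cellCount / k) w≤2kb ⟩
    cellCount / k * (k * (b + b))  ≡⟨ *-assoc (cellCount / k) k (b + b) ⟨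
    cellCount / k * k * (b + b)    ≤⟨ *-monoˡ-≤ (b + b) (m/n*n≤m cellCount k) ⟩
    cellCount * (b + b)            ≡⟨ cong (_* (b + b)) cellCount≡ ⟩
    8 * 2 ^ t * (b + b)            ≤⟨ *-monoʳ-≤ (8 * 2 ^ t) (+-mono-≤ b≤2t b≤2t) ⟩
    8 * 2 ^ t * (t + t + (t + t))  ≡⟨ lem (2 ^ t) t ⟩
    16 * 2 ^ t * (t + t)           ∎
    where
    lem : ∀ p t → 8 * p * (t + t + (t + t)) ≡ 16 * p * (t + t)
    lem = solve-∀
  lem₁ : ∀ q b w → (30 + (q + b * 4 + 1)) * w ≡ (31 + b * 4) * w + q * w
  lem₁ = solve-∀
  lem₂ : ∀ t L p → (31 * t + (t + t) * 4) * (16 * t + 8 * L) + 16 * p * (t + t) ≡ 624 * (t * t) + 312 * (t * L) + 32 * (p * t)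
  lem₂ = solve-∀
  lem₃ : ∀ x y → 624 * x + 656 * y + 32 * x ≡ 656 * (x + y)
  lem₃ = solve-∀

setupTime≤ : ∀ t L n f → L ≤ n → 1 ≤ n → f ≤ 3051 * (3 ^ t * n) →
             13 + (8 * (t + L + 1) * 3 + L * 4) + (f + 11) ≤ 3151 * (3 ^ t * n)
setupTime≤ t L n f L≤n 1≤n f≤ = begin
  13 + (8 * (t + L + 1) * 3 + L * 4) + (f + 11)      ≡⟨ lem₁ t L f ⟩
  24 * t + 28 * L + 48 * 1 + f                       ≤⟨ +-mono-≤ (+-mono-≤ (+-mono-≤ (*-monoʳ-≤ 24 t≤) (*-monoʳ-≤ 28 L≤)) (*-monoʳ-≤ 48 1≤)) f≤ ⟩
  24 * x + 28 * x + 48 * x + 3051 * x                ≡⟨ lem₂ x ⟩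
  3151 * x                                           ∎
  where
  open ≤-Reasoning
  x = 3 ^ t * n
  n≤x : n ≤ x
  n≤x = ≤-trans (≤-reflexive (sym (*-identityˡ n))) (*-monoˡ-≤ n (m^n>0 3 t))
  L≤ : L ≤ x
  L≤ = ≤-trans L≤n n≤x
  1≤ : 1 ≤ x
  1≤ = ≤-trans 1≤n n≤x
  t≤ : t ≤ x
  t≤ = ≤-trans (≤-trans (<⇒≤ (n<3^n t)) (≤-reflexive (sym (*-identityʳ (3 ^ t))))) (*-monoʳ-≤ (3 ^ t) 1≤n)
  lem₁ : ∀ t L f → 13 + (8 * (t + L + 1) * 3 + L * 4) + (f + 11) ≡ 24 * t + 28 * L + 48 * 1 + f
  lem₁ = solve-∀
  lem₂ : ∀ x → 24 * x + 28 * x + 48 * x + 3051 * x ≡ 3151 * x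
  lem₂ = solve-∀

-- For t = 1 the factor ⌈log₂ t⌉ vanishes, but then the graph is a single vertex.
module _ {t n : ℕ} (1≤t : 1 ≤ t) (single : t ≤ 1 → n ≤ 1) where

  1≤⌈log₂t⌉ : 1 < t → 1 ≤ ⌈log₂ t ⌉
  1≤⌈log₂t⌉ 1<t = ⌈log₂⌉-mono-≤ {2} {t} 1<t

  private
    time-case : t ≤ 1 ⊎ 1 < t → 3 ^ t * n ≤ 3 * (3 ^ t * ⌈log₂ t ⌉ * n + 1)
    time-case (inj₁ t≤1) = ≤-trans (*-mono-≤ (^-monoʳ-≤ 3 t≤1) (single t≤1)) (*-monoʳ-≤ 3 {1} (m≤n+m 1 (3 ^ t * ⌈log₂ t ⌉ * n)))
    time-case (inj₂ 1<t) = ≤-trans (*-monoˡ-≤ n (≤-trans (≤-reflexive (sym (*-identityʳ (3 ^ t)))) (*-monoʳ-≤ (3 ^ t) (1≤⌈log₂t⌉ 1<t))))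
      (≤-trans (m≤m+n _ 1) (m≤n*m (3 ^ t * ⌈log₂ t ⌉ * n + 1) 3))

    space-case : t ≤ 1 ⊎ 1 < t → 2 ^ t * t ≤ 2 * (2 ^ t * t * ⌈log₂ t ⌉ + 1)
    space-case (inj₁ t≤1) = ≤-trans (*-mono-≤ (^-monoʳ-≤ 2 t≤1) t≤1) (*-monoʳ-≤ 2 {1} (m≤n+m 1 (2 ^ t * t * ⌈log₂ t ⌉)))
    space-case (inj₂ 1<t) = ≤-trans (≤-trans (≤-reflexive (sym (*-identityʳ (2 ^ t * t)))) (*-monoʳ-≤ (2 ^ t * t) (1≤⌈log₂t⌉ 1<t)))
      (≤-trans (m≤m+n _ 1) (m≤n*m (2 ^ t * t * ⌈log₂ t ⌉ + 1) 2))

    split : t ≤ 1 ⊎ 1 < t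
    split = [ inj₂ , (λ e → inj₁ (≤-reflexive (sym e))) ]′ (m≤n⇒m<n∨m≡n 1≤t)

  time-log : 3151 * (3 ^ t * n) ≤ 9453 * (3 ^ t * ⌈log₂ t ⌉ * n + 1)
  time-log = ≤-trans (*-monoʳ-≤ 3151 (time-case split)) (≤-reflexive (lem (3 ^ t * ⌈log₂ t ⌉ * n + 1)))
    where
    lem : ∀ x → 3151 * (3 * x) ≡ 9453 * x
    lem = solve-∀

  space-log : ∀ L → 656 * (2 ^ t * t + t * L) ≤ 9453 * (2 ^ t * t * ⌈log₂ t ⌉ + t * L + 1)
  space-log L = begin
    656 * (2 ^ t * t + t * L)        ≤⟨ *-monoʳ-≤ 656 (+-monoˡ-≤ (t * L) (space-case split)) ⟩
    656 * (2 * (z + 1) + t * L)      ≤⟨ m≤m+n _ (656 * (t * L)) ⟩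
    656 * (2 * (z + 1) + t * L) + 656 * (t * L)  ≡⟨ lem z (t * L) ⟩
    1312 * (z + t * L + 1)           ≤⟨ *-monoˡ-≤ (z + t * L + 1) (≤ᵇ⇒≤ 1312 9453 tt) ⟩
    9453 * (z + t * L + 1)           ∎
    where
    open ≤-Reasoning
    z = 2 ^ t * t * ⌈log₂ t ⌉
    lem : ∀ z y → 656 * (2 * (z + 1) + y) + 656 * y ≡ 1312 * (z + y + 1)
    lem = solve-∀

theorem4p5 : Σ Program λ P → ∃ λ (κ : ℕ) → ∃ λ (c : ℕ) →
    ∀ (n : ℕ) (G : Graph n) → Connected G →
    ∀ (T : RootedForest n) → IsTreedepthDecomposition G T →
    ∀ (t : ℕ) → HasDepth T t →
    ∀ (I : InputLists G T) →
    ∃ λ (γ : ℕ) → ∃ λ (τ : ℕ) → ∃ λ (σ : ℕ) →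
    IsMinDominatingSetSize G γ ×
    Computes P (oracle I) (κ * (t + ⌈log₂ n ⌉ + 1)) γ τ σ ×
    τ ≤ c * (3 ^ t * ⌈log₂ t ⌉ * n + 1) ×
    σ ≤ c * (2 ^ t * t * ⌈log₂ t ⌉ + t * ⌈log₂ n ⌉ + 1)
-- The factor 8 is the one that `setup` divides by. The constant 9453 = 3 · 3151 stems from the
-- time, where the case t = 1 costs the factor 3, and it exceeds the 1312 of the space bound.
theorem4p5 = solver , 8 , 9453 , λ n G conn T td t depth I →
  let L = ⌈log₂ n ⌉
      n≤2^L = n≤2^⌈log₂n⌉ n
      s = sizes n t L n≤2^L
      1≤t = positive (proj₂ (proj₂ (proj₁ depth)))
      1≤n = ≤-trans (s≤s z≤n) (toℕ<n (proj₁ conn))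
      single = Forest.depth-1 G T td t depth I conn
      τ , computed , τ≤ = Run.solves G T td t depth I s L n≤2^L (⌈log₂⌉-least n) refl refl refl (^-monoʳ-≤ 2 (m≤n+m L t))
  in Forest.γ G T td t depth I , τ , _ , Forest.γ-correct G T td t depth I , computed ,
     ≤-trans τ≤ (≤-trans (setupTime≤ t L n _ (⌈log₂⌉-least n n (<⇒≤ (n<2^n n))) 1≤n (Bounds.allTime≤ G T td t depth I s)) (time-log 1≤t single)) ,
     ≤-trans (space≤ t L s 1≤t refl refl refl refl) (space-log {n = n} 1≤t single L)
  where
  positive : ∀ {n} {parent : Fin n → Maybe (Fin n)} {v k} → RootPath parent v k → 1 ≤ k
  positive (root _)   = s≤s z≤n
  positive (step _ _) = s≤s z≤n
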